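{- Let $n$ and $l$ be integers with $n\ge 3$ and $l\ge 2$. (i) If $l\ge 4$ and $l$ is even, then $\mathrm{ex}(CT_n,C_{2l})=O(n^{ -1+\frac{2}{l}})\,e(CT_n)$. (ii) If $l\ge 4$ and $l$ is odd, then $\mathrm{ex}(CT_n,C_{2l})=O(n^{ -\frac{1}{l}})\,e(CT_n)$ if $l=7$, and $\mathrm{ex}(CT_n,C_{2l})=O(n^{ -\frac{1}{8}+\frac{1}{4(l-3)}})\,e(CT_n)$ otherwise. (iii) If $l=3$, then $\mathrm{ex}(CT_n,C_{6})\le(\sqrt{2}-1+o(1))\,e(CT_n)$. (iv) If $l=2$, then $\mathrm{ex}(CT_n,C_{4})\le\frac{3}{4}e(CT_n)$.
   Context: $\mathrm{S}_n$ is the symmetric group on $\{1,\dots,n\}$. The complete transposition graph $CT_n$ is the Cayley graph on $\mathrm{S}_n$ whose connection set is the set of all transpositions: vertex set $\mathrm{S}_n$, and $x,y$ adjacent iff $y=ux$ for some transposition $u$. It is an $\binom n2$-regular bipartite graph with $n!$ vertices and $e(CT_n)=\frac{n!}{2}\binom n2$ edges. For graphs $G,H$, $\mathrm{ex}(G,H)$ is the maximum number of edges in an $H$-free spanning subgraph of $G$ (no subgraph isomorphic to $H$). $C_m$ denotes the cycle of length $m$. Asymptotic notation is as $n\to\infty$ with $l$ fixed (implied constants depend only on $l$). -}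

module Defs where

open import Data.Nat using (ℕ; zero; suc; _+_; _*_; _∸_; _^_; _≤_; _/_; _!)
open import Data.Nat.Combinatorics using (_C_)
open import Data.Fin using (Fin; zero; suc; inject₁; fromℕ)
open import Data.Fin.Permutation.Components using (transpose)
open import Data.Vec using (Vec; lookup; map)
open import Data.List using (List; length)
open import Data.List.Membership.Propositional using (_∈_)
open import Data.List.Relation.Unary.All using (All)
open import Data.List.Relation.Unary.AllPairs using (AllPairs)
open import Data.Product using (Σ; _×_; _,_; ∃₂)
open import Data.Sum using (_⊎_)
open import Data.Empty using (⊥)
open import Relation.Binary.PropositionalEquality using (_≡_; _≢_)
open import Relation.Nullary using (¬_)
open import Function.Definitions using (Injective)

-- An element of S_n, written as its table of values: v represents the
-- map k ↦ lookup v k.  Vectors have extensional (decidable) equality.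
Vertex : ℕ → Set
Vertex n = Vec (Fin n) n

IsPerm : ∀ {n} → Vertex n → Set
IsPerm {n} v = ∀ (i j : Fin n) → lookup v i ≡ lookup v j → i ≡ j

Adjacent : ∀ {n} → Vertex n → Vertex n → Set
Adjacent {n} x y = ∃₂ λ (i j : Fin n) → i ≢ j × y ≡ map (transpose i j) x

Edge : ℕ → Set
Edge n = Vertex n × Vertex n

IsCTEdge : ∀ {n} → Edge n → Set
IsCTEdge (x , y) = IsPerm x × IsPerm y × Adjacent x y

SameEdge : ∀ {n} → Edge n → Edge n → Set
SameEdge (x , y) (x' , y') = (x ≡ x' × y ≡ y') ⊎ (x ≡ y' × y ≡ x')

-- A spanning subgraph of CT_n, given by its edge set: a list of edges of
-- CT_n, no edge listed twice.  Its number of edges is the list length.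
record SubgraphCT (n : ℕ) : Set where
  field
    edges    : List (Edge n)
    areEdges : All IsCTEdge edges
    distinct : AllPairs (λ e e' → ¬ SameEdge e e') edges
open SubgraphCT public

numEdges : ∀ {n} → SubgraphCT n → ℕ
numEdges F = length (edges F)

EdgeIn : ∀ {n} → SubgraphCT n → Vertex n → Vertex n → Set
EdgeIn F x y = (x , y) ∈ edges F ⊎ (y , x) ∈ edges F

-- F contains a cycle of length suc k (used for k + 1 ≥ 3):
-- suc k distinct vertices f 0, …, f k with f i ~ f (i+1) and f k ~ f 0.
HasCycle : ∀ {n} → SubgraphCT n → ℕ → Set
HasCycle {n} F zero = ⊥
HasCycle {n} F (suc k) =
  Σ (Fin (suc k) → Vertex n) λ f →
      Injective _≡_ _≡_ f
    × (∀ (i : Fin k) → EdgeIn F (f (inject₁ i)) (f (suc i)))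
    × EdgeIn F (f (fromℕ k)) (f zero)

CycleFree : ∀ {n} → ℕ → SubgraphCT n → Set
CycleFree m F = ¬ HasCycle F m

-- e(CT_n) = n!/2 · C(n,2)   (exact for n ≥ 2)
eCT : ℕ → ℕ
eCT n = (n ! * (n C 2)) / 2

-- "x ≤ C · n^(-a/k) · e" for natural numbers, written without real
-- exponents:  x^k · n^a ≤ (C · e)^k   (equivalent since all are ≥ 0).
PowBound : (x C n a k e : ℕ) → Set
PowBound x C n a k e = x ^ k * n ^ a ≤ (C * e) ^ k

{-# OPTIONS --safe #-}

-- For a vertex x let the link H_x be the graph on the transpositions in which disjoint u, v are
-- joined when F contains the path ux, uvx, vx.  A cycle of length m in H_x lifts to a cycle of
-- length 2m in F, and the edges of all links together are the pairs of F-edges u, v at a common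
-- vertex with u, v disjoint, so bounds on the links bound the sum of the squared degrees of F.
--
-- (i)   If 4k is forbidden, then no H_x has a 2k-cycle, and Bondy–Simonovits applies to H_x.
-- (ii)  By Bondy–Simonovits most pairs of edges lie in a lifted 8-cycle and in a lifted 4k-cycle.
--       Hence some edge {y, vy} lies in an 8-cycle lifted from the link of uy and in a 4k-cycle
--       lifted from the link of u′vy which share nothing else; without that edge they form a
--       cycle of length 4k + 6.  This gives the bound O(n^(-1/2)), which implies the stated ones.
-- (iii) H_x is triangle-free, and each vertex of H_x has at most one neighbour among the F-edges
--       at x, so Mantel's theorem applies to the remaining N − d(x) vertices.
-- (iv)  Average over the 4-cycles x, ux, vux, vx.
--
-- Bondy–Simonovits: between consecutive levels of a breadth-first search tree a dense part would
-- contain, for the largest height h of a meeting point of two of its vertices b, c with a common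
-- neighbour y, a path of length 2(k − h) − 1 from y to a vertex p avoiding b and c; one of b, c
-- meets p exactly at height h, which closes a 2k-cycle.  So the levels grow geometrically.

module Submission where

open import Defs
open import Data.Bool using (Bool; true; false; T)
open import Data.Bool.Properties using (T?)
open import Data.Empty using (⊥; ⊥-elim)
open import Data.Fin using (Fin; zero; suc; inject₁; fromℕ) renaming (_<_ to _<ᶠ_)
open import Data.Fin.Permutation.Components using (transpose)
import Data.Fin.Properties as Fin
open import Data.List as List using (List; []; _∷_; _++_; [_]; map; length; filter; allFin; concatMap; tabulate)
import Data.List.Membership.DecPropositional as DecMembership
open import Data.List.Membership.Propositional using (_∈_; _∉_; find; lose)
open import Data.List.Membership.Propositional.Properties using (∈-∃++; ∈-++⁺ˡ; ∈-++⁺ʳ; ∈-++⁻; ∈-map⁻; ∈-map⁺; ∈-filter⁻; ∈-filter⁺; ∈-allFin; ∈-tabulate⁻; ∈-tabulate⁺; ∈-concatMap⁻; ∈-concatMap⁺; ∈-lookup)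
open import Data.List.Properties using (length-++; length-map; length-tabulate)
open import Data.List.Relation.Binary.Permutation.Propositional using (_↭_; prep; swap; ↭-sym) renaming (refl to ↭-rfl; trans to ↭-tr)
open import Data.List.Relation.Binary.Permutation.Propositional.Properties using (shift; ↭-length; ∈-resp-↭; ∷↭∷ʳ)
open import Data.List.Relation.Unary.All as All using (All; []; _∷_)
open import Data.List.Relation.Unary.All.Properties using (¬Any⇒All¬) renaming (++⁺ to All-++⁺)
open import Data.List.Relation.Unary.AllPairs as AllPairs using (AllPairs; []; _∷_)
open import Data.List.Relation.Unary.Any as Any using (Any; here; there)
import Data.List.Relation.Unary.Unique.DecPropositional as DecUnique
open import Data.List.Relation.Unary.Unique.Propositional using (Unique)
open import Data.List.Relation.Unary.Unique.Propositional.Properties using (Unique[x∷xs]⇒x∉xs; allFin⁺) renaming (map⁺ to Unique-map⁺; ++⁺ to Unique-++⁺; filter⁺ to Unique-filter⁺; tabulate⁺ to Unique-tabulate⁺)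
open import Data.Nat using (ℕ; zero; suc; _+_; _*_; _∸_; _^_; _!; _≤_; _<_; z≤n; s≤s; _≤?_; _<?_; NonZero; >-nonZero)
open import Data.Nat.Combinatorics using (nCk+nC[k+1]≡[n+1]C[k+1]; nC1≡n) renaming (_C_ to _choose_)
open import Data.Nat.DivMod using (m/n*n≡m)
open import Data.Nat.Divisibility using (_∣_; divides; m∣m*n; ∣-trans; m≤n⇒m!∣n!)
import Data.Nat.Properties as ℕₚ
open import Data.Nat.Properties hiding (_≟_)
open import Data.Nat.Tactic.RingSolver using (solve-∀)
open import Data.Product as Prod using (Σ; ∃; ∃₂; _×_; _,_; proj₁; proj₂)
import Data.Product.Properties as Prodₚ
open import Data.Sum using (_⊎_; inj₁; inj₂)
open import Data.Sum.Properties using (inj₁-injective; inj₂-injective; ≡-dec)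
open import Data.Unit using (tt)
open import Data.Vec as Vec using (Vec; []; _∷_; lookup)
import Data.Vec.Properties as Vecₚ
open import Function using (_∘_; id)
open import Relation.Binary.Definitions using (DecidableEquality)
open import Relation.Binary.PropositionalEquality using (_≡_; _≢_; refl; sym; trans; cong; cong₂; subst; subst₂; ≢-sym; module ≡-Reasoning)
open import Relation.Nullary using (¬_; Dec; yes; no; does)
open import Relation.Nullary.Decidable using (_×-dec_; _⊎-dec_; ¬?; decidable-stable; dec-true; dec-false; map′)

-- Finite sums

-- Only disjoint pairs enter the link because they commute and their product determines them, which
-- keeps the vertices of a lifted cycle distinct. The pairs given up number at most `4 * n` per edge
-- end, little against roughly n²/2 transpositions. For odd l the argument of (i) breaks down: a
-- complete bipartite link has no l-cycle, however dense it is. Even link cycles lift to lengths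
-- divisible by four, and joining two of them along an edge that is then dropped gives a length that
-- is 2 modulo 4. The shortest one available is 14 = 8 + 8 - 2; for l = 5 the claimed exponent is 0.
-- The two lifts have different centres, so that an entry moved in one and kept in the other tells
-- their vertices apart. The exponent -1/2 comes from the pairs on no suitable link cycle: O(nN) of
-- them at each centre, with N the number of transpositions, which allows degrees of order √(nN), a
-- fraction n^(-1/2) of N. In (iii) let δ be the edge density. Mantel's bound and Cauchy-Schwarz
-- give δ² + 2δ ≤ 1 + o(1), and √2 - 1 is the positive root of (δ + 1)² = 2.

variable
  A B : Set

⟦_⟧ : Bool → ℕ
⟦ true ⟧ = 1
⟦ false ⟧ = 0

∑ : List A → (A → ℕ) → ℕ
∑ [] f = 0
∑ (x ∷ xs) f = f x + ∑ xs f

syntax ∑ xs (λ x → e) = ∑[ x ∈ xs ] e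
infix 5 ∑

∑-mono : (xs : List A) {f g : A → ℕ} → (∀ {x} → x ∈ xs → f x ≤ g x) → ∑ xs f ≤ ∑ xs g
∑-mono [] le = z≤n
∑-mono (x ∷ xs) le = +-mono-≤ (le (here refl)) (∑-mono xs (le ∘ there))

∑-cong : (xs : List A) {f g : A → ℕ} → (∀ {x} → x ∈ xs → f x ≡ g x) → ∑ xs f ≡ ∑ xs g
∑-cong xs eq = ≤-antisym (∑-mono xs (≤-reflexive ∘ eq)) (∑-mono xs (≤-reflexive ∘ sym ∘ eq))

∑-+ : (xs : List A) (f g : A → ℕ) → ∑[ x ∈ xs ] (f x + g x) ≡ ∑ xs f + ∑ xs g
∑-+ [] f g = refl
∑-+ (x ∷ xs) f g = trans (cong (f x + g x +_) (∑-+ xs f g)) (lemma (f x) (g x) (∑ xs f) (∑ xs g))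
  where
  lemma : ∀ a b c d → a + b + (c + d) ≡ a + c + (b + d)
  lemma = solve-∀

∑-*ˡ : (xs : List A) (c : ℕ) (f : A → ℕ) → ∑[ x ∈ xs ] (c * f x) ≡ c * ∑ xs f
∑-*ˡ [] c f = sym (*-zeroʳ c)
∑-*ˡ (x ∷ xs) c f = trans (cong (c * f x +_) (∑-*ˡ xs c f)) (sym (*-distribˡ-+ c (f x) _))

∑-*ʳ : (xs : List A) (c : ℕ) (f : A → ℕ) → ∑[ x ∈ xs ] (f x * c) ≡ ∑ xs f * c
∑-*ʳ xs c f = trans (∑-cong xs (λ {x} _ → *-comm (f x) c)) (trans (∑-*ˡ xs c f) (*-comm c _))

∑-const : (xs : List A) (c : ℕ) → ∑[ _ ∈ xs ] c ≡ length xs * c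
∑-const [] c = refl
∑-const (x ∷ xs) c = cong (c +_) (∑-const xs c)

∑-≤-const : (xs : List A) {f : A → ℕ} (c : ℕ) → (∀ {x} → x ∈ xs → f x ≤ c) → ∑ xs f ≤ length xs * c
∑-≤-const xs c le = ≤-trans (∑-mono xs le) (≤-reflexive (∑-const xs c))

∑-++ : (xs ys : List A) (f : A → ℕ) → ∑ (xs ++ ys) f ≡ ∑ xs f + ∑ ys f
∑-++ [] ys f = refl
∑-++ (x ∷ xs) ys f = trans (cong (f x +_) (∑-++ xs ys f)) (sym (+-assoc (f x) _ _))

∑-map : (φ : A → B) (xs : List A) (f : B → ℕ) → ∑ (map φ xs) f ≡ ∑ xs (f ∘ φ)
∑-map φ [] f = refl
∑-map φ (x ∷ xs) f = cong (f (φ x) +_) (∑-map φ xs f)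

∑-swap : (xs : List A) (ys : List B) (f : A → B → ℕ) →
         ∑[ x ∈ xs ] ∑[ y ∈ ys ] f x y ≡ ∑[ y ∈ ys ] ∑[ x ∈ xs ] f x y
∑-swap [] ys f = sym (trans (∑-const ys 0) (*-zeroʳ (length ys)))
∑-swap (x ∷ xs) ys f = trans (cong (∑ ys (f x) +_) (∑-swap xs ys f)) (sym (∑-+ ys (f x) _))

∑-↭ : {xs ys : List A} (f : A → ℕ) → xs ↭ ys → ∑ xs f ≡ ∑ ys f
∑-↭ f ↭-rfl = refl
∑-↭ f (prep x p) = cong (f x +_) (∑-↭ f p)
∑-↭ f (swap {xs} {ys} x y p) = trans (cong (λ z → f x + (f y + z)) (∑-↭ f p)) (lemma (f x) (f y) _)
  where
  lemma : ∀ a b c → a + (b + c) ≡ b + (a + c)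
  lemma = solve-∀
∑-↭ f (↭-tr p q) = trans (∑-↭ f p) (∑-↭ f q)

∑-filter : {P : A → Set} (P? : ∀ x → Dec (P x)) (xs : List A) (f : A → ℕ) →
           ∑ (filter P? xs) f ≡ ∑[ x ∈ xs ] (⟦ does (P? x) ⟧ * f x)
∑-filter P? [] f = refl
∑-filter P? (x ∷ xs) f with does (P? x)
... | true = cong₂ _+_ (sym (+-identityʳ (f x))) (∑-filter P? xs f)
... | false = ∑-filter P? xs f

length-filter-∑ : {P : A → Set} (P? : ∀ x → Dec (P x)) (xs : List A) →
                length (filter P? xs) ≡ ∑[ x ∈ xs ] ⟦ does (P? x) ⟧
length-filter-∑ P? [] = refl
length-filter-∑ P? (x ∷ xs) with does (P? x)
... | true = cong suc (length-filter-∑ P? xs)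
... | false = length-filter-∑ P? xs

∑-product : (xs : List A) (ys : List B) (f : A → ℕ) (g : B → ℕ) →
            ∑[ x ∈ xs ] ∑[ y ∈ ys ] (f x * g y) ≡ ∑ xs f * ∑ ys g
∑-product xs ys f g = trans (∑-cong xs (λ {x} _ → ∑-*ˡ ys (f x) g)) (∑-*ʳ xs (∑ ys g) f)

Unique-resp-↭ : {xs ys : List A} → xs ↭ ys → Unique xs → Unique ys
Unique-resp-↭ ↭-rfl u = u
Unique-resp-↭ (prep x p) (x∉ ∷ u) =
  All.tabulate (λ z∈ → All.lookup x∉ (∈-resp-↭ (↭-sym p) z∈)) ∷ Unique-resp-↭ p u
Unique-resp-↭ (swap x y p) ((x≢y ∷ x∉) ∷ y∉ ∷ u) =
  ((x≢y ∘ sym) ∷ All.tabulate (λ z∈ → All.lookup y∉ (∈-resp-↭ (↭-sym p) z∈)))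
  ∷ All.tabulate (λ z∈ → All.lookup x∉ (∈-resp-↭ (↭-sym p) z∈))
  ∷ Unique-resp-↭ p u
Unique-resp-↭ (↭-tr p q) u = Unique-resp-↭ q (Unique-resp-↭ p u)

∈⇒↭ : {x : A} {xs : List A} → x ∈ xs → ∃ λ ys → xs ↭ x ∷ ys
∈⇒↭ {x = x} x∈ with ∈-∃++ x∈
... | ys , zs , refl = ys ++ zs , shift x ys zs

∑-⊆ : {xs ys : List A} (f : A → ℕ) → Unique xs → (∀ {x} → x ∈ xs → x ∈ ys) → ∑ xs f ≤ ∑ ys f
∑-⊆ {xs = []} f u sub = z≤n
∑-⊆ {xs = x ∷ xs} {ys} f u@(_ ∷ u′) sub with ∈⇒↭ (sub (here refl))
... | zs , p = ≤-trans (+-monoʳ-≤ (f x) (∑-⊆ f u′ sub′)) (≤-reflexive (sym (∑-↭ f p)))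
  where
  sub′ : ∀ {z} → z ∈ xs → z ∈ zs
  sub′ z∈ with ∈-resp-↭ p (sub (there z∈))
  ... | here refl = ⊥-elim (Unique[x∷xs]⇒x∉xs u z∈)
  ... | there w = w

length-∑ : (xs : List A) → length xs ≡ ∑[ _ ∈ xs ] 1
length-∑ xs = sym (trans (∑-const xs 1) (*-identityʳ _))

length-⊆ : {xs ys : List A} → Unique xs → (∀ {x} → x ∈ xs → x ∈ ys) → length xs ≤ length ys
length-⊆ {xs = xs} {ys} u sub = begin
  length xs       ≡⟨ length-∑ xs ⟩
  ∑[ _ ∈ xs ] 1   ≤⟨ ∑-⊆ (λ _ → 1) u sub ⟩
  ∑[ _ ∈ ys ] 1   ≡⟨ sym (length-∑ ys) ⟩
  length ys       ∎
  where open ≤-Reasoning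

Unique-map-on : {xs : List A} (φ : A → B) → (∀ {x y} → x ∈ xs → y ∈ xs → φ x ≡ φ y → x ≡ y) →
                Unique xs → Unique (map φ xs)
Unique-map-on {xs = []} φ inj [] = []
Unique-map-on {xs = x ∷ xs} φ inj (x∉ ∷ u) =
  All.tabulate (λ z∈ e → let y , y∈ , eq = ∈-map⁻ φ z∈ in
    All.lookup x∉ y∈ (inj (here refl) (there y∈) (trans e eq)))
  ∷ Unique-map-on φ (λ p q → inj (there p) (there q)) u

-- Injectivity and `∑-⊆` give one inequality; the same inequality for `f ∘ φ` gives the other. This
-- is the substitution rule for sums over permutations and over transpositions.
∑-involution : {xs : List A} (φ : A → A) → Unique xs → (∀ {x} → x ∈ xs → φ x ∈ xs) →
               (∀ {x} → x ∈ xs → φ (φ x) ≡ x) → (f : A → ℕ) → ∑[ x ∈ xs ] f (φ x) ≡ ∑ xs f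
∑-involution {xs = xs} φ u closed inv f = ≤-antisym (half f) (≤-trans (≤-reflexive (sym twice)) (half (f ∘ φ)))
  where
  closed-map : ∀ {z} → z ∈ map φ xs → z ∈ xs
  closed-map z∈ with ∈-map⁻ φ z∈
  ... | y , y∈ , refl = closed y∈
  inj : ∀ {x y} → x ∈ xs → y ∈ xs → φ x ≡ φ y → x ≡ y
  inj p q e = trans (sym (inv p)) (trans (cong φ e) (inv q))
  half : ∀ g → ∑[ x ∈ xs ] g (φ x) ≤ ∑ xs g
  half g = ≤-trans (≤-reflexive (sym (∑-map φ xs g))) (∑-⊆ g (Unique-map-on φ inj u) closed-map)
  twice : ∑[ x ∈ xs ] f (φ (φ x)) ≡ ∑ xs f
  twice = ∑-cong xs (λ x∈ → cong f (inv x∈))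

2mn≤m²+n² : ∀ m n → 2 * (m * n) ≤ m * m + n * n
2mn≤m²+n² m n with ≤-total m n
... | inj₁ m≤n with m≤n⇒∃[o]m+o≡n m≤n
... | o , refl = ≤-trans (m≤m+n _ (o * o)) (≤-reflexive (lemma m o))
  where
  lemma : ∀ m o → 2 * (m * (m + o)) + o * o ≡ m * m + (m + o) * (m + o)
  lemma = solve-∀
2mn≤m²+n² m n | inj₂ n≤m with m≤n⇒∃[o]m+o≡n n≤m
... | o , refl = ≤-trans (m≤m+n _ (o * o)) (≤-reflexive (lemma n o))
  where
  lemma : ∀ n o → 2 * ((n + o) * n) + o * o ≡ (n + o) * (n + o) + n * n
  lemma = solve-∀

cauchy-schwarz : (xs : List A) (f : A → ℕ) → ∑ xs f * ∑ xs f ≤ length xs * (∑[ x ∈ xs ] (f x * f x))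
cauchy-schwarz xs f = *-cancelˡ-≤ 2 (begin
  2 * (∑ xs f * ∑ xs f)                                   ≡⟨ cong (2 *_) (sym (∑-product xs xs f f)) ⟩
  2 * (∑[ x ∈ xs ] ∑[ y ∈ xs ] (f x * f y))               ≡⟨ sym (∑-*ˡ xs 2 _) ⟩
  ∑[ x ∈ xs ] (2 * (∑[ y ∈ xs ] (f x * f y)))             ≡⟨ ∑-cong xs (λ _ → sym (∑-*ˡ xs 2 _)) ⟩
  ∑[ x ∈ xs ] ∑[ y ∈ xs ] (2 * (f x * f y))               ≤⟨ ∑-mono xs (λ {x} _ → ∑-mono xs (λ {y} _ → 2mn≤m²+n² (f x) (f y))) ⟩
  ∑[ x ∈ xs ] ∑[ y ∈ xs ] (f x * f x + f y * f y)         ≡⟨ ∑-cong xs (λ {x} _ → trans (∑-+ xs _ _) (cong (_+ Q) (∑-const xs _))) ⟩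
  ∑[ x ∈ xs ] (length xs * (f x * f x) + Q)               ≡⟨ trans (∑-+ xs _ _) (cong₂ _+_ (∑-*ˡ xs (length xs) _) (∑-const xs Q)) ⟩
  length xs * Q + length xs * Q                           ≡⟨ cong (length xs * Q +_) (sym (+-identityʳ _)) ⟩
  2 * (length xs * Q)                                     ∎)
  where
  open ≤-Reasoning
  Q = ∑[ x ∈ xs ] (f x * f x)

-- Walks, degrees and cores

-- The index lists the starting vertex of every step and omits the final vertex. Hence a closed walk
-- lists each vertex of a cycle once, and joining walks concatenates their lists.
data Walk {A : Set} (R : A → A → Set) : A → List A → A → Set where
  []  : ∀ {x} → Walk R x [] x
  _∷_ : ∀ {x y z ys} → R x y → Walk R y ys z → Walk R x (x ∷ ys) z

infixr 5 _++ʷ_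

_++ʷ_ : ∀ {R : A → A → Set} {x y z xs ys} → Walk R x xs y → Walk R y ys z → Walk R x (xs ++ ys) z
[] ++ʷ v = v
(r ∷ w) ++ʷ v = r ∷ (w ++ʷ v)

reverseʷ : ∀ {R : A → A → Set} → (∀ {x y} → R x y → R y x) → ∀ {x y xs} → Walk R x xs y →
           ∃ λ ys → Walk R y ys x × y ∷ xs ↭ x ∷ ys
reverseʷ s [] = [] , [] , ↭-rfl
reverseʷ s {x} {z} (_∷_ {y = y} {ys = ys} r w) with reverseʷ s w
... | zs , w′ , p = zs ++ [ y ] , (w′ ++ʷ (s r ∷ [])) ,
  ↭-tr (swap z x ↭-rfl) (prep x (↭-tr p (∷↭∷ʳ y zs)))

Cycle : (A → A → Set) → List A → ℕ → Set
Cycle R vs m = ∃₂ λ x xs → Walk R x xs x × Unique xs × length xs ≡ m × All (_∈ vs) xs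

∑-support : {xs ys : List A} (f : A → ℕ) → Unique xs → (∀ {x} → x ∈ xs → f x ≢ 0 → x ∈ ys) → ∑ xs f ≤ ∑ ys f
∑-support {xs = xs} {ys} f u sub = ≤-trans (≤-reflexive (sym eq)) (∑-⊆ f (Unique-filter⁺ nz? u) sub′)
  where
  nz? : ∀ x → Dec (f x ≢ 0)
  nz? x = ¬? (f x ℕₚ.≟ 0)
  sub′ : ∀ {x} → x ∈ filter nz? xs → x ∈ ys
  sub′ x∈ = let p , q = ∈-filter⁻ nz? x∈ in sub p q
  eq : ∑ (filter nz? xs) f ≡ ∑ xs f
  eq = trans (∑-filter nz? xs f) (∑-cong xs (λ {x} _ → drop x))
    where
    drop : ∀ x → ⟦ does (nz? x) ⟧ * f x ≡ f x
    drop x with f x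
    ... | zero = refl
    ... | suc m = cong suc (+-identityʳ m)

⟦⟧-≤1 : ∀ b → ⟦ b ⟧ ≤ 1
⟦⟧-≤1 true = ≤-refl
⟦⟧-≤1 false = z≤n

⟦⟧≢0 : ∀ {b} → ⟦ b ⟧ ≢ 0 → T b
⟦⟧≢0 {true} _ = tt
⟦⟧≢0 {false} p = p refl

module Degree (a : A → A → Bool) where

  deg : List A → A → ℕ
  deg xs v = ∑[ w ∈ xs ] ⟦ a v w ⟧

  -- Deleting a vertex of degree at most `D` lowers the degree sum by at most `2 * D`, once for its
  -- row and once for its column, so the strict inequality survives. It fails for the empty list,
  -- hence the deletions stop earlier.
  core : (∀ u v → a u v ≡ a v u) → ∀ D xs → Unique xs → 2 * D * length xs < ∑ xs (deg xs) →
         ∃ λ ys → Unique ys × (∀ {x} → x ∈ ys → x ∈ xs) × ∃ (_∈ ys) × (∀ {x} → x ∈ ys → D < deg ys x)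
  core a-sym D xs = go (length xs) xs refl
    where
    go : ∀ m xs → length xs ≡ m → Unique xs → 2 * D * length xs < ∑ xs (deg xs) →
         ∃ λ ys → Unique ys × (∀ {x} → x ∈ ys → x ∈ xs) × ∃ (_∈ ys) × (∀ {x} → x ∈ ys → D < deg ys x)
    go m xs eq u lt with Any.any? (λ v → deg xs v ≤? D) xs
    go m [] eq u lt | no _ = ⊥-elim (n≮0 lt)
    go m xs@(x ∷ _) eq u lt | no none =
      xs , u , id , (x , here refl) , λ x∈ → ≰⇒> (All.lookup (¬Any⇒All¬ xs none) x∈)
    go m xs eq u lt | yes some with find some
    ... | v , v∈ , small with ∈⇒↭ v∈
    go zero [] eq u lt | yes some | v , () , small | zs , p
    go (suc m) xs eq u lt | yes some | v , v∈ , small | zs , p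
      with go m zs (suc-injective (trans (sym (↭-length p)) eq)) (AllPairs.tail (Unique-resp-↭ p u)) lt′
      where
      open ≤-Reasoning
      bound : deg (v ∷ zs) v ≤ D
      bound = ≤-trans (≤-reflexive (sym (∑-↭ _ p))) small
      total : ∑ xs (deg xs) ≤ 2 * D + ∑ zs (deg zs)
      total = begin
        ∑ xs (deg xs)                                  ≡⟨ ∑-↭ _ p ⟩
        deg xs v + ∑ zs (deg xs)                       ≤⟨ +-mono-≤ small (≤-reflexive (∑-cong zs (λ _ → ∑-↭ _ p))) ⟩
        D + (∑[ z ∈ zs ] (⟦ a z v ⟧ + deg zs z))        ≡⟨ cong (D +_) (∑-+ zs _ _) ⟩
        D + ((∑[ z ∈ zs ] ⟦ a z v ⟧) + ∑ zs (deg zs))   ≡⟨ cong (λ s → D + (s + ∑ zs (deg zs))) (∑-cong zs (λ {z} _ → cong ⟦_⟧ (a-sym z v))) ⟩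
        D + (deg zs v + ∑ zs (deg zs))                 ≤⟨ +-monoʳ-≤ D (+-monoˡ-≤ _ (≤-trans (m≤n+m _ ⟦ a v v ⟧) bound)) ⟩
        D + (D + ∑ zs (deg zs))                        ≡⟨ lemma D _ ⟩
        2 * D + ∑ zs (deg zs)                          ∎
        where
        lemma : ∀ d s → d + (d + s) ≡ 2 * d + s
        lemma = solve-∀
      lt′ : 2 * D * length zs < ∑ zs (deg zs)
      lt′ = +-cancelˡ-< (2 * D) _ _ (begin-strict
        2 * D + 2 * D * length zs  ≡⟨ sym (*-suc (2 * D) (length zs)) ⟩
        2 * D * suc (length zs)    ≡⟨ cong (2 * D *_) (sym (↭-length p)) ⟩
        2 * D * length xs          <⟨ lt ⟩
        ∑ xs (deg xs)              ≤⟨ total ⟩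
        2 * D + ∑ zs (deg zs)      ∎)
    ... | ys , uy , sub , ne , big = ys , uy , (λ x∈ → ∈-resp-↭ (↭-sym p) (there (sub x∈))) , ne , big

  -- The greedy step by which paths are grown inside a core; `S` collects what the path must avoid.
  pick : DecidableEquality A → ∀ {D ys v S} → Unique ys → D < deg ys v → length S ≤ D →
         ∃ λ w → w ∈ ys × T (a v w) × w ∉ S
  pick _≟_ {D} {ys} {v} {S} u big small with Any.any? (λ w → T? (a v w) ×-dec ¬? (w ∈? S)) ys
    where open DecMembership _≟_ using (_∈?_)
  ... | yes some = let w , w∈ , t , w∉ = find some in w , w∈ , t , w∉
  ... | no none = ⊥-elim (<⇒≱ big (≤-trans deg≤ small))
    where
    open DecMembership _≟_ using (_∈?_)
    inS : ∀ {w} → w ∈ ys → ⟦ a v w ⟧ ≢ 0 → w ∈ S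
    inS {w} w∈ nz = decidable-stable (w ∈? S) λ w∉ → none (lose w∈ (⟦⟧≢0 nz , w∉))
    deg≤ : deg ys v ≤ length S
    deg≤ = ≤-trans (∑-support _ u inS)
      (≤-trans (∑-≤-const S 1 (λ {w} _ → ⟦⟧-≤1 (a v w))) (≤-reflexive (*-identityʳ _)))

-- Serves twice: for the height at which neighbours stop having different ancestors, and for integer
-- roots.
first-failure : {Q : ℕ → Set} → (∀ h → Dec (Q h)) → Q 0 → ∀ i → ¬ Q i → ∃ λ h → h < i × Q h × ¬ Q (suc h)
first-failure Q? q0 zero ¬q = ⊥-elim (¬q q0)
first-failure Q? q0 (suc i) ¬q with Q? i
... | yes q = i , ≤-refl , q , ¬q
... | no ¬q′ = let h , h<i , q , ¬qs = first-failure Q? q0 i ¬q′ in h , m<n⇒m<1+n h<i , q , ¬qs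

Unique-++ : {xs ys : List A} → Unique xs → Unique ys → (∀ {z} → z ∈ xs → z ∈ ys → ⊥) → Unique (xs ++ ys)
Unique-++ u v d = Unique-++⁺ u v (λ (p , q) → d p q)

∉⇒All≢ : {x : A} {xs : List A} → x ∉ xs → All (x ≢_) xs
∉⇒All≢ x∉ = ¬Any⇒All¬ _ x∉

-- Breadth-first search trees and the closing of a cycle of length 2k

module BreadthFirst {A : Set} (_≟_ : DecidableEquality A) (a : A → A → Bool)
  (a-sym : ∀ u v → a u v ≡ a v u) (a-irr : ∀ v → ¬ T (a v v))
  (vs : List A) (r : A) where

  _~_ : A → A → Set
  u ~ v = T (a u v)

  ~-sym : ∀ {u v} → u ~ v → v ~ u
  ~-sym {u} {v} = subst T (a-sym u v)

  -- Cumulative: distance at most `j` from the root, by a path whose vertices after `v` lie in `vs`.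
  -- The levels `In` are the successive differences.
  Reach : ℕ → A → Set
  Reach zero v = v ≡ r
  Reach (suc j) v = Reach j v ⊎ Any (λ w → v ~ w × Reach j w) vs

  reach? : ∀ j v → Dec (Reach j v)
  reach? zero v = v ≟ r
  reach? (suc j) v = reach? j v ⊎-dec Any.any? (λ w → T? (a v w) ×-dec reach? j w) vs

  -- The parent is a function of vertex and level, so ancestors that once coincide coincide from
  -- there on. The default `v` does not arise on level `suc j`.
  par : ℕ → A → A
  par j v with Any.any? (λ w → T? (a v w) ×-dec reach? j w) vs
  ... | yes p = proj₁ (find p)
  ... | no _ = v

  In : ℕ → A → Set
  In zero v = Reach zero v
  In (suc j) v = Reach (suc j) v × ¬ Reach j v

  in? : ∀ j v → Dec (In j v)
  in? zero v = reach? zero v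
  in? (suc j) v = reach? (suc j) v ×-dec ¬? (reach? j v)

  In⇒Reach : ∀ j {v} → In j v → Reach j v
  In⇒Reach zero p = p
  In⇒Reach (suc j) = proj₁

  reach-neighbour : ∀ {j v w} → w ∈ vs → v ~ w → Reach j w → Reach (suc j) v
  reach-neighbour w∈ e p = inj₂ (lose w∈ (e , p))

  par-reach : ∀ j {v} → In (suc j) v → (v ~ par j v) × Reach j (par j v) × par j v ∈ vs
  par-reach j {v} (re , ¬re) with Any.any? (λ w → T? (a v w) ×-dec reach? j w) vs
  ... | yes p = let w , w∈ , e , q = find p in e , q , w∈
  par-reach j {v} (inj₁ re , ¬re) | no _ = ⊥-elim (¬re re)
  par-reach j {v} (inj₂ re , ¬re) | no n = ⊥-elim (n re)

  par-edge : ∀ j {v} → In (suc j) v → v ~ par j v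
  par-edge j p = proj₁ (par-reach j p)

  par-∈ : ∀ j {v} → In (suc j) v → par j v ∈ vs
  par-∈ j p = proj₂ (proj₂ (par-reach j p))

  par-In : ∀ j {v} → In (suc j) v → In j (par j v)
  par-In zero p = proj₁ (proj₂ (par-reach zero p))
  par-In (suc j) p@(_ , ¬re) =
    let e , q , w∈ = par-reach (suc j) p in q , λ q′ → ¬re (reach-neighbour w∈ e q′)

  anc : ℕ → ℕ → A → A
  anc (suc h) (suc i) v = anc h i (par i v)
  anc _ _ v = v

  anc-root : ∀ i {v} → In i v → anc i i v ≡ r
  anc-root zero p = p
  anc-root (suc i) p = anc-root i (par-In i p)

  -- From `v` up to, but without, its `h`-th ancestor, whereas `down` runs from that ancestor to `v`
  -- inclusive. Both fit the convention of `Walk`: `down` is followed by a further edge that leaves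
  -- `v`.
  up : ℕ → ℕ → A → List A
  up (suc h) (suc i) v = v ∷ up h i (par i v)
  up _ _ v = []

  down : ℕ → ℕ → A → List A
  down (suc h) (suc i) v = down h i (par i v) ++ [ v ]
  down _ _ v = [ v ]

  up-walk : ∀ h i {v} → h ≤ i → In i v → Walk _~_ v (up h i v) (anc h i v)
  up-walk zero i le p = []
  up-walk (suc h) (suc i) (s≤s le) p = par-edge i p ∷ up-walk h i le (par-In i p)

  down-walk : ∀ h i {v w} → h ≤ i → In i v → v ~ w → Walk _~_ (anc h i v) (down h i v) w
  down-walk zero i le p e = e ∷ []
  down-walk (suc h) (suc i) (s≤s le) p e =
    down-walk h i le (par-In i p) (~-sym (par-edge i p)) ++ʷ (e ∷ [])

  up-length : ∀ h i v → h ≤ i → length (up h i v) ≡ h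
  up-length zero i v le = refl
  up-length (suc h) (suc i) v (s≤s le) = cong suc (up-length h i _ le)

  down-length : ∀ h i v → h ≤ i → length (down h i v) ≡ suc h
  down-length zero i v le = refl
  down-length (suc h) (suc i) v (s≤s le) =
    trans (length-++ (down h i (par i v))) (trans (+-comm _ 1) (cong suc (down-length h i _ le)))

  up-reach : ∀ h i {v} → In i v → All (Reach i) (up h i v)
  up-reach zero i p = []
  up-reach (suc h) zero p = []
  up-reach (suc h) (suc i) p = proj₁ p ∷ All.map inj₁ (up-reach h i (par-In i p))

  down-reach : ∀ h i {v} → In i v → All (Reach i) (down h i v)
  down-reach zero i p = In⇒Reach i p ∷ []
  down-reach (suc h) zero p = p ∷ []
  down-reach (suc h) (suc i) p = All-++⁺ (All.map inj₁ (down-reach h i (par-In i p))) (proj₁ p ∷ [])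

  up-∈ : ∀ h i {v} → v ∈ vs → In i v → All (_∈ vs) (up h i v)
  up-∈ zero i v∈ p = []
  up-∈ (suc h) zero v∈ p = []
  up-∈ (suc h) (suc i) v∈ p = v∈ ∷ up-∈ h i (par-∈ i p) (par-In i p)

  down-∈ : ∀ h i {v} → v ∈ vs → In i v → All (_∈ vs) (down h i v)
  down-∈ zero i v∈ p = v∈ ∷ []
  down-∈ (suc h) zero v∈ p = v∈ ∷ []
  down-∈ (suc h) (suc i) v∈ p = All-++⁺ (down-∈ h i (par-∈ i p) (par-In i p)) (v∈ ∷ [])

  up-unique : ∀ h i {v} → In i v → Unique (up h i v)
  up-unique zero i p = []
  up-unique (suc h) zero p = []
  up-unique (suc h) (suc i) p =
    All.map (λ re eq → proj₂ p (subst (Reach i) (sym eq) re)) (up-reach h i (par-In i p)) ∷ up-unique h i (par-In i p)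

  down-unique : ∀ h i {v} → In i v → Unique (down h i v)
  down-unique zero i p = [] ∷ []
  down-unique (suc h) zero p = [] ∷ []
  down-unique (suc h) (suc i) p = Unique-++ (down-unique h i (par-In i p)) ([] ∷ [])
    λ { z∈ (here refl) → proj₂ p (All.lookup (down-reach h i (par-In i p)) z∈) }

  -- Vertices on different levels differ, and a coincidence on one level would pass up to the `h`-th
  -- ancestors. The topmost vertex, at height `suc h`, is listed by `down` only.
  up-down-disjoint : ∀ h i {u v} → h < i → In i u → In i v → anc h i u ≢ anc h i v →
                     ∀ {z} → z ∈ up (suc h) i u → z ∈ down (suc h) i v → ⊥
  up-down-disjoint h (suc i) {u} {v} (s≤s le) p q ne z∈u z∈d
    with z∈u | ∈-++⁻ (down h i (par i v)) z∈d
  ... | here refl | inj₁ z∈ = proj₂ p (All.lookup (down-reach h i (par-In i q)) z∈)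
  ... | here refl | inj₂ (here refl) = ne refl
  ... | there z∈ | inj₂ (here refl) = proj₂ q (All.lookup (up-reach h i (par-In i p)) z∈)
  up-down-disjoint (suc h) (suc i) (s≤s le) p q ne z∈u z∈d | there z∈ | inj₁ z∈′ =
    up-down-disjoint h i le (par-In i p) (par-In i q) ne z∈ z∈′

  level : ℕ → List A
  level i = filter (in? i) vs

  -- Holds on levels `i` and `suc i` alike, and keeps a path there off all proper ancestors of
  -- vertices on level `i`.
  NotBelow : ℕ → A → Set
  NotBelow i v = ∀ j → j < i → ¬ Reach j v

  Reach-mono : ∀ {j i v} → j ≤ i → Reach j v → Reach i v
  Reach-mono {j} {i} le p with m≤n⇒∃[o]m+o≡n le
  ... | zero , refl rewrite +-identityʳ j = p
  ... | suc o , refl rewrite +-suc j o = inj₁ (Reach-mono (m≤m+n j o) p)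

  In⇒NotBelow : ∀ i {v} → In i v → NotBelow i v
  In⇒NotBelow (suc i) p j (s≤s le) re = proj₂ p (Reach-mono le re)

  -- A `down` path without its last entry `v`: in the closed walk `v` is already counted as the
  -- start of the upper path.
  descent : ℕ → ℕ → A → List A
  descent h zero v = []
  descent h (suc i) v = down h i (par i v)

  descent-walk : ∀ h i {v} → h < i → In i v → Walk _~_ (anc (suc h) i v) (descent h i v) v
  descent-walk h (suc i) (s≤s le) p = down-walk h i le (par-In i p) (~-sym (par-edge i p))

  descent-unique : ∀ h i {v} → h < i → In i v → Unique (descent h i v)
  descent-unique h (suc i) le p = down-unique h i (par-In i p)

  descent-∈ : ∀ h i {v} → h < i → In i v → All (_∈ vs) (descent h i v)
  descent-∈ h (suc i) le p = down-∈ h i (par-∈ i p) (par-In i p)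

  descent-length : ∀ h i v → h < i → length (descent h i v) ≡ suc h
  descent-length h (suc i) v (s≤s le) = down-length h i _ le

  descent⊆down : ∀ h i {v z} → h < i → z ∈ descent h i v → z ∈ down (suc h) i v
  descent⊆down h (suc i) le z∈ = ∈-++⁺ˡ z∈

  descent-low : ∀ h i {v z} → h < i → In i v → z ∈ descent h i v → ¬ NotBelow i z
  descent-low h (suc i) le p z∈ nb = nb i ≤-refl (All.lookup (down-reach h i (par-In i p)) z∈)

  up-low : ∀ h i {v z} → h < i → In i v → z ∈ up (suc h) i v → z ≡ v ⊎ ¬ NotBelow i z
  up-low h (suc i) le p (here eq) = inj₁ eq
  up-low h (suc i) le p (there z∈) = inj₂ λ nb → nb i ≤-refl (All.lookup (up-reach h i (par-In i p)) z∈)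

  -- `ps` and `ys` may overlap, since edges inside level `i` are treated together with those to
  -- level `suc i`. Distinctness is therefore demanded of whole paths and not deduced from the two
  -- sides.
  module Close (k i : ℕ) (i<k : i < k) (ps ys : List A)
    (ps∈ : ∀ {p} → p ∈ ps → p ∈ vs × In i p) (ys∈ : ∀ {y} → y ∈ ys → y ∈ vs × NotBelow i y)
    (pickʸ : ∀ {p} → p ∈ ps → ∀ S → length S ≤ 2 * k + 5 → ∃ λ y → y ∈ ys × p ~ y × y ∉ S)
    (pickᵖ : ∀ {y} → y ∈ ys → ∀ S → length S ≤ 2 * k + 5 → ∃ λ p → p ∈ ps × p ~ y × p ∉ S) where

    -- True at 0, since a vertex of `ys` has two neighbours in `ps`, and false at `i`, where every
    -- ancestor is the root. Where it turns false from `h` to `suc h`, some pair meets exactly at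
    -- height `suc h` and no pair meets higher; so `h` is one less than the height of the meeting
    -- point.
    Split : ℕ → Set
    Split h = Any (λ y → Any (λ u → Any (λ v → u ~ y × v ~ y × anc h i u ≢ anc h i v) ps) ps) ys

    split? : ∀ h → Dec (Split h)
    split? h = Any.any? (λ y → Any.any? (λ u → Any.any? (λ v →
      T? (a u y) ×-dec T? (a v y) ×-dec ¬? (anc h i u ≟ anc h i v)) ps) ps) ys

    split₀ : ∀ {y} → y ∈ ys → Split 0
    split₀ y∈ with pickᵖ y∈ [] z≤n
    ... | u , u∈ , eu , _ with pickᵖ y∈ [ u ] (≤-trans (s≤s z≤n) (m≤n+m 5 (2 * k)))
    ... | v , v∈ , ev , v∉ = lose y∈ (lose u∈ (lose v∈ (eu , ev , λ eq → v∉ (here (sym eq)))))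

    ¬splitᵢ : ¬ Split i
    ¬splitᵢ s with find s
    ... | y , y∈ , s₁ with find s₁
    ... | u , u∈ , s₂ with find s₂
    ... | v , v∈ , _ , _ , ne = ne (trans (anc-root i (proj₂ (ps∈ u∈))) (sym (anc-root i (proj₂ (ps∈ v∈)))))

    module _ {h} (h<i : h < i) (all-meet : ¬ Split (suc h))
      {b c y} (b∈ : b ∈ ps) (c∈ : c ∈ ps) (y∈ : y ∈ ys) (b~y : b ~ y) (c~y : c ~ y)
      (b≉c : anc h i b ≢ anc h i c) where

      -- Chained along a path that alternates between `ps` and `ys`, this keeps the ancestor at
      -- height `suc h` constant, which is the field `meets` of `Path`.
      meet : ∀ {u v z} → u ∈ ps → v ∈ ps → z ∈ ys → u ~ z → v ~ z → anc (suc h) i u ≡ anc (suc h) i v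
      meet {u} {v} u∈ v∈ z∈ eu ev = decidable-stable (anc (suc h) i u ≟ anc (suc h) i v)
        λ ne → all-meet (lose z∈ (lose u∈ (lose v∈ (eu , ev , ne))))

      -- Grown away from `y` by two vertices at a time; `inner` begins with `start` and stops just
      -- before `y`. Both `b` and `c` are kept off, because only at the end is it known which of
      -- them closes the cycle.
      record Path (m : ℕ) : Set where
        field
          {start} : A
          {inner} : List A
          start∈ : start ∈ ps
          walk : Walk _~_ start inner y
          size : length inner ≡ suc (2 * m)
          fresh : Unique (b ∷ c ∷ y ∷ inner)
          high : All (NotBelow i) inner
          inside : All (_∈ vs) inner
          meets : anc (suc h) i b ≡ anc (suc h) i start

      ends-fresh : Unique (b ∷ c ∷ y ∷ [])
      ends-fresh = ((λ eq → b≉c (cong (anc h i) eq)) ∷ (λ eq → a-irr y (subst (_~ y) eq b~y)) ∷ [])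
        ∷ ((λ eq → a-irr y (subst (_~ y) eq c~y)) ∷ []) ∷ [] ∷ []

      P⇒NotBelow : ∀ {p} → p ∈ ps → NotBelow i p
      P⇒NotBelow p∈ = In⇒NotBelow i (proj₂ (ps∈ p∈))

      rotate : ∀ (p : A) xs → p ∷ b ∷ c ∷ y ∷ xs ↭ b ∷ c ∷ y ∷ p ∷ xs
      rotate p xs = ↭-sym (shift p (b ∷ c ∷ y ∷ []) xs)

      -- Origin of the constant `2 * k + 5`: the longest list to avoid consists of `z`, `b`, `c`,
      -- `y` and the `2 * m + 1` inner vertices.
      room : ∀ {m} (xs : List A) → suc m < k → length xs ≡ suc (2 * m) → 4 + length xs ≤ 2 * k + 5
      room {m} xs m<k sz = ≤-trans (≤-reflexive (trans (cong (4 +_) sz) (+-comm 5 (2 * m))))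
        (+-monoˡ-≤ 5 (*-monoʳ-≤ 2 (<⇒≤ (<-trans (n<1+n m) m<k))))

      grow : ∀ m → m < k → Path m
      grow zero m<k with pickᵖ y∈ (b ∷ c ∷ y ∷ []) (≤-trans (s≤s (s≤s (s≤s z≤n))) (m≤n+m 5 (2 * k)))
      ... | p , p∈ , e , p∉ = record
        { start∈ = p∈ ; walk = e ∷ [] ; size = refl
        ; fresh = Unique-resp-↭ (rotate p []) (∉⇒All≢ p∉ ∷ ends-fresh)
        ; high = P⇒NotBelow p∈ ∷ []
        ; inside = proj₁ (ps∈ p∈) ∷ []
        ; meets = meet b∈ p∈ y∈ b~y e }
      grow (suc m) m<k with grow m (<-trans (n<1+n m) m<k)
      ... | record { start = s ; inner = xs ; start∈ = s∈ ; walk = w ; size = sz ; fresh = fr ; high = hi ; inside = ins ; meets = me }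
        with pickʸ s∈ (b ∷ c ∷ y ∷ xs) (≤-trans (n≤1+n _) (room xs m<k sz))
      ... | z , z∈ , s~z , z∉ with pickᵖ z∈ (z ∷ b ∷ c ∷ y ∷ xs) (room xs m<k sz)
      ... | p , p∈ , p~z , p∉ = record
        { start∈ = p∈ ; walk = p~z ∷ ~-sym s~z ∷ w
        ; size = trans (cong (2 +_) sz) (cong suc (sym (*-suc 2 m)))
        ; fresh = Unique-resp-↭ (↭-tr (prep p (rotate z xs)) (rotate p (z ∷ xs))) (∉⇒All≢ p∉ ∷ ∉⇒All≢ z∉ ∷ fr)
        ; high = P⇒NotBelow p∈ ∷ proj₂ (ys∈ z∈) ∷ hi
        ; inside = proj₁ (ps∈ p∈) ∷ proj₁ (ys∈ z∈) ∷ ins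
        ; meets = trans me (meet s∈ p∈ z∈ s~z p~z) }

      -- From `start` along the path to `y`, over to `d`, up to the common ancestor at height
      -- `suc h` and down to `start`: `2 * m + 2` vertices on the path and `suc h` on each branch.
      close : ∀ {m} (P : Path m) → m + (2 + h) ≡ k → let open Path P in
              ∀ {d} → d ∈ ps → d ~ y → d ∉ y ∷ inner →
              anc h i d ≢ anc h i start → anc (suc h) i d ≡ anc (suc h) i start → Cycle _~_ vs (2 * k)
      close {m} P refl {d} d∈ d~y d∉ apart together =
        start , (inner ++ [ y ]) ++ (up (suc h) i d ++ tail) ,
        (walk ++ʷ (~-sym d~y ∷ [])) ++ʷ (up-walk (suc h) i h<i d-in ++ʷ subst (λ z → Walk _~_ z tail start) (sym together) (descent-walk h i h<i s-in)) ,
        Unique-++ front-unique (Unique-++ (up-unique (suc h) i d-in) (descent-unique h i h<i s-in) back-disjoint) front-back ,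
        size-eq ,
        All-++⁺ (All-++⁺ inside (proj₁ (ys∈ y∈) ∷ [])) (All-++⁺ (up-∈ (suc h) i (proj₁ (ps∈ d∈)) d-in) (descent-∈ h i h<i s-in))
        where
        open Path P
        d-in : In i d
        d-in = proj₂ (ps∈ d∈)
        s-in : In i start
        s-in = proj₂ (ps∈ start∈)
        tail : List A
        tail = descent h i start
        back-disjoint : ∀ {z} → z ∈ up (suc h) i d → z ∈ tail → ⊥
        back-disjoint z∈ z∈′ = up-down-disjoint h i h<i d-in s-in apart z∈ (descent⊆down h i h<i z∈′)
        front-unique : Unique (inner ++ [ y ])
        front-unique = Unique-resp-↭ (∷↭∷ʳ y inner) (AllPairs.tail (AllPairs.tail fresh))
        front-high : All (NotBelow i) (inner ++ [ y ])
        front-high = All-++⁺ high (proj₂ (ys∈ y∈) ∷ [])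
        front-back : ∀ {z} → z ∈ inner ++ [ y ] → z ∈ up (suc h) i d ++ tail → ⊥
        front-back z∈ z∈′ with ∈-++⁻ (up (suc h) i d) z∈′
        ... | inj₂ z∈t = descent-low h i h<i s-in z∈t (All.lookup front-high z∈)
        ... | inj₁ z∈u with up-low h i h<i d-in z∈u
        ... | inj₁ refl = d∉ (∈-resp-↭ (↭-sym (∷↭∷ʳ y inner)) z∈)
        ... | inj₂ low = low (All.lookup front-high z∈)
        size-eq : length ((inner ++ [ y ]) ++ (up (suc h) i d ++ tail)) ≡ 2 * (m + (2 + h))
        size-eq = begin
          length ((inner ++ [ y ]) ++ (up (suc h) i d ++ tail))
            ≡⟨ length-++ (inner ++ [ y ]) ⟩
          length (inner ++ [ y ]) + length (up (suc h) i d ++ tail)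
            ≡⟨ cong₂ _+_ (trans (length-++ inner) (cong (_+ 1) size)) (trans (length-++ (up (suc h) i d)) (cong₂ _+_ (up-length (suc h) i d h<i) (descent-length h i start h<i))) ⟩
          suc (2 * m) + 1 + (suc h + suc h)
            ≡⟨ lemma m h ⟩
          2 * (m + (2 + h)) ∎
          where
          open ≡-Reasoning
          lemma : ∀ m h → suc (2 * m) + 1 + (suc h + suc h) ≡ 2 * (m + (2 + h))
          lemma = solve-∀

      -- As `b` and `c` have different ancestors at height `h`, at least one of them differs there
      -- from `start`, and that one serves as `d`.
      finish : Cycle _~_ vs (2 * k)
      finish with m≤n⇒∃[o]m+o≡n (≤-trans (s≤s h<i) i<k)
      ... | m , eq = go (grow m (≤-trans (m≤m+n (suc m) (suc h)) (≤-reflexive (trans (lemma m h) eq)))) 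
        where
        lemma : ∀ m h → suc m + suc h ≡ suc (suc h) + m
        lemma = solve-∀
        eq′ : m + (2 + h) ≡ k
        eq′ = trans (+-comm m (2 + h)) eq
        go : Path m → Cycle _~_ vs (2 * k)
        go P with Path.fresh P | anc h i b ≟ anc h i (Path.start P)
        ... | (_ ∷ b∉) ∷ _ | no apart = close P eq′ b∈ b~y (λ z∈ → All.lookup b∉ z∈ refl) apart (Path.meets P)
        ... | _ ∷ c∉ ∷ _ | yes same = close P eq′ c∈ c~y (λ z∈ → All.lookup c∉ z∈ refl)
                (λ same′ → b≉c (trans same (sym same′)))
                (trans (meet c∈ b∈ y∈ c~y b~y) (Path.meets P))

    cycle : ∀ {y} → y ∈ ys → Cycle _~_ vs (2 * k)
    cycle y∈ with first-failure split? (split₀ y∈) i ¬splitᵢ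
    ... | h , h<i , s , ¬s with find s
    ... | y , y∈′ , s₁ with find s₁
    ... | u , u∈ , s₂ with find s₂
    ... | v , v∈ , eu , ev , ne = finish h<i ¬s u∈ v∈ y∈′ eu ev ne

-- Even cycles

-- The bipartite double cover. With level `i` as left copy and levels `i`, `suc i` as right copy,
-- one application of `core` gives large degrees across in both directions although the vertex sets
-- overlap.
crossing : (A → A → Bool) → A ⊎ A → A ⊎ A → Bool
crossing a (inj₁ p) (inj₂ y) = a p y
crossing a (inj₂ y) (inj₁ p) = a p y
crossing a _ _ = false

crossing-sym : (a : A → A → Bool) → ∀ u v → crossing a u v ≡ crossing a v u
crossing-sym a (inj₁ _) (inj₁ _) = refl
crossing-sym a (inj₁ _) (inj₂ _) = refl
crossing-sym a (inj₂ _) (inj₁ _) = refl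
crossing-sym a (inj₂ _) (inj₂ _) = refl

crossing-total : (a : A → A → Bool) (ps ys : List A) → let ws = map inj₁ ps ++ map inj₂ ys in
  ∑ ws (Degree.deg (crossing a) ws) ≡ 2 * (∑[ p ∈ ps ] ∑[ y ∈ ys ] ⟦ a p y ⟧)
crossing-total a ps ys = begin
  ∑ ws (deg ws)
    ≡⟨ split _ ⟩
  (∑[ p ∈ ps ] deg ws (inj₁ p)) + (∑[ y ∈ ys ] deg ws (inj₂ y))
    ≡⟨ cong₂ _+_ (∑-cong ps (λ {p} _ → trans (split _) (cong (_+ (∑[ y ∈ ys ] ⟦ a p y ⟧)) (none ps))))
                 (∑-cong ys (λ {y} _ → trans (split _) (cong ((∑[ p ∈ ps ] ⟦ a p y ⟧) +_) (none ys)))) ⟩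
  E + (∑[ y ∈ ys ] ((∑[ p ∈ ps ] ⟦ a p y ⟧) + 0))
    ≡⟨ cong (E +_) (trans (∑-cong ys (λ _ → +-identityʳ _)) (trans (∑-swap ys ps _) (sym (+-identityʳ E)))) ⟩
  2 * E ∎
  where
  open ≡-Reasoning
  open Degree (crossing a)
  E = ∑[ p ∈ ps ] ∑[ y ∈ ys ] ⟦ a p y ⟧
  ws = map inj₁ ps ++ map inj₂ ys
  split : ∀ f → ∑ ws f ≡ (∑[ p ∈ ps ] f (inj₁ p)) + (∑[ y ∈ ys ] f (inj₂ y))
  split f = trans (∑-++ (map inj₁ ps) _ f) (cong₂ _+_ (∑-map inj₁ ps f) (∑-map inj₂ ys f))
  none : ∀ zs → ∑[ _ ∈ zs ] 0 ≡ 0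
  none zs = trans (∑-const zs 0) (*-zeroʳ (length zs))

module Layers {A : Set} (_≟_ : DecidableEquality A) (a : A → A → Bool)
  (a-sym : ∀ u v → a u v ≡ a v u) (a-irr : ∀ v → ¬ T (a v v))
  (vs : List A) (vs! : Unique vs) (r : A) (r∈ : r ∈ vs)
  (k : ℕ) (acyclic : ¬ Cycle (λ u v → T (a u v)) vs (2 * k)) where

  open Degree a using (deg)
  open BreadthFirst _≟_ a a-sym a-irr vs r

  D : ℕ
  D = 2 * k + 5

  upper : ℕ → List A
  upper i = level i ++ level (suc i)

  ∈-level : ∀ i {v} → v ∈ level i → v ∈ vs × In i v
  ∈-level i = ∈-filter⁻ (in? i)

  upper-high : ∀ i {y} → y ∈ upper i → y ∈ vs × NotBelow i y
  upper-high i y∈ with ∈-++⁻ (level i) y∈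
  ... | inj₁ p = let v∈ , q = ∈-level i p in v∈ , In⇒NotBelow i q
  ... | inj₂ p = let v∈ , q = ∈-level (suc i) p in v∈ , λ j lt → In⇒NotBelow (suc i) q j (m<n⇒m<1+n lt)

  level-unique : ∀ i → Unique (level i)
  level-unique i = Unique-filter⁺ (in? i) vs!

  upper-unique : ∀ i → Unique (upper i)
  upper-unique i = Unique-++ (level-unique i) (level-unique (suc i))
    λ p q → proj₂ (proj₂ (∈-level (suc i) q)) (In⇒Reach i (proj₂ (∈-level i p)))

  -- The degree sum of the double cover is twice the left-hand side, so a violation leaves a core of
  -- minimum degree above `D`, in which `Close` finds a cycle.
  sparse : ∀ i → i < k → ∑[ p ∈ level i ] ∑[ y ∈ upper i ] ⟦ a p y ⟧ ≤ D * (length (level i) + length (upper i))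
  sparse i i<k = ≮⇒≥ λ lt → acyclic (dense lt)
    where
    open Degree (crossing a) using () renaming (core to core′; deg to deg′; pick to pick′)
    open DecMembership (≡-dec _≟_ _≟_) using (_∈?_)
    ws : List (A ⊎ A)
    ws = map inj₁ (level i) ++ map inj₂ (upper i)
    ws! : Unique ws
    ws! = Unique-++ (Unique-map⁺ inj₁-injective (level-unique i)) (Unique-map⁺ inj₂-injective (upper-unique i)) clash
      where
      clash : ∀ {z} → z ∈ map inj₁ (level i) → z ∈ map inj₂ (upper i) → ⊥
      clash p q with ∈-map⁻ inj₁ p | ∈-map⁻ inj₂ q
      ... | _ , _ , refl | _ , _ , ()
    dense : D * (length (level i) + length (upper i)) < (∑[ p ∈ level i ] ∑[ y ∈ upper i ] ⟦ a p y ⟧) →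
            Cycle _~_ vs (2 * k)
    dense lt with core′ (crossing-sym a) D ws ws! many
      where
      open ≤-Reasoning
      many : 2 * D * length ws < ∑ ws (deg′ ws)
      many = begin-strict
        2 * D * length ws
          ≡⟨ trans (*-assoc 2 D _) (cong (λ s → 2 * (D * s)) (trans (length-++ (map inj₁ (level i))) (cong₂ _+_ (length-map inj₁ (level i)) (length-map inj₂ (upper i))))) ⟩
        2 * (D * (length (level i) + length (upper i)))
          <⟨ *-monoʳ-< 2 lt ⟩
        2 * (∑[ p ∈ level i ] ∑[ y ∈ upper i ] ⟦ a p y ⟧)
          ≡⟨ sym (crossing-total a (level i) (upper i)) ⟩
        ∑ ws (deg′ ws) ∎
    ... | zs , zs! , zs⊆ , (w , w∈) , big = found w w∈
      where
      P? : ∀ p → Dec (inj₁ p ∈ zs)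
      P? p = inj₁ p ∈? zs
      Y? : ∀ y → Dec (inj₂ y ∈ zs)
      Y? y = inj₂ y ∈? zs
      ps ys : List A
      ps = filter P? (level i)
      ys = filter Y? (upper i)
      inj₁∈ : ∀ {p} → inj₁ p ∈ zs → p ∈ ps
      inj₁∈ p∈ with ∈-++⁻ (map inj₁ (level i)) (zs⊆ p∈)
      ... | inj₁ q with ∈-map⁻ inj₁ q
      ... | _ , q∈ , refl = ∈-filter⁺ P? q∈ p∈
      inj₁∈ p∈ | inj₂ q with ∈-map⁻ inj₂ q
      ... | _ , _ , ()
      inj₂∈ : ∀ {y} → inj₂ y ∈ zs → y ∈ ys
      inj₂∈ y∈ with ∈-++⁻ (map inj₁ (level i)) (zs⊆ y∈)
      ... | inj₂ q with ∈-map⁻ inj₂ q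
      ... | _ , q∈ , refl = ∈-filter⁺ Y? q∈ y∈
      inj₂∈ y∈ | inj₁ q with ∈-map⁻ inj₁ q
      ... | _ , _ , ()
      pickʸ : ∀ {p} → p ∈ ps → ∀ S → length S ≤ D → ∃ λ y → y ∈ ys × p ~ y × y ∉ S
      pickʸ {p} p∈ S le with pick′ (≡-dec _≟_ _≟_) {v = inj₁ p} {S = map inj₂ S} zs! (big (proj₂ (∈-filter⁻ P? {xs = level i} p∈))) (subst (_≤ D) (sym (length-map inj₂ S)) le)
      ... | inj₂ y , y∈ , e , y∉ = y , inj₂∈ y∈ , e , λ q → y∉ (∈-map⁺ inj₂ q)
      pickᵖ : ∀ {y} → y ∈ ys → ∀ S → length S ≤ D → ∃ λ p → p ∈ ps × p ~ y × p ∉ S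
      pickᵖ {y} y∈ S le with pick′ (≡-dec _≟_ _≟_) {v = inj₂ y} {S = map inj₁ S} zs! (big (proj₂ (∈-filter⁻ Y? {xs = upper i} y∈))) (subst (_≤ D) (sym (length-map inj₁ S)) le)
      ... | inj₁ p , p∈ , e , p∉ = p , inj₁∈ p∈ , e , λ q → p∉ (∈-map⁺ inj₁ q)
      open Close k i i<k ps ys
        (λ p∈ → ∈-level i (proj₁ (∈-filter⁻ P? p∈)))
        (λ y∈ → upper-high i (proj₁ (∈-filter⁻ Y? y∈))) pickʸ pickᵖ using (cycle)
      found : ∀ w → w ∈ zs → Cycle _~_ vs (2 * k)
      found (inj₁ p) p∈ = let y , y∈ , _ = pickʸ (inj₁∈ p∈) [] z≤n in cycle y∈
      found (inj₂ y) y∈ = cycle (inj₂∈ y∈)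

  below : ℕ → List A
  below zero = []
  below (suc i) = level i

  neighbour-level : ∀ i {v w} → v ∈ vs → In i v → w ∈ vs → v ~ w → w ∈ below i ++ upper i
  neighbour-level i {v} {w} v∈ p w∈ e with reach? i w
  ... | no ¬q = ∈-++⁺ʳ (below i) (∈-++⁺ʳ (level i) (∈-filter⁺ (in? (suc i)) w∈ (reach-neighbour v∈ (~-sym e) (In⇒Reach i p) , ¬q)))
  neighbour-level zero v∈ p w∈ e | yes q = ∈-++⁺ˡ (∈-filter⁺ (in? 0) w∈ q)
  neighbour-level (suc i) {v} {w} v∈ p w∈ e | yes q with reach? i w
  ... | no ¬q = ∈-++⁺ʳ (level i) (∈-++⁺ˡ (∈-filter⁺ (in? (suc i)) w∈ (q , ¬q)))
  neighbour-level (suc zero) v∈ p w∈ e | yes q | yes q′ = ∈-++⁺ˡ (∈-filter⁺ (in? 0) w∈ q′)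
  -- A neighbour at distance at most `i` would put `v` on a lower level than its own.
  neighbour-level (suc (suc i)) v∈ p w∈ e | yes q | yes q′ =
    ∈-++⁺ˡ (∈-filter⁺ (in? (suc i)) w∈ (q′ , λ q″ → proj₂ p (reach-neighbour w∈ e q″)))

  deg-split : ∀ i {v} → v ∈ level i → deg vs v ≤ deg (below i) v + deg (upper i) v
  deg-split i {v} v∈ = ≤-trans
    (∑-support _ vs! (λ w∈ nz → let v∈′ , p = ∈-level i v∈ in neighbour-level i v∈′ p w∈ (⟦⟧≢0 nz)))
    (≤-reflexive (∑-++ (below i) (upper i) _))

  ∣_∣ : ℕ → ℕ
  ∣ i ∣ = length (level i)

  upper-length : ∀ i → length (upper i) ≡ ∣ i ∣ + ∣ suc i ∣
  upper-length i = length-++ (level i)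

  module Growth (q : ℕ) (q≥1 : 1 ≤ q) (min-deg : ∀ {v} → v ∈ vs → D * (q + 5) ≤ deg vs v) where

    below-bound : ℕ → ℕ
    below-bound zero = 0
    below-bound (suc i) = D * (∣ i ∣ + (∣ i ∣ + ∣ suc i ∣))

    below-sparse : ∀ i → i < k → ∑[ v ∈ level i ] deg (below i) v ≤ below-bound i
    below-sparse zero _ = ≤-reflexive (trans (∑-const (level zero) 0) (*-zeroʳ ∣ zero ∣))
    below-sparse (suc i) i<k = begin
      ∑[ v ∈ level (suc i) ] ∑[ w ∈ level i ] ⟦ a v w ⟧  ≡⟨ ∑-swap (level (suc i)) (level i) _ ⟩
      ∑[ w ∈ level i ] ∑[ v ∈ level (suc i) ] ⟦ a v w ⟧  ≡⟨ ∑-cong (level i) (λ {w} _ → ∑-cong (level (suc i)) (λ {v} _ → cong ⟦_⟧ (a-sym v w))) ⟩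
      ∑[ w ∈ level i ] ∑[ v ∈ level (suc i) ] ⟦ a w v ⟧  ≤⟨ ∑-mono (level i) (λ _ → ∑-⊆ _ (level-unique (suc i)) (∈-++⁺ʳ (level i))) ⟩
      ∑[ w ∈ level i ] ∑[ v ∈ upper i ] ⟦ a w v ⟧        ≤⟨ sparse i (<-trans (n<1+n i) i<k) ⟩
      D * (∣ i ∣ + length (upper i))                     ≡⟨ cong (λ s → D * (∣ i ∣ + s)) (upper-length i) ⟩
      D * (∣ i ∣ + (∣ i ∣ + ∣ suc i ∣))                   ∎
      where open ≤-Reasoning

    below-bound≤ : ∀ i → (∀ j → suc j ≡ i → ∣ j ∣ ≤ ∣ i ∣) → below-bound i ≤ D * (3 * ∣ i ∣)
    below-bound≤ zero _ = z≤n
    below-bound≤ (suc i) mono = *-monoʳ-≤ D (≤-trans (+-mono-≤ (mono i refl) (+-monoˡ-≤ _ (mono i refl))) (≤-reflexive (lemma ∣ suc i ∣)))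
      where
      lemma : ∀ x → x + (x + x) ≡ 3 * x
      lemma = solve-∀

    -- The 5 in the minimum degree pays for the terms that do not count level `suc i`: 3 for the
    -- edges to the level below, by `sparse` there and the growth already shown, and 2 from `sparse`
    -- at level `i` itself.
    grows : ∀ i → i < k → q * ∣ i ∣ ≤ ∣ suc i ∣
    grows i i<k = +-cancelˡ-≤ (5 * ∣ i ∣) _ _ (*-cancelˡ-≤ D (begin
      D * (5 * ∣ i ∣ + q * ∣ i ∣)                                       ≡⟨ lemma₁ D q ∣ i ∣ ⟩
      ∣ i ∣ * (D * (q + 5))                                            ≡⟨ sym (∑-const (level i) _) ⟩
      ∑[ _ ∈ level i ] (D * (q + 5))                                   ≤⟨ ∑-mono (level i) (λ v∈ → ≤-trans (min-deg (proj₁ (∈-level i v∈))) (deg-split i v∈)) ⟩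
      ∑[ v ∈ level i ] (deg (below i) v + deg (upper i) v)             ≡⟨ ∑-+ (level i) _ _ ⟩
      ∑ (level i) (deg (below i)) + ∑ (level i) (deg (upper i))        ≤⟨ +-mono-≤ (≤-trans (below-sparse i i<k) (below-bound≤ i mono)) (≤-trans (sparse i i<k) (≤-reflexive (cong (λ s → D * (∣ i ∣ + s)) (upper-length i)))) ⟩
      D * (3 * ∣ i ∣) + D * (∣ i ∣ + (∣ i ∣ + ∣ suc i ∣))                ≡⟨ lemma₂ D ∣ i ∣ ∣ suc i ∣ ⟩
      D * (5 * ∣ i ∣ + ∣ suc i ∣)                                       ∎))
      where
      open ≤-Reasoning
      instance
        D≢0 = >-nonZero (≤-trans (s≤s z≤n) (m≤n+m 5 (2 * k)))
      lemma₁ : ∀ d q x → d * (5 * x + q * x) ≡ x * (d * (q + 5))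
      lemma₁ = solve-∀
      lemma₂ : ∀ d x y → d * (3 * x) + d * (x + (x + y)) ≡ d * (5 * x + y)
      lemma₂ = solve-∀
      mono : ∀ j → suc j ≡ i → ∣ j ∣ ≤ ∣ i ∣
      mono j refl = ≤-trans (≤-trans (≤-reflexive (sym (*-identityˡ ∣ j ∣))) (*-monoˡ-≤ ∣ j ∣ q≥1)) (grows j (<-trans (n<1+n j) i<k))

    exponential : ∀ i → i ≤ k → q ^ i ≤ ∣ i ∣
    exponential zero _ = length-⊆ {xs = [ r ]} ([] ∷ []) λ { (here refl) → ∈-filter⁺ (in? 0) r∈ refl }
    exponential (suc i) i<k = ≤-trans (*-monoʳ-≤ q (exponential i (<⇒≤ i<k))) (grows i i<k)

    k-bound : q ^ k ≤ length vs
    k-bound = ≤-trans (exponential k ≤-refl) (length-⊆ (level-unique k) (proj₁ ∘ ∈-level k))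

module EvenCycles {A : Set} (_≟_ : DecidableEquality A) (a : A → A → Bool)
  (a-sym : ∀ u v → a u v ≡ a v u) (a-irr : ∀ v → ¬ T (a v v)) where

  open Degree a

  -- `q` stands in for the k-th root of the number of vertices. A larger degree sum leaves a core
  -- whose levels grow by the factor `q`, so that level `k` alone would have at least `q ^ k`
  -- vertices.
  bondy-simonovits : ∀ vs → Unique vs → ∀ k q → 1 ≤ q → length vs < q ^ k →
    ¬ Cycle (λ u v → T (a u v)) vs (2 * k) → ∑ vs (deg vs) ≤ 2 * ((2 * k + 5) * (q + 5)) * length vs
  bondy-simonovits vs vs! k q q≥1 small acyclic = ≮⇒≥ λ lt → absurd (core a-sym _ vs vs! lt)
    where
    absurd : ¬ ∃ λ ys → Unique ys × (∀ {x} → x ∈ ys → x ∈ vs) × ∃ (_∈ ys) × (∀ {x} → x ∈ ys → (2 * k + 5) * (q + 5) < deg ys x)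
    absurd (ys , ys! , ys⊆ , (r , r∈) , big) =
      <⇒≱ small (≤-trans (Growth.k-bound q q≥1 (λ v∈ → <⇒≤ (big v∈))) (length-⊆ ys! ys⊆))
      where
      open Layers _≟_ a a-sym a-irr ys ys! r r∈ k
        (λ (x , xs , w , u , e , i) → acyclic (x , xs , w , u , e , All.map ys⊆ i))

-- Triangle-free graphs

module Mantel (a : A → A → Bool) (a-sym : ∀ u v → a u v ≡ a v u) (vs : List A)
  (triangle-free : ∀ {u v w} → u ∈ vs → v ∈ vs → w ∈ vs → T (a u v) → T (a v w) → T (a u w) → ⊥) where

  open Degree a

  S Q m : ℕ
  S = ∑ vs (deg vs)
  Q = ∑[ v ∈ vs ] (deg vs v * deg vs v)
  m = length vs

  edge-bound : ∀ {u v} → u ∈ vs → v ∈ vs → T (a u v) → deg vs u + deg vs v ≤ m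
  edge-bound {u} {v} u∈ v∈ e = begin
    deg vs u + deg vs v                       ≡⟨ sym (∑-+ vs _ _) ⟩
    ∑[ w ∈ vs ] (⟦ a u w ⟧ + ⟦ a v w ⟧)        ≤⟨ ∑-mono vs one ⟩
    ∑[ _ ∈ vs ] 1                             ≡⟨ sym (length-∑ vs) ⟩
    m                                         ∎
    where
    open ≤-Reasoning
    one : ∀ {w} → w ∈ vs → ⟦ a u w ⟧ + ⟦ a v w ⟧ ≤ 1
    one {w} w∈ with a u w in eu | a v w in ev
    ... | false | b = ⟦⟧-≤1 b
    ... | true | false = ≤-refl
    ... | true | true = ⊥-elim (triangle-free u∈ v∈ w∈ e (subst T (sym ev) tt) (subst T (sym eu) tt))

  -- Summing `deg u + deg v` over ordered adjacent pairs counts every squared degree twice, and each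
  -- term is at most `m`.
  2Q≤mS : 2 * Q ≤ m * S
  2Q≤mS = begin
    2 * Q
      ≡⟨ cong (Q +_) (+-identityʳ Q) ⟩
    Q + Q
      ≡⟨ cong₂ _+_ (∑-cong vs (λ {u} _ → sym (∑-*ʳ vs (deg vs u) _))) (trans (∑-cong vs (λ {u} _ → sym (∑-*ʳ vs (deg vs u) _))) (∑-swap vs vs _)) ⟩
    (∑[ u ∈ vs ] ∑[ v ∈ vs ] (⟦ a u v ⟧ * deg vs u)) + (∑[ u ∈ vs ] ∑[ v ∈ vs ] (⟦ a v u ⟧ * deg vs v))
      ≡⟨ sym (trans (∑-cong vs (λ _ → ∑-+ vs _ _)) (∑-+ vs _ _)) ⟩
    ∑[ u ∈ vs ] ∑[ v ∈ vs ] (⟦ a u v ⟧ * deg vs u + ⟦ a v u ⟧ * deg vs v)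
      ≤⟨ ∑-mono vs (λ u∈ → ∑-mono vs (λ v∈ → weigh u∈ v∈)) ⟩
    ∑[ u ∈ vs ] ∑[ v ∈ vs ] (m * ⟦ a u v ⟧)
      ≡⟨ trans (∑-cong vs (λ _ → ∑-*ˡ vs m _)) (∑-*ˡ vs m _) ⟩
    m * S ∎
    where
    open ≤-Reasoning
    weigh : ∀ {u v} → u ∈ vs → v ∈ vs → ⟦ a u v ⟧ * deg vs u + ⟦ a v u ⟧ * deg vs v ≤ m * ⟦ a u v ⟧
    weigh {u} {v} u∈ v∈ rewrite a-sym v u with a u v in eq
    ... | false = z≤n
    ... | true = ≤-trans (≤-reflexive (cong₂ _+_ (+-identityʳ (deg vs u)) (+-identityʳ (deg vs v))))
                   (≤-trans (edge-bound u∈ v∈ (subst T (sym eq) tt)) (≤-reflexive (sym (*-identityʳ m))))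

  mantel : 2 * S ≤ m * m
  mantel with S in eq
  ... | zero = z≤n
  ... | suc s = *-cancelʳ-≤ _ _ (suc s) (begin
    2 * suc s * suc s      ≡⟨ *-assoc 2 (suc s) (suc s) ⟩
    2 * (suc s * suc s)    ≡⟨ cong (λ z → 2 * (z * z)) (sym eq) ⟩
    2 * (S * S)            ≤⟨ *-monoʳ-≤ 2 (cauchy-schwarz vs (deg vs)) ⟩
    2 * (m * Q)            ≡⟨ lemma m Q ⟩
    m * (2 * Q)            ≤⟨ *-monoʳ-≤ m 2Q≤mS ⟩
    m * (m * S)            ≡⟨ trans (sym (*-assoc m m S)) (cong (m * m *_) eq) ⟩
    m * m * suc s          ∎)
    where
    open ≤-Reasoning
    lemma : ∀ m q → 2 * (m * q) ≡ m * (2 * q)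
    lemma = solve-∀

-- Permutations

Unique-concatMap : (f : A → List B) {xs : List A} → Unique xs → (∀ {x} → x ∈ xs → Unique (f x)) →
  (∀ {x y z} → z ∈ f x → z ∈ f y → x ≡ y) → Unique (concatMap f xs)
Unique-concatMap f [] uf d = []
Unique-concatMap f {x ∷ xs} (x∉ ∷ u) uf d =
  Unique-++ (uf (here refl)) (Unique-concatMap f u (uf ∘ there) d)
    λ z∈ z∈′ → let y , y∈ , p = find (∈-concatMap⁻ f {xs = xs} z∈′) in All.lookup x∉ y∈ (d z∈ p)

length-concatMap : (f : A → List B) (c : ℕ) (xs : List A) → (∀ {x} → x ∈ xs → length (f x) ≡ c) →
  length (concatMap f xs) ≡ length xs * c
length-concatMap f c [] eq = refl
length-concatMap f c (x ∷ xs) eq =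
  trans (length-++ (f x)) (cong₂ _+_ (eq (here refl)) (length-concatMap f c xs (eq ∘ there)))

-- `IsPerm` with length and range decoupled, so that permutations can be enumerated entry by entry.
Injectiveᵛ : ∀ {n m} → Vec (Fin n) m → Set
Injectiveᵛ {m = m} v = ∀ (i j : Fin m) → lookup v i ≡ lookup v j → i ≡ j

Fresh : ∀ {n m} → Vec (Fin n) m → Fin n → Set
Fresh v i = ∀ k → lookup v k ≢ i

fresh? : ∀ {n m} (v : Vec (Fin n) m) i → Dec (Fresh v i)
fresh? v i = Fin.all? (λ k → ¬? (lookup v k Fin.≟ i))

fresh-count : ∀ {n m} (v : Vec (Fin n) m) → Injectiveᵛ v → length (filter (fresh? v) (allFin n)) ≡ n ∸ m
fresh-count {n} {m} v inj = sym (trans (cong (_∸ m) (sym total)) (trans (cong (fresh + m ∸_) (sym used≡m)) (trans (cong (λ z → fresh + z ∸ used) (sym used≡m)) (m+n∸n≡m fresh used))))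
  where
  fresh used : ℕ
  fresh = length (filter (fresh? v) (allFin n))
  used = length (filter (λ i → ¬? (fresh? v i)) (allFin n))
  image : List (Fin n)
  image = tabulate (lookup v)
  image! : Unique image
  image! = Unique-tabulate⁺ (inj _ _)
  used≡m : used ≡ m
  used≡m = ≤-antisym
    (≤-trans (length-⊆ (Unique-filter⁺ (λ i → ¬? (fresh? v i)) (allFin⁺ n)) into) (≤-reflexive (length-tabulate (lookup v))))
    (≤-trans (≤-reflexive (sym (length-tabulate (lookup v)))) (length-⊆ image! back))
    where
    into : ∀ {i} → i ∈ filter (λ i → ¬? (fresh? v i)) (allFin n) → i ∈ image
    into {i} i∈ with Fin.any? (λ k → lookup v k Fin.≟ i)
    ... | yes (k , refl) = ∈-tabulate⁺ k
    ... | no none = ⊥-elim (proj₂ (∈-filter⁻ (λ i → ¬? (fresh? v i)) {xs = allFin n} i∈) (λ k eq → none (k , eq)))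
    back : ∀ {i} → i ∈ image → i ∈ filter (λ i → ¬? (fresh? v i)) (allFin n)
    back {i} i∈ with ∈-tabulate⁻ i∈
    ... | k , refl = ∈-filter⁺ (λ i → ¬? (fresh? v i)) (∈-allFin _) (λ fr → fr k refl)
  total : fresh + m ≡ n
  total = begin
    fresh + m
      ≡⟨ cong (fresh +_) (sym used≡m) ⟩
    fresh + used
      ≡⟨ cong₂ _+_ (length-filter-∑ (fresh? v) (allFin n)) (length-filter-∑ (λ i → ¬? (fresh? v i)) (allFin n)) ⟩
    (∑[ i ∈ allFin n ] ⟦ does (fresh? v i) ⟧) + (∑[ i ∈ allFin n ] ⟦ does (¬? (fresh? v i)) ⟧)
      ≡⟨ sym (∑-+ (allFin n) _ _) ⟩
    ∑[ i ∈ allFin n ] (⟦ does (fresh? v i) ⟧ + ⟦ does (¬? (fresh? v i)) ⟧)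
      ≡⟨ ∑-cong (allFin n) (λ {i} _ → complement (fresh? v i)) ⟩
    ∑[ _ ∈ allFin n ] 1
      ≡⟨ sym (length-∑ (allFin n)) ⟩
    length (allFin n)
      ≡⟨ length-tabulate {n = n} id ⟩
    n ∎
    where
    open ≡-Reasoning
    complement : ∀ {X : Set} (d : Dec X) → ⟦ does d ⟧ + ⟦ does (¬? d) ⟧ ≡ 1
    complement (yes _) = refl
    complement (no _) = refl

extensions : ∀ {n m} → Vec (Fin n) m → List (Vec (Fin n) (suc m))
extensions {n} v = map (_∷ v) (filter (fresh? v) (allFin n))

injections : ∀ n m → List (Vec (Fin n) m)
injections n zero = [ [] ]
injections n (suc m) = concatMap extensions (injections n m)

∈-extensions : ∀ {n m} {v : Vec (Fin n) m} {i w} → i ∷ w ∈ extensions v → w ≡ v × Fresh v i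
∈-extensions {v = v} p with ∈-map⁻ (_∷ v) p
... | _ , q , refl = refl , proj₂ (∈-filter⁻ (fresh? v) {xs = allFin _} q)

injections-sound : ∀ n m {v} → v ∈ injections n m → Injectiveᵛ v
injections-sound n zero p () 
injections-sound n (suc m) {i ∷ v} p with find (∈-concatMap⁻ extensions {xs = injections n m} p)
... | w , w∈ , q with ∈-extensions q
... | refl , fr = inj
  where
  inj : Injectiveᵛ (i ∷ v)
  inj zero zero _ = refl
  inj zero (suc k) eq = ⊥-elim (fr k (sym eq))
  inj (suc k) zero eq = ⊥-elim (fr k eq)
  inj (suc j) (suc k) eq = cong suc (injections-sound n m w∈ j k eq)

injections-complete : ∀ n m (v : Vec (Fin n) m) → Injectiveᵛ v → v ∈ injections n m
injections-complete n zero [] inj = here refl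
injections-complete n (suc m) (i ∷ v) inj = ∈-concatMap⁺ extensions
  (lose (injections-complete n m v (λ j k eq → Fin.suc-injective (inj (suc j) (suc k) eq)))
    (∈-map⁺ (_∷ v) (∈-filter⁺ (fresh? v) (∈-allFin i) λ k eq → Fin.0≢1+n (inj zero (suc k) (sym eq)))))

injections-unique : ∀ n m → Unique (injections n m)
injections-unique n zero = [] ∷ []
injections-unique n (suc m) = Unique-concatMap extensions (injections-unique n m)
  (λ {v} _ → Unique-map⁺ Vecₚ.∷-injectiveˡ (Unique-filter⁺ (fresh? v) (allFin⁺ n)))
  λ { {z = _ ∷ _} p q → trans (sym (proj₁ (∈-extensions p))) (proj₁ (∈-extensions q)) }

injections-count : ∀ n m → m ≤ n → length (injections n m) * (n ∸ m) ! ≡ n !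
injections-count n zero le = *-identityˡ (n !)
injections-count n (suc m) le = begin
  length (injections n (suc m)) * (n ∸ suc m) !
    ≡⟨ cong (_* (n ∸ suc m) !) (length-concatMap extensions (n ∸ m) (injections n m)
         (λ {v} v∈ → trans (length-map (_∷ v) (filter (fresh? v) (allFin n))) (fresh-count v (injections-sound n m v∈)))) ⟩
  length (injections n m) * (n ∸ m) * (n ∸ suc m) !
    ≡⟨ *-assoc (length (injections n m)) (n ∸ m) _ ⟩
  length (injections n m) * ((n ∸ m) * (n ∸ suc m) !)
    ≡⟨ cong (λ z → length (injections n m) * (z * (n ∸ suc m) !)) eq ⟩
  length (injections n m) * (suc (n ∸ suc m)) !
    ≡⟨ cong (λ z → length (injections n m) * z !) (sym eq) ⟩
  length (injections n m) * (n ∸ m) !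
    ≡⟨ injections-count n m (<⇒≤ le) ⟩
  n ! ∎
  where
  open ≡-Reasoning
  eq : n ∸ m ≡ suc (n ∸ suc m)
  eq = +-∸-assoc 1 le

perms : ∀ n → List (Vertex n)
perms n = injections n n

perms-count : ∀ n → length (perms n) ≡ n !
perms-count n = trans (sym (*-identityʳ _)) (trans (cong (λ z → length (perms n) * z !) (sym (n∸n≡0 n))) (injections-count n n ≤-refl))

-- The pigeonhole principle in the form of `fresh-count`: at full length no value is fresh.
perm-surjective : ∀ {n} {x : Vertex n} → IsPerm x → ∀ p → ∃ λ k → lookup x k ≡ p
perm-surjective {n} {x} inj p with Fin.any? (λ k → lookup x k Fin.≟ p)
... | yes r = r
... | no none = ⊥-elim (n≮0 (≤-trans (s≤s (z≤n {length rest})) (≤-trans (≤-reflexive (cong length (sym eq))) (≤-reflexive (trans (fresh-count x inj) (n∸n≡0 n))))))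
  where
  p∈ : p ∈ filter (fresh? x) (allFin n)
  p∈ = ∈-filter⁺ (fresh? x) (∈-allFin p) (λ k eq → none (k , eq))
  split : ∀ {xs : List (Fin n)} → p ∈ xs → ∃₂ λ y ys → xs ≡ y ∷ ys
  split (here _) = _ , _ , refl
  split (there _) = _ , _ , refl
  rest = proj₁ (proj₂ (split p∈))
  eq = proj₂ (proj₂ (split p∈))

-- Transpositions

Transposition : ℕ → Set
Transposition n = Fin n × Fin n

_≟ᵗ_ : ∀ {n} → DecidableEquality (Transposition n)
_≟ᵗ_ = Prodₚ.≡-dec Fin._≟_ Fin._≟_

Ordered : ∀ {n} → Transposition n → Set
Ordered (i , j) = i <ᶠ j

transpositions : ∀ n → List (Transposition n)
transpositions zero = []
transpositions (suc n) = map (λ j → zero , suc j) (allFin n) ++ map (Prod.map suc suc) (transpositions n)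

transpositions-ordered : ∀ n {u} → u ∈ transpositions n → Ordered u
transpositions-ordered (suc n) u∈ with ∈-++⁻ (map (λ j → zero , suc j) (allFin n)) u∈
... | inj₁ p with ∈-map⁻ (λ j → zero , suc j) p
... | _ , _ , refl = s≤s z≤n
transpositions-ordered (suc n) u∈ | inj₂ p with ∈-map⁻ (Prod.map suc suc) p
... | _ , q , refl = s≤s (transpositions-ordered n q)

transpositions-complete : ∀ n {u} → Ordered u → u ∈ transpositions n
transpositions-complete (suc n) {zero , suc j} lt = ∈-++⁺ˡ (∈-map⁺ (λ j → zero , suc j) (∈-allFin j))
transpositions-complete (suc n) {suc i , suc j} (s≤s lt) =
  ∈-++⁺ʳ (map (λ j → zero , suc j) (allFin n)) (∈-map⁺ (Prod.map suc suc) (transpositions-complete n lt))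

transpositions-unique : ∀ n → Unique (transpositions n)
transpositions-unique zero = []
transpositions-unique (suc n) = Unique-++
  (Unique-map⁺ (λ { refl → refl }) (allFin⁺ n))
  (Unique-map⁺ (λ { {_ , _} {_ , _} refl → refl }) (transpositions-unique n))
  λ p q → clash (∈-map⁻ (λ j → zero , suc j) p) (∈-map⁻ (Prod.map suc suc) q)
  where
  clash : ∀ {z : Transposition (suc n)} → (∃ λ j → j ∈ allFin n × z ≡ (zero , suc j)) →
          (∃ λ u → u ∈ transpositions n × z ≡ Prod.map suc suc u) → ⊥
  clash (_ , _ , refl) (_ , _ , ())

transpositions-count : ∀ n → length (transpositions n) ≡ n choose 2
transpositions-count zero = refl
transpositions-count (suc n) = begin
  length (map (λ j → zero , suc j) (allFin n) ++ map (Prod.map suc suc) (transpositions n))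
    ≡⟨ length-++ (map (λ j → zero , suc j) (allFin n)) ⟩
  length (map {B = Transposition (suc n)} (λ j → zero , suc j) (allFin n)) + length (map (Prod.map suc suc) (transpositions n))
    ≡⟨ cong₂ _+_ (trans (length-map _ (allFin n)) (length-tabulate {n = n} id)) (length-map _ (transpositions n)) ⟩
  n + length (transpositions n)
    ≡⟨ cong₂ _+_ (sym (nC1≡n n)) (transpositions-count n) ⟩
  n choose 1 + n choose 2
    ≡⟨ nCk+nC[k+1]≡[n+1]C[k+1] n 1 ⟩
  suc n choose 2 ∎
  where open ≡-Reasoning

module _ {n : ℕ} where

  τ : Transposition n → Fin n → Fin n
  τ u = transpose (proj₁ u) (proj₂ u)

  τ-fst : ∀ u → τ u (proj₁ u) ≡ proj₂ u
  τ-fst (i , j) rewrite dec-true (i Fin.≟ i) refl = refl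

  τ-snd : ∀ u → τ u (proj₂ u) ≡ proj₁ u
  τ-snd (i , j) with j Fin.≟ i
  ... | yes refl = refl
  ... | no _ rewrite dec-true (j Fin.≟ j) refl = refl

  τ-fixed : ∀ u {k} → k ≢ proj₁ u → k ≢ proj₂ u → τ u k ≡ k
  τ-fixed (i , j) {k} p q rewrite dec-false (k Fin.≟ i) p | dec-false (k Fin.≟ j) q = refl

  data Position (u : Transposition n) (k : Fin n) : Set where
    first  : k ≡ proj₁ u → τ u k ≡ proj₂ u → Position u k
    second : k ≡ proj₂ u → τ u k ≡ proj₁ u → Position u k
    fixed  : k ≢ proj₁ u → k ≢ proj₂ u → τ u k ≡ k → Position u k

  position : ∀ u k → Position u k
  position u k with k Fin.≟ proj₁ u | k Fin.≟ proj₂ u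
  ... | yes refl | _ = first refl (τ-fst u)
  ... | no _ | yes refl = second refl (τ-snd u)
  ... | no p | no q = fixed p q (τ-fixed u p q)

  τ-involutive : ∀ u k → τ u (τ u k) ≡ k
  τ-involutive u k with position u k
  ... | first refl e = trans (cong (τ u) e) (τ-snd u)
  ... | second refl e = trans (cong (τ u) e) (τ-fst u)
  ... | fixed _ _ e = trans (cong (τ u) e) e

  τ-injective : ∀ u {j k} → τ u j ≡ τ u k → j ≡ k
  τ-injective u {j} {k} e = trans (sym (τ-involutive u j)) (trans (cong (τ u) e) (τ-involutive u k))

  fst≢snd : ∀ {u : Transposition n} → Ordered u → proj₁ u ≢ proj₂ u
  fst≢snd o e = Fin.<⇒≢ o e

  -- A moved point and its image are the two entries, and the order tells which comes first.
  τ-determined : ∀ {u w p} → Ordered u → Ordered w → τ u p ≢ p → τ u p ≡ τ w p → u ≡ w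
  τ-determined {u} {w} {p} ou ow ne e with position u p | position w p
  ... | first refl e₁ | first refl e₂ = cong₂ _,_ refl (trans (sym e₁) (trans e e₂))
  ... | first refl e₁ | second refl e₂ = ⊥-elim (Fin.<-asym ou (subst (_<ᶠ proj₂ w) (trans (sym e₂) (trans (sym e) e₁)) ow))
  ... | second refl e₁ | first refl e₂ = ⊥-elim (Fin.<-asym ow (subst (_<ᶠ proj₂ u) (trans (sym e₁) (trans e e₂)) ou))
  ... | second refl e₁ | second refl e₂ = cong₂ _,_ (trans (sym e₁) (trans e e₂)) refl
  ... | fixed _ _ e₁ | _ = ⊥-elim (ne e₁)
  ... | _ | fixed _ _ e₂ = ⊥-elim (ne (trans e e₂))

  τ-moves-fst : ∀ {u} → Ordered u → τ u (proj₁ u) ≢ proj₁ u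
  τ-moves-fst {u} o e = fst≢snd o (trans (sym e) (τ-fst u))

  τ-moves-snd : ∀ {u} → Ordered u → τ u (proj₂ u) ≢ proj₂ u
  τ-moves-snd {u} o e = fst≢snd o (trans (sym (τ-snd u)) e)

  -- Does the work of the sign. If `s` fixed an entry of `t`, then `w` would agree with `t` at the
  -- other entry, hence equal `t`, and `s` would be the identity. So `s` moves both entries of `t`
  -- and equals `t`.
  product-not-transposition : ∀ {s t w} → Ordered s → Ordered t → Ordered w → s ≢ t →
                              ¬ (∀ k → τ s (τ t k) ≡ τ w k)
  product-not-transposition {s} {t} {w} os ot ow s≢t eq = absurd (position s c) (position s d)
    where
    c d : Fin n
    c = proj₁ t
    d = proj₂ t
    w≢t : w ≢ t
    w≢t refl = let p = proj₁ s in τ-moves-fst os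
      (trans (cong (τ s) (sym (τ-involutive t p))) (trans (eq (τ t p)) (τ-involutive t p)))
    fix-c : τ s c ≢ c
    fix-c e = w≢t (τ-determined {w} {t} {d} ow ot
      (λ e′ → fst≢snd ot (trans (sym e) (trans (cong (τ s) (sym (τ-snd t))) (trans (eq d) e′))))
      (trans (sym (eq d)) (trans (cong (τ s) (τ-snd t)) (trans e (sym (τ-snd t))))))
    fix-d : τ s d ≢ d
    fix-d e = w≢t (τ-determined {w} {t} {c} ow ot
      (λ e′ → fst≢snd ot (trans (sym e′) (trans (sym (eq c)) (trans (cong (τ s) (τ-fst t)) e))))
      (trans (sym (eq c)) (trans (cong (τ s) (τ-fst t)) (trans e (sym (τ-fst t))))))
    absurd : Position s c → Position s d → ⊥
    absurd (fixed _ _ e) _ = fix-c e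
    absurd _ (fixed _ _ e) = fix-d e
    absurd (first p _) (first q _) = fst≢snd ot (trans p (sym q))
    absurd (second p _) (second q _) = fst≢snd ot (trans p (sym q))
    absurd (first p _) (second q _) = s≢t (cong₂ _,_ (sym p) (sym q))
    absurd (second p _) (first q _) = Fin.<-asym ot (subst₂ _<ᶠ_ (sym q) (sym p) os)

  infix 4 _∥_ _∥?_

  _∥_ : Transposition n → Transposition n → Set
  (i , j) ∥ (k , l) = (i ≢ k × i ≢ l) × (j ≢ k × j ≢ l)

  _∥?_ : ∀ u v → Dec (u ∥ v)
  (i , j) ∥? (k , l) = (¬? (i Fin.≟ k) ×-dec ¬? (i Fin.≟ l)) ×-dec (¬? (j Fin.≟ k) ×-dec ¬? (j Fin.≟ l))

  ∥-sym : ∀ {u v} → u ∥ v → v ∥ u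
  ∥-sym ((a , b) , (c , d)) = (≢-sym a , ≢-sym c) , (≢-sym b , ≢-sym d)

  ∥-irrefl : ∀ {u v} → u ∥ v → u ≢ v
  ∥-irrefl ((a , _) , _) refl = a refl

  ∥-fst : ∀ {u v} → u ∥ v → τ v (proj₁ u) ≡ proj₁ u
  ∥-fst {u} {v} ((a , b) , _) = τ-fixed v a b

  ∥-snd : ∀ {u v} → u ∥ v → τ v (proj₂ u) ≡ proj₂ u
  ∥-snd {u} {v} (_ , (c , d)) = τ-fixed v c d

  ∥-moved : ∀ {u v k} → u ∥ v → τ u k ≢ k → τ v k ≡ k × τ v (τ u k) ≡ τ u k
  ∥-moved {u} {v} {k} p ne with position u k
  ... | first refl e = ∥-fst {u} {v} p , subst (λ z → τ v z ≡ z) (sym e) (∥-snd {u} {v} p)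
  ... | second refl e = ∥-snd {u} {v} p , subst (λ z → τ v z ≡ z) (sym e) (∥-fst {u} {v} p)
  ... | fixed _ _ e = ⊥-elim (ne e)

  τ-commute : ∀ {u v} → u ∥ v → ∀ k → τ u (τ v k) ≡ τ v (τ u k)
  τ-commute {u} {v} p k with τ u k Fin.≟ k | τ v k Fin.≟ k
  ... | no ne | _ = let a , b = ∥-moved {u} {v} p ne in trans (cong (τ u) a) (sym b)
  ... | yes e | yes e′ = trans (cong (τ u) e′) (trans e (trans (sym e′) (cong (τ v) (sym e))))
  ... | yes e | no ne = let a , b = ∥-moved {v} {u} (∥-sym {u} {v} p) ne in trans b (cong (τ v) (sym e))

  ∥-product-factor : ∀ {s t k} → s ∥ t → τ s (τ t k) ≢ k → τ s k ≡ τ s (τ t k) ⊎ τ t k ≡ τ s (τ t k)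
  ∥-product-factor {s} {t} {k} p ne with τ t k Fin.≟ k
  ... | yes e = inj₁ (cong (τ s) (sym e))
  ... | no ne′ = inj₂ (sym (proj₂ (∥-moved {t} {s} (∥-sym {s} {t} p) ne′)))

  -- At the first entry of `s` the product acts as `s` alone. One of `s′`, `t′` acts there as the
  -- whole product, and `τ-determined` identifies it with `s`.
  ∥-product-injective : ∀ {s t s′ t′} → Ordered s → Ordered s′ → Ordered t′ → s ∥ t → s′ ∥ t′ →
    (∀ k → τ s (τ t k) ≡ τ s′ (τ t′ k)) → s ≡ s′ ⊎ s ≡ t′
  ∥-product-injective {s} {t} {s′} {t′} os os′ ot′ p p′ eq
    with ∥-product-factor {s′} {t′} {proj₁ s} p′ (λ e → τ-moves-fst os (trans (sym here-eq) e))
    where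
    here-eq : τ s′ (τ t′ (proj₁ s)) ≡ τ s (proj₁ s)
    here-eq = trans (sym (eq (proj₁ s))) (cong (τ s) (∥-fst {s} {t} p))
  ... | inj₁ e = inj₁ (τ-determined os os′ (τ-moves-fst os) (sym (trans e (trans (sym (eq (proj₁ s))) (cong (τ s) (∥-fst {s} {t} p))))))
  ... | inj₂ e = inj₂ (τ-determined os ot′ (τ-moves-fst os) (sym (trans e (trans (sym (eq (proj₁ s))) (cong (τ s) (∥-fst {s} {t} p))))))

  order : Fin n → Fin n → Transposition n
  order p q with p Fin.<? q
  ... | yes _ = p , q
  ... | no _ = q , p

  transpose-sym : ∀ i j k → transpose i j k ≡ transpose j i k
  transpose-sym i j k with position (i , j) k
  ... | first refl e = trans e (sym (τ-snd (j , i)))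
  ... | second refl e = trans e (sym (τ-fst (j , i)))
  ... | fixed p q e = trans e (sym (τ-fixed (j , i) q p))

  τ-order : ∀ p q k → τ (order p q) k ≡ transpose p q k
  τ-order p q k with p Fin.<? q
  ... | yes _ = refl
  ... | no _ = transpose-sym q p k

  order-ordered : ∀ {p q} → p ≢ q → Ordered (order p q)
  order-ordered {p} {q} ne with p Fin.<? q
  ... | yes lt = lt
  ... | no ≮ = ≤∧≢⇒< (≮⇒≥ ≮) (λ e → ne (Fin.toℕ-injective (sym e)))

  -- The transposition vuv, which labels the side from vx to vux of the square x, ux, vux, vx.
  conj : Transposition n → Transposition n → Transposition n
  conj v u = order (τ v (proj₁ u)) (τ v (proj₂ u))

  conj-ordered : ∀ v {u} → Ordered u → Ordered (conj v u)
  conj-ordered v o = order-ordered (λ e → fst≢snd o (τ-injective v e))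

  τ-conj : ∀ v u k → τ (conj v u) k ≡ τ v (τ u (τ v k))
  τ-conj v u k = trans (τ-order _ _ k) (go (position u (τ v k)))
    where
    undo : ∀ {z} → τ v k ≡ z → k ≡ τ v z
    undo refl = sym (τ-involutive v k)
    go : Position u (τ v k) → transpose (τ v (proj₁ u)) (τ v (proj₂ u)) k ≡ τ v (τ u (τ v k))
    go (first p e) = trans (cong (transpose _ _) (undo p)) (trans (τ-fst (τ v (proj₁ u) , τ v (proj₂ u))) (cong (τ v) (sym e)))
    go (second p e) = trans (cong (transpose _ _) (undo p)) (trans (τ-snd (τ v (proj₁ u) , τ v (proj₂ u))) (cong (τ v) (sym e)))
    go (fixed p q e) = trans (τ-fixed (τ v (proj₁ u) , τ v (proj₂ u)) (λ k≡ → p (trans (cong (τ v) k≡) (τ-involutive v _))) (λ k≡ → q (trans (cong (τ v) k≡) (τ-involutive v _))))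
      (trans (sym (τ-involutive v k)) (cong (τ v) (sym e)))

  τ-ext : ∀ {u w} → Ordered u → Ordered w → (∀ k → τ u k ≡ τ w k) → u ≡ w
  τ-ext {u} ou ow eq = τ-determined ou ow (τ-moves-fst ou) (eq (proj₁ u))

  conj-involutive : ∀ v {u} → Ordered u → conj v (conj v u) ≡ u
  conj-involutive v {u} o = τ-ext (conj-ordered v (conj-ordered v o)) o λ k →
    trans (τ-conj v (conj v u) k) (trans (cong (τ v) (τ-conj v u (τ v k)))
      (trans (τ-involutive v _) (cong (τ u) (τ-involutive v k))))

  conj-self : ∀ {v} → Ordered v → conj v v ≡ v
  conj-self {v} o = τ-ext (conj-ordered v o) o λ k → trans (τ-conj v v k) (τ-involutive v _)

  -- A transposition that meets `u` has one of the two entries of `u` in one of its two positions,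
  -- with `n` choices for the other position.
  few-touching : ∀ u → ∑[ v ∈ transpositions n ] ⟦ does (¬? (u ∥? v)) ⟧ ≤ 4 * n
  few-touching (i , j) = ≤-trans (∑-support _ (transpositions-unique n) (λ {v} _ nz → touching v (⟦⟧≢0 nz)))
    (≤-trans (∑-≤-const ys 1 (λ {v} _ → ⟦⟧-≤1 (does (¬? ((i , j) ∥? v))))) (≤-reflexive size))
    where
    star star′ : Fin n → List (Transposition n)
    star p = map (p ,_) (allFin n)
    star′ p = map (_, p) (allFin n)
    ys : List (Transposition n)
    ys = star i ++ (star′ i ++ (star j ++ star′ j))
    star-size : ∀ p → length (star p) ≡ n
    star-size p = trans (length-map _ (allFin n)) (length-tabulate {n = n} id)
    star′-size : ∀ p → length (star′ p) ≡ n
    star′-size p = trans (length-map _ (allFin n)) (length-tabulate {n = n} id)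
    size : length ys * 1 ≡ 4 * n
    size = trans (*-identityʳ _) (trans (length-++ (star i)) (cong₂ _+_ (star-size i) (trans (length-++ (star′ i)) (cong₂ _+_ (star′-size i)
      (trans (length-++ (star j)) (cong₂ _+_ (star-size j) (trans (star′-size j) (sym (+-identityʳ n)))))))))
    touching : ∀ v → T (does (¬? ((i , j) ∥? v))) → v ∈ ys
    touching (k , l) t with i Fin.≟ k | i Fin.≟ l | j Fin.≟ k | j Fin.≟ l
    ... | yes refl | _ | _ | _ = ∈-++⁺ˡ (∈-map⁺ (i ,_) (∈-allFin l))
    ... | no _ | yes refl | _ | _ = ∈-++⁺ʳ (star i) (∈-++⁺ˡ (∈-map⁺ (_, i) (∈-allFin k)))
    ... | no _ | no _ | yes refl | _ = ∈-++⁺ʳ (star i) (∈-++⁺ʳ (star′ i) (∈-++⁺ˡ (∈-map⁺ (j ,_) (∈-allFin l))))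
    ... | no _ | no _ | no _ | yes refl = ∈-++⁺ʳ (star i) (∈-++⁺ʳ (star′ i) (∈-++⁺ʳ (star j) (∈-map⁺ (_, j) (∈-allFin k))))
    ... | no _ | no _ | no _ | no _ = ⊥-elim t

-- Subgraphs of the complete transposition graph

⟨_⟩ : {X : Set} → Dec X → ℕ
⟨ d ⟩ = ⟦ does d ⟧

T-does⁻ : {X : Set} (d : Dec X) → T (does d) → X
T-does⁻ (yes x) _ = x

⟨⟩-yes : {X : Set} (d : Dec X) → X → ⟨ d ⟩ ≡ 1
⟨⟩-yes d x = cong ⟦_⟧ (dec-true d x)

⟨⟩-no : {X : Set} (d : Dec X) → ¬ X → ⟨ d ⟩ ≡ 0
⟨⟩-no d ¬x = cong ⟦_⟧ (dec-false d ¬x)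

does-cong : {X Y : Set} (d : Dec X) (e : Dec Y) → (X → Y) → (Y → X) → does d ≡ does e
does-cong (yes x) e f g = sym (dec-true e (f x))
does-cong (no ¬x) e f g = sym (dec-false e (¬x ∘ g))

⟨⟩-cong : {X Y : Set} (d : Dec X) (e : Dec Y) → (X → Y) → (Y → X) → ⟨ d ⟩ ≡ ⟨ e ⟩
⟨⟩-cong d e f g = cong ⟦_⟧ (does-cong d e f g)

⟨⟩-≤1 : {X : Set} (d : Dec X) → ⟨ d ⟩ ≤ 1
⟨⟩-≤1 d = ⟦⟧-≤1 (does d)

⟨⟩-¬ : {X : Set} (d : Dec X) → ⟨ d ⟩ + ⟨ ¬? d ⟩ ≡ 1
⟨⟩-¬ (yes _) = refl
⟨⟩-¬ (no _) = refl

∑-concatMap : (φ : A → List B) (xs : List A) (f : B → ℕ) → ∑ (concatMap φ xs) f ≡ ∑[ x ∈ xs ] ∑ (φ x) f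
∑-concatMap φ [] f = refl
∑-concatMap φ (x ∷ xs) f = trans (∑-++ (φ x) (concatMap φ xs) f) (cong (∑ (φ x) f +_) (∑-concatMap φ xs f))

Walk-map : {R Q : A → A → Set} → (∀ {x y} → R x y → Q x y) → ∀ {x xs y} → Walk R x xs y → Walk Q x xs y
Walk-map f [] = []
Walk-map f (r ∷ w) = f r ∷ Walk-map f w

module _ {n : ℕ} where

  act : Transposition n → Vertex n → Vertex n
  act u = Vec.map (τ u)

  lookup-act : ∀ u x k → lookup (act u x) k ≡ τ u (lookup x k)
  lookup-act u x k = Vecₚ.lookup-map k (τ u) x

  lookup-act² : ∀ u v x k → lookup (act u (act v x)) k ≡ τ u (τ v (lookup x k))
  lookup-act² u v x k = trans (lookup-act u (act v x) k) (cong (τ u) (lookup-act v x k))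

  act-involutive : ∀ u x → act u (act u x) ≡ x
  act-involutive u x = trans (sym (Vecₚ.map-∘ (τ u) (τ u) x)) (trans (Vecₚ.map-cong (τ-involutive u) x) (Vecₚ.map-id x))

  act-commute : ∀ {u v} → u ∥ v → ∀ x → act u (act v x) ≡ act v (act u x)
  act-commute {u} {v} p x = trans (sym (Vecₚ.map-∘ (τ u) (τ v) x)) (trans (Vecₚ.map-cong (τ-commute {u = u} {v} p) x) (Vecₚ.map-∘ (τ v) (τ u) x))

  act-conj : ∀ v u x → act (conj v u) x ≡ act v (act u (act v x))
  act-conj v u x = trans (Vecₚ.map-cong (τ-conj v u) x)
    (trans (Vecₚ.map-∘ (τ v) (τ u ∘ τ v) x) (cong (act v) (Vecₚ.map-∘ (τ u) (τ v) x)))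

  act-perm : ∀ u {x} → IsPerm x → IsPerm (act u x)
  act-perm u {x} p i j eq = p i j (τ-injective u (trans (sym (lookup-act u x i)) (trans eq (lookup-act u x j))))

  act-injective : ∀ u {x y} → act u x ≡ act u y → x ≡ y
  act-injective u {x} {y} e = trans (sym (act-involutive u x)) (trans (cong (act u) e) (act-involutive u y))

  -- Every point is a value of `x`, so equal images of `x` come from equal permutations. The names
  -- below count the transpositions on either side.
  module Free {x : Vertex n} (perm : IsPerm x) where

    everywhere : {g h : Fin n → Fin n} → (∀ k → g (lookup x k) ≡ h (lookup x k)) → ∀ p → g p ≡ h p
    everywhere eq p with perm-surjective {x = x} perm p
    ... | k , refl = eq k

    zero-one : ∀ {s} → Ordered s → act s x ≢ x
    zero-one {s} o e = τ-moves-fst o (everywhere {g = τ s} {h = id} (λ k → trans (sym (lookup-act s x k)) (cong (λ z → lookup z k) e)) (proj₁ s))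

    one-one : ∀ {s t} → Ordered s → Ordered t → act s x ≡ act t x → s ≡ t
    one-one {s} {t} os ot e = τ-ext os ot (everywhere λ k →
      trans (sym (lookup-act s x k)) (trans (cong (λ z → lookup z k) e) (lookup-act t x k)))

    zero-two : ∀ {s t} → Ordered s → Ordered t → s ≢ t → act s (act t x) ≢ x
    zero-two {s} os ot ne e = ne (one-one os ot (sym (act-injective s (trans e (sym (act-involutive s x))))))

    one-two : ∀ {s t w} → Ordered s → Ordered t → Ordered w → s ≢ t → act s (act t x) ≢ act w x
    one-two {s} {t} {w} os ot ow ne e = product-not-transposition os ot ow ne (everywhere λ k →
      trans (sym (lookup-act² s t x k)) (trans (cong (λ z → lookup z k) e) (lookup-act w x k)))

    two-two : ∀ {s t s′ t′} → Ordered s → Ordered s′ → Ordered t′ → s ∥ t → s′ ∥ t′ →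
              act s (act t x) ≡ act s′ (act t′ x) → s ≡ s′ ⊎ s ≡ t′
    two-two {s} {t} {s′} {t′} os os′ ot′ p p′ e = ∥-product-injective {t = t} os os′ ot′ p p′ (everywhere λ k →
      trans (sym (lookup-act² s t x k)) (trans (cong (λ z → lookup z k) e) (lookup-act² s′ t′ x k)))

lookup-injective : {xs : List A} → Unique xs → ∀ {i j} → List.lookup xs i ≡ List.lookup xs j → i ≡ j
lookup-injective (x∉ ∷ u) {zero} {zero} e = refl
lookup-injective {xs = x ∷ xs} (x∉ ∷ u) {zero} {suc j} e = ⊥-elim (All.lookup x∉ (∈-lookup {xs = xs} j) e)
lookup-injective {xs = x ∷ xs} (x∉ ∷ u) {suc i} {zero} e = ⊥-elim (All.lookup x∉ (∈-lookup {xs = xs} i) (sym e))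
lookup-injective (x∉ ∷ u) {suc i} {suc j} e = cong suc (lookup-injective u e)

walk-steps : {R : A → A → Set} → ∀ {x y z ys} → Walk R x (y ∷ ys) z →
  (∀ (i : Fin (length ys)) → R (List.lookup (y ∷ ys) (inject₁ i)) (List.lookup (y ∷ ys) (suc i))) ×
  R (List.lookup (y ∷ ys) (fromℕ (length ys))) z
walk-steps (r ∷ []) = (λ ()) , r
walk-steps {R = R} (r ∷ (r′ ∷ w)) with walk-steps (r′ ∷ w)
... | inner , final = (λ { zero → r ; (suc i) → inner i }) , final

module _ {n : ℕ} (F : SubgraphCT n) where

  closed-walk⇒cycle : ∀ {x xs m} → Walk (EdgeIn F) x xs x → Unique xs → length xs ≡ suc m → HasCycle F (suc m)
  closed-walk⇒cycle {xs = y ∷ ys} w@(_ ∷ _) u refl with walk-steps w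
  ... | inner , final = List.lookup (y ∷ ys) , lookup-injective u , inner , final

  EdgeIn-sym : ∀ {x y} → EdgeIn F x y → EdgeIn F y x
  EdgeIn-sym (inj₁ p) = inj₂ p
  EdgeIn-sym (inj₂ p) = inj₁ p

  edgeIn? : ∀ x y → Dec (EdgeIn F x y)
  edgeIn? x y = ((x , y) ∈? edges F) ⊎-dec ((y , x) ∈? edges F)
    where open DecMembership (Prodₚ.≡-dec (Vecₚ.≡-dec Fin._≟_) (Vecₚ.≡-dec Fin._≟_)) using (_∈?_)

  edge-perm : ∀ {x y} → EdgeIn F x y → IsPerm x
  edge-perm (inj₁ p) = proj₁ (All.lookup (areEdges F) p)
  edge-perm (inj₂ p) = proj₁ (proj₂ (All.lookup (areEdges F) p))

  private
    ts : List (Transposition n)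
    ts = transpositions n

    ps : List (Vertex n)
    ps = perms n

  degree : Vertex n → ℕ
  degree x = ∑[ u ∈ ts ] ⟨ edgeIn? x (act u x) ⟩

  degreeSum : ℕ
  degreeSum = ∑ ps degree

  ∑-act : ∀ u (f : Vertex n → ℕ) → ∑[ x ∈ ps ] f (act u x) ≡ ∑ ps f
  ∑-act u = ∑-involution (act u) (injections-unique n n)
    (λ {x} x∈ → injections-complete n n (act u x) (act-perm u {x} (injections-sound n n x∈)))
    (λ {x} _ → act-involutive u x)

  edge-direction : ∀ {x y} → EdgeIn F x y → ∃ λ u → u ∈ ts × y ≡ act u x
  edge-direction (inj₁ p) with All.lookup (areEdges F) p
  ... | _ , _ , i , j , i≢j , eq = order i j , transpositions-complete n (order-ordered i≢j) ,
    trans eq (sym (Vecₚ.map-cong (τ-order i j) _))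
  edge-direction {x} (inj₂ p) with edge-direction (inj₁ p)
  ... | u , u∈ , eq = u , u∈ , trans (sym (act-involutive u _)) (cong (act u) (sym eq))

  private
    darts : List (Edge n)
    darts = edges F ++ map Prod.swap (edges F)

    AllPairs-∈ : ∀ {es} → AllPairs (λ e e′ → ¬ SameEdge e e′) es →
                 ∀ {e e′} → e ∈ es → e′ ∈ es → SameEdge e e′ → e ≡ e′
    AllPairs-∈ (p ∷ ps) (here refl) (here refl) s = refl
    AllPairs-∈ (p ∷ ps) (here refl) (there q) s = ⊥-elim (All.lookup p q s)
    AllPairs-∈ (p ∷ ps) (there q) (here refl) s = ⊥-elim (All.lookup p q (flip-same s))
      where
      flip-same : ∀ {e e′ : Edge n} → SameEdge e e′ → SameEdge e′ e
      flip-same (inj₁ (a , b)) = inj₁ (sym a , sym b)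
      flip-same (inj₂ (a , b)) = inj₂ (sym b , sym a)
    AllPairs-∈ (p ∷ ps) (there q) (there r) s = AllPairs-∈ ps q r s

    darts-unique : Unique darts
    darts-unique = Unique-++ edges! (Unique-map⁺ (λ { {_ , _} {_ , _} refl → refl }) edges!) clash
      where
      edges! : Unique (edges F)
      edges! = AllPairs.map (λ { ¬same refl → ¬same (inj₁ (refl , refl)) }) (distinct F)
      clash : ∀ {e} → e ∈ edges F → e ∈ map Prod.swap (edges F) → ⊥
      clash {x , y} p q with ∈-map⁻ Prod.swap q
      -- An entry whose reversal is also listed must equal that reversal, hence would be a loop.
      ... | (_ , _) , q′ , refl with AllPairs-∈ (distinct F) p q′ (inj₂ (refl , refl))
      ... | refl with edge-direction (inj₁ p)
      ... | u , u∈ , eq = Free.zero-one {x = x} (edge-perm (inj₁ p)) (transpositions-ordered n u∈) (sym eq)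

    dart-edge : ∀ {e} → e ∈ darts → EdgeIn F (proj₁ e) (proj₂ e)
    dart-edge e∈ with ∈-++⁻ (edges F) e∈
    ... | inj₁ p = inj₁ p
    ... | inj₂ p with ∈-map⁻ Prod.swap p
    ... | (_ , _) , q , refl = inj₂ q

    out : Vertex n → List (Edge n)
    out x = map (λ u → x , act u x) ts

  handshake : 2 * numEdges F ≤ degreeSum
  handshake = begin
    2 * numEdges F
      ≡⟨ cong (numEdges F +_) (+-identityʳ _) ⟩
    numEdges F + numEdges F
      ≡⟨ sym (trans (length-++ (edges F)) (cong (numEdges F +_) (length-map Prod.swap (edges F)))) ⟩
    length darts
      ≡⟨ length-∑ darts ⟩
    ∑[ _ ∈ darts ] 1
      ≡⟨ ∑-cong darts (λ {e} e∈ → sym (⟨⟩-yes (edgeIn? (proj₁ e) (proj₂ e)) (dart-edge e∈))) ⟩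
    ∑ darts weight
      ≤⟨ ∑-⊆ weight darts-unique listed ⟩
    ∑ (concatMap out ps) weight
      ≡⟨ trans (∑-concatMap out ps weight) (∑-cong ps (λ _ → ∑-map _ ts weight)) ⟩
    degreeSum ∎
    where
    open ≤-Reasoning
    weight : Edge n → ℕ
    weight e = ⟨ edgeIn? (proj₁ e) (proj₂ e) ⟩
    listed : ∀ {e} → e ∈ darts → e ∈ concatMap out ps
    listed {x , y} e∈ with edge-direction (dart-edge e∈)
    ... | u , u∈ , refl = ∈-concatMap⁺ out
      (lose (injections-complete n n x (edge-perm (dart-edge e∈))) (∈-map⁺ (λ u → x , act u x) u∈))

-- The link of a vertex

⟨⟩-split : {X Y Z : Set} (c : Dec X) (d : Dec Y) (e : Dec Z) → ⟨ d ⟩ * ⟨ e ⟩ ≤ ⟨ c ×-dec d ×-dec e ⟩ + ⟨ d ⟩ * ⟨ ¬? c ⟩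
⟨⟩-split (yes _) (yes _) (yes _) = s≤s z≤n
⟨⟩-split (yes _) (yes _) (no _) = z≤n
⟨⟩-split (yes _) (no _) _ = z≤n
⟨⟩-split (no _) (yes _) (yes _) = s≤s z≤n
⟨⟩-split (no _) (yes _) (no _) = z≤n
⟨⟩-split (no _) (no _) _ = z≤n

module Link {n : ℕ} (F : SubgraphCT n) where

  private
    ts : List (Transposition n)
    ts = transpositions n

    ps : List (Vertex n)
    ps = perms n

  -- The two sides of the square x, ux, uvx, vx away from `x`. The sides at `x` are left open; the
  -- bound for hexagons distinguishes whether they belong to `F`.
  Linked : Vertex n → Transposition n → Transposition n → Set
  Linked x u v = u ∥ v × EdgeIn F (act u x) (act u (act v x)) × EdgeIn F (act v x) (act u (act v x))

  linked? : ∀ x u v → Dec (Linked x u v)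
  linked? x u v = (u ∥? v) ×-dec edgeIn? F (act u x) (act u (act v x)) ×-dec edgeIn? F (act v x) (act u (act v x))

  linked-sym : ∀ x {u v} → Linked x u v → Linked x v u
  linked-sym x {u} {v} (p , e , e′) =
    ∥-sym {u = u} {v} p , subst (EdgeIn F (act v x)) eq e′ , subst (EdgeIn F (act u x)) eq e
    where
    eq : act u (act v x) ≡ act v (act u x)
    eq = act-commute {u = u} {v} p x

  linked-irrefl : ∀ x {u} → ¬ Linked x u u
  linked-irrefl x {u} (p , _) = ∥-irrefl {u = u} {u} p refl

  module Expand {x : Vertex n} (perm : IsPerm x) where

    open Free {x = x} perm

    expand : ∀ {v ws u} → Walk (Linked x) v ws u → List (Vertex n)
    expand [] = []
    expand (_∷_ {x = v} {y = w} r rest) = act v x ∷ act v (act w x) ∷ expand rest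

    expand-walk : ∀ {v ws u} (w : Walk (Linked x) v ws u) → Walk (EdgeIn F) (act v x) (expand w) (act u x)
    expand-walk [] = []
    expand-walk ((_ , e , e′) ∷ rest) = e ∷ EdgeIn-sym F e′ ∷ expand-walk rest

    expand-length : ∀ {v ws u} (w : Walk (Linked x) v ws u) → length (expand w) ≡ 2 * length ws
    expand-length [] = refl
    expand-length (_∷_ {ys = ys} r rest) = trans (cong (2 +_) (expand-length rest)) (sym (*-suc 2 (length ys)))

    -- The two kinds are kept apart by `one-two`. A second factor may be the end `u` of the walk,
    -- which `ws` does not list.
    data Shape (ws : List (Transposition n)) (u : Transposition n) (z : Vertex n) : Set where
      one : ∀ {s} → s ∈ ws → z ≡ act s x → Shape ws u z
      two : ∀ {s t} → s ∈ ws → t ∈ u ∷ ws → s ∥ t → z ≡ act s (act t x) → Shape ws u z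

    weaken : ∀ {v ws u z} → Shape ws u z → Shape (v ∷ ws) u z
    weaken (one s∈ e) = one (there s∈) e
    weaken (two s∈ (here t≡) p e) = two (there s∈) (here t≡) p e
    weaken (two s∈ (there t∈) p e) = two (there s∈) (there (there t∈)) p e

    walk-end : ∀ {v ws u} → Walk (Linked x) v ws u → v ∈ u ∷ ws
    walk-end [] = here refl
    walk-end (_ ∷ _) = there (here refl)

    shape : ∀ {v ws u} (w : Walk (Linked x) v ws u) → ∀ {z} → z ∈ expand w → Shape ws u z
    shape (r ∷ rest) (here e) = one (here refl) e
    shape (r ∷ rest) (there (here e)) with walk-end rest
    ... | here eq = two (here refl) (here eq) (proj₁ r) e
    ... | there w∈ = two (here refl) (there (there w∈)) (proj₁ r) e
    shape (r ∷ rest) (there (there z∈)) = weaken (shape rest z∈)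

    one∉ : ∀ {v ws u s} (w : Walk (Linked x) v ws u) → All Ordered (u ∷ ws) → Ordered s → s ∉ ws → act s x ∉ expand w
    one∉ w (ou ∷ os) o s∉ z∈ with shape w z∈
    ... | one t∈ e = s∉ (subst (_∈ _) (sym (one-one o (All.lookup os t∈) e)) t∈)
    ... | two {s = t} {t′} t∈ t′∈ p e = one-two (All.lookup os t∈) (All.lookup (ou ∷ os) t′∈) o (∥-irrefl {u = t} {t′} p) (sym e)

    two∉ : ∀ {v ws u s t} (w : Walk (Linked x) v ws u) → All Ordered (u ∷ ws) → Ordered s → Ordered t → s ∥ t →
           s ∉ u ∷ ws → act s (act t x) ∉ expand w
    two∉ {s = s} {t} w (ou ∷ os) o o′ p s∉ z∈ with shape w z∈
    ... | one r∈ e = one-two o o′ (All.lookup os r∈) (∥-irrefl {u = s} {t} p) e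
    ... | two {s = s′} {t′} s′∈ t′∈ p′ e with two-two {t = t} o (All.lookup os s′∈) (All.lookup (ou ∷ os) t′∈) p p′ e
    ... | inj₁ refl = s∉ (there s′∈)
    ... | inj₂ refl = s∉ t′∈

    expand-unique : ∀ {v ws u} (w : Walk (Linked x) v ws u) → All Ordered (u ∷ ws) → Unique (u ∷ ws) → Unique (expand w)
    expand-unique [] o! _ = []
    expand-unique {v} {ws = _ ∷ ws} {u} (_∷_ {y = w} r rest) (ou ∷ ov ∷ os) ((u≢v ∷ u∉) ∷ v∉ ∷ ws!) =
      ((λ e → one-two ov ow ov (∥-irrefl {u = v} {w} (proj₁ r)) (sym e)) ∷ ∉⇒All≢ (one∉ rest (ou ∷ os) ov v∉ws)) ∷
      ∉⇒All≢ (two∉ rest (ou ∷ os) ov ow (proj₁ r) v∉uws) ∷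
      expand-unique rest (ou ∷ os) (u∉ ∷ ws!)
      where
      ow : Ordered w
      ow = All.lookup (ou ∷ os) (walk-end rest)
      v∉ws : v ∉ ws
      v∉ws p = All.lookup v∉ p refl
      v∉uws : v ∉ u ∷ ws
      v∉uws (here e) = u≢v (sym e)
      v∉uws (there p) = v∉ws p

    -- the arc of the F-cycle over a cycle of the link of x that avoids the edge from act u x to act u (act v x)
    arc : ∀ {v ws u} → Walk (Linked x) v ws u → List (Vertex n)
    arc {v} {ws} {u} w = act u (act v x) ∷ expand w

    arc-walk : ∀ {v ws u} → Linked x u v → (w : Walk (Linked x) v ws u) →
               Walk (EdgeIn F) (act u (act v x)) (arc w) (act u x)
    arc-walk (_ , _ , e′) w = EdgeIn-sym F e′ ∷ expand-walk w

    -- A walk of a single step would lead from `v` straight to `u`, and its vertex vux would repeat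
    -- the initial uvx; `2 ≤ length ws` excludes this.
    arc-unique : ∀ {v ws u} → Linked x u v → (w : Walk (Linked x) v ws u) → 2 ≤ length ws →
                 All Ordered (u ∷ ws) → Unique (u ∷ ws) → Unique (act u x ∷ arc w)
    arc-unique _ [] () 
    arc-unique {v} {_ ∷ ws} {u} (p , _) w@(_∷_ {y = w′} r rest) (s≤s le) os@(ou ∷ ov ∷ ows) us@((u≢v ∷ u∉) ∷ v∉ ∷ _) =
      ((λ e → one-two ou ov ou (∥-irrefl {u = u} {v} p) (sym e)) ∷ ∉⇒All≢ (one∉ w os ou (λ q → All.lookup (u≢v ∷ u∉) q refl))) ∷
      (first-one ∷ first-two ∷ ∉⇒All≢ rest∉) ∷
      expand-unique w os us
      where
      next : ∀ {y ws} → Walk (Linked x) y ws u → 1 ≤ length ws → y ∈ ws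
      next (_ ∷ _) _ = here refl
      w′∈ : w′ ∈ ws
      w′∈ = next rest le
      first-one : act u (act v x) ≢ act v x
      first-one = one-two ou ov ov (∥-irrefl {u = u} {v} p)
      first-two : act u (act v x) ≢ act v (act w′ x)
      first-two e with two-two {t = v} ou ov (All.lookup ows w′∈) p (proj₁ r) e
      ... | inj₁ u≡v = u≢v u≡v
      ... | inj₂ u≡w′ = All.lookup u∉ w′∈ u≡w′
      rest∉ : act u (act v x) ∉ expand rest
      rest∉ z∈ = two∉ {s = v} {u} rest (ou ∷ ows) ov ou (∥-sym {u = u} {v} p)
        (λ { (here e) → u≢v (sym e) ; (there q) → All.lookup v∉ q refl })
        (subst (_∈ expand rest) (act-commute {u = u} {v} p x) z∈)

    arc-length : ∀ {v ws u} (w : Walk (Linked x) v ws u) → length (arc w) ≡ suc (2 * length ws)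
    arc-length w = cong suc (expand-length w)

    link-cycle : ∀ m → 3 ≤ m → Cycle (Linked x) ts m → HasCycle F (2 * m)
    link-cycle (suc m) (s≤s le) (u , u ∷ ws , r ∷ w , us , size , ins) =
      subst (HasCycle F) (sym (*-suc 2 m)) (closed-walk⇒cycle F
        (proj₁ (proj₂ r) ∷ arc-walk r w)
        (arc-unique r w (subst (2 ≤_) (sym size′) le) (All.map (transpositions-ordered n) ins) us)
        (cong suc (trans (arc-length w) (cong (λ z → suc (2 * z)) size′))))
      where
      size′ : length ws ≡ m
      size′ = suc-injective size

  linkSum : ℕ
  linkSum = ∑[ x ∈ ps ] ∑[ u ∈ ts ] ∑[ v ∈ ts ] ⟨ linked? x u v ⟩

  private
    cherry? : ∀ z u v → Dec (u ∥ v × EdgeIn F z (act u z) × EdgeIn F z (act v z))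
    cherry? z u v = (u ∥? v) ×-dec edgeIn? F z (act u z) ×-dec edgeIn? F z (act v z)

    -- Substitute z = uvx: the neighbours uz and vz become vx and ux, so two edges at `z` are a link
    -- edge of `x`.
    cherry-link : ∀ u v → ∑[ z ∈ ps ] ⟨ cherry? z u v ⟩ ≡ ∑[ x ∈ ps ] ⟨ linked? x u v ⟩
    cherry-link u v = trans (sym (trans (∑-act F v (λ x → ⟨ cherry? (act u x) u v ⟩)) (∑-act F u (λ z → ⟨ cherry? z u v ⟩))))
      (∑-cong ps (λ {x} _ → ⟨⟩-cong (cherry? (act u (act v x)) u v) (linked? x u v) (to x) (from x)))
      where
      u-side : ∀ x → act u (act u (act v x)) ≡ act v x
      u-side x = act-involutive u (act v x)
      v-side : u ∥ v → ∀ x → act v (act u (act v x)) ≡ act u x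
      v-side p x = trans (cong (act v) (act-commute {u = u} {v} p x)) (act-involutive v (act u x))
      to : ∀ x → u ∥ v × EdgeIn F (act u (act v x)) (act u (act u (act v x))) × EdgeIn F (act u (act v x)) (act v (act u (act v x))) → Linked x u v
      to x (p , e , e′) = p , EdgeIn-sym F (subst (EdgeIn F _) (v-side p x) e′) , EdgeIn-sym F (subst (EdgeIn F _) (u-side x) e)
      from : ∀ x → Linked x u v → u ∥ v × EdgeIn F (act u (act v x)) (act u (act u (act v x))) × EdgeIn F (act u (act v x)) (act v (act u (act v x)))
      from x (p , e , e′) = p , subst (EdgeIn F _) (sym (u-side x)) (EdgeIn-sym F e′) , subst (EdgeIn F _) (sym (v-side p x)) (EdgeIn-sym F e)

  -- Pairs of edges at `z` whose transpositions meet, equal ones included, cost at most `4 * n` for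
  -- each edge at `z`.
  cherry-count : ∑[ z ∈ ps ] (degree F z * degree F z) ≤ linkSum + 4 * n * degreeSum F
  cherry-count = begin
    ∑[ z ∈ ps ] (degree F z * degree F z)
      ≤⟨ ∑-mono ps (λ {z} _ → at z) ⟩
    ∑[ z ∈ ps ] ((∑[ u ∈ ts ] ∑[ v ∈ ts ] ⟨ cherry? z u v ⟩) + 4 * n * degree F z)
      ≡⟨ trans (∑-+ ps _ _) (cong₂ _+_ reorder (∑-*ˡ ps (4 * n) (degree F))) ⟩
    linkSum + 4 * n * degreeSum F ∎
    where
    open ≤-Reasoning
    d : Vertex n → Transposition n → ℕ
    d z u = ⟨ edgeIn? F z (act u z) ⟩
    pair : ∀ z u v → d z u * d z v ≤ ⟨ cherry? z u v ⟩ + d z u * ⟨ ¬? (u ∥? v) ⟩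
    pair z u v = ⟨⟩-split (u ∥? v) (edgeIn? F z (act u z)) (edgeIn? F z (act v z))
    at : ∀ z → degree F z * degree F z ≤ (∑[ u ∈ ts ] ∑[ v ∈ ts ] ⟨ cherry? z u v ⟩) + 4 * n * degree F z
    at z = begin
      degree F z * degree F z
        ≡⟨ sym (∑-product ts ts (d z) (d z)) ⟩
      ∑[ u ∈ ts ] ∑[ v ∈ ts ] (d z u * d z v)
        ≤⟨ ∑-mono ts (λ {u} _ → ∑-mono ts (λ {v} _ → pair z u v)) ⟩
      ∑[ u ∈ ts ] ∑[ v ∈ ts ] (⟨ cherry? z u v ⟩ + d z u * ⟨ ¬? (u ∥? v) ⟩)
        ≡⟨ trans (∑-cong ts (λ _ → ∑-+ ts _ _)) (∑-+ ts _ _) ⟩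
      K + (∑[ u ∈ ts ] ∑[ v ∈ ts ] (d z u * ⟨ ¬? (u ∥? v) ⟩))
        ≤⟨ +-monoʳ-≤ K (∑-mono ts (λ {u} _ → ≤-trans (≤-reflexive (∑-*ˡ ts (d z u) _)) (*-monoʳ-≤ (d z u) (few-touching u)))) ⟩
      K + (∑[ u ∈ ts ] (d z u * (4 * n)))
        ≡⟨ cong (K +_) (trans (∑-*ʳ ts (4 * n) (d z)) (*-comm _ (4 * n))) ⟩
      K + 4 * n * degree F z ∎
      where K = ∑[ u ∈ ts ] ∑[ v ∈ ts ] ⟨ cherry? z u v ⟩
    reorder : ∑[ z ∈ ps ] ∑[ u ∈ ts ] ∑[ v ∈ ts ] ⟨ cherry? z u v ⟩ ≡ linkSum
    reorder = trans (bring cherry?′)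
      (trans (∑-cong ts (λ {u} _ → ∑-cong ts (λ {v} _ → cherry-link u v))) (sym (bring (λ x u v → ⟨ linked? x u v ⟩))))
      where
      cherry?′ : Vertex n → Transposition n → Transposition n → ℕ
      cherry?′ z u v = ⟨ cherry? z u v ⟩
      bring : ∀ (f : Vertex n → Transposition n → Transposition n → ℕ) →
              ∑[ z ∈ ps ] ∑[ u ∈ ts ] ∑[ v ∈ ts ] f z u v ≡ ∑[ u ∈ ts ] ∑[ v ∈ ts ] ∑[ z ∈ ps ] f z u v
      bring f = trans (∑-swap ps ts _) (∑-cong ts (λ {u} _ → ∑-swap ps ts _))

-- Four-cycles

∑-partition : {P : A → Set} (P? : ∀ x → Dec (P x)) (xs : List A) (f : A → ℕ) →
  ∑ xs f ≡ ∑ (filter P? xs) f + ∑ (filter (λ x → ¬? (P? x)) xs) f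
∑-partition P? xs f = sym (begin
  ∑ (filter P? xs) f + ∑ (filter (λ x → ¬? (P? x)) xs) f
    ≡⟨ cong₂ _+_ (∑-filter P? xs f) (∑-filter (λ x → ¬? (P? x)) xs f) ⟩
  (∑[ x ∈ xs ] (⟨ P? x ⟩ * f x)) + (∑[ x ∈ xs ] (⟨ ¬? (P? x) ⟩ * f x))
    ≡⟨ sym (∑-+ xs _ _) ⟩
  ∑[ x ∈ xs ] (⟨ P? x ⟩ * f x + ⟨ ¬? (P? x) ⟩ * f x)
    ≡⟨ ∑-cong xs (λ {x} _ → trans (sym (*-distribʳ-+ (f x) ⟨ P? x ⟩ _)) (trans (cong (_* f x) (⟨⟩-¬ (P? x))) (*-identityˡ (f x)))) ⟩
  ∑ xs f ∎)
  where open ≡-Reasoning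

∑-none : (xs : List A) {f : A → ℕ} → (∀ {x} → x ∈ xs → f x ≡ 0) → ∑ xs f ≡ 0
∑-none xs z = trans (∑-cong xs z) (trans (∑-const xs 0) (*-zeroʳ (length xs)))

at-most-one : {P : A → Set} (P? : ∀ x → Dec (P x)) {xs : List A} → Unique xs →
  (∀ {x y} → x ∈ xs → y ∈ xs → P x → P y → x ≡ y) → ∑[ x ∈ xs ] ⟨ P? x ⟩ ≤ 1
at-most-one P? [] same = z≤n
at-most-one P? {x ∷ xs} (x∉ ∷ u) same with P? x
... | no _ = at-most-one P? u (λ p q → same (there p) (there q))
... | yes px = ≤-reflexive (cong suc (∑-none xs λ {y} y∈ →
      ⟨⟩-no (P? y) (λ py → All.lookup x∉ y∈ (same (here refl) (there y∈) px py))))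

count-others : (_≟_ : DecidableEquality A) {xs : List A} → Unique xs → ∀ {x} → x ∈ xs →
  suc (∑[ y ∈ xs ] ⟨ ¬? (x ≟ y) ⟩) ≡ length xs
count-others _≟_ {xs} u {x} x∈ = begin
  suc (∑[ y ∈ xs ] ⟨ ¬? (x ≟ y) ⟩)
    ≡⟨ cong (_+ (∑[ y ∈ xs ] ⟨ ¬? (x ≟ y) ⟩)) (sym self) ⟩
  (∑[ y ∈ xs ] ⟨ x ≟ y ⟩) + (∑[ y ∈ xs ] ⟨ ¬? (x ≟ y) ⟩)
    ≡⟨ sym (∑-+ xs _ _) ⟩
  ∑[ y ∈ xs ] (⟨ x ≟ y ⟩ + ⟨ ¬? (x ≟ y) ⟩)
    ≡⟨ ∑-cong xs (λ {y} _ → ⟨⟩-¬ (x ≟ y)) ⟩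
  ∑[ _ ∈ xs ] 1
    ≡⟨ sym (length-∑ xs) ⟩
  length xs ∎
  where
  open ≡-Reasoning
  self : ∑[ y ∈ xs ] ⟨ x ≟ y ⟩ ≡ 1
  self = ≤-antisym (at-most-one (x ≟_) u (λ _ _ p q → trans (sym p) q))
    (≤-trans (≤-reflexive (sym (trans (+-identityʳ _) (⟨⟩-yes (x ≟ x) refl))))
      (∑-⊆ {xs = [ x ]} (λ y → ⟨ x ≟ y ⟩) ([] ∷ []) λ { (here refl) → x∈ }))

-- Numerical relations between n, the number of transpositions and the edge number

2*nC2 : ∀ n → 2 * (suc n choose 2) ≡ suc n * n
2*nC2 zero = refl
2*nC2 (suc n) = begin
  2 * (suc (suc n) choose 2)             ≡⟨ cong (2 *_) (sym (nCk+nC[k+1]≡[n+1]C[k+1] (suc n) 1)) ⟩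
  2 * (suc n choose 1 + suc n choose 2)       ≡⟨ *-distribˡ-+ 2 (suc n choose 1) (suc n choose 2) ⟩
  2 * (suc n choose 1) + 2 * (suc n choose 2) ≡⟨ cong₂ _+_ (cong (2 *_) (nC1≡n (suc n))) (2*nC2 n) ⟩
  2 * suc n + suc n * n             ≡⟨ lemma n ⟩
  suc (suc n) * suc n               ∎
  where
  open ≡-Reasoning
  lemma : ∀ n → 2 * suc n + suc n * n ≡ suc (suc n) * suc n
  lemma = solve-∀

n²≤4nC2 : ∀ n → 2 ≤ n → n * n ≤ 4 * (n choose 2)
n²≤4nC2 (suc zero) (s≤s ())
n²≤4nC2 (suc (suc n)) _ = ≤-trans (m≤m+n _ (n * n + 2 * n)) (≤-reflexive (trans (lemma n) (trans (cong (2 *_) (sym (2*nC2 (suc n)))) (sym (*-assoc 2 2 (suc (suc n) choose 2))))))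
  where
  lemma : ∀ n → suc (suc n) * suc (suc n) + (n * n + 2 * n) ≡ 2 * (suc (suc n) * suc n)
  lemma = solve-∀

nC2<n² : ∀ n → 1 ≤ n → n choose 2 < n * n
nC2<n² (suc n) _ = *-cancelˡ-< 2 _ _ (≤-trans (s≤s (≤-reflexive (2*nC2 n))) (≤-trans (m≤m+n _ (n * n + 3 * n + 1)) (≤-reflexive (lemma n))))
  where
  lemma : ∀ n → suc (suc n * n) + (n * n + 3 * n + 1) ≡ 2 * (suc n * suc n)
  lemma = solve-∀

2*eCT : ∀ n → 2 ≤ n → 2 * eCT n ≡ n ! * (n choose 2)
2*eCT n le = trans (*-comm 2 (eCT n)) (m/n*n≡m (∣-trans (m≤n⇒m!∣n! le) (m∣m*n (n choose 2))))

module Counts {n : ℕ} (F : SubgraphCT n) where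

  ts : List (Transposition n)
  ts = transpositions n

  ps : List (Vertex n)
  ps = perms n

  N P S : ℕ
  N = length ts
  P = length ps
  S = degreeSum F

  ps-perm : ∀ {x} → x ∈ ps → IsPerm x
  ps-perm = injections-sound n n

  ts! : Unique ts
  ts! = transpositions-unique n

  ordered : ∀ {u} → u ∈ ts → Ordered u
  ordered = transpositions-ordered n

  PN≡2e : 2 ≤ n → P * N ≡ 2 * eCT n
  PN≡2e le = trans (cong₂ _*_ (perms-count n) (transpositions-count n)) (sym (2*eCT n le))

  n²≤4*N : 2 ≤ n → n * n ≤ 4 * N
  n²≤4*N le = ≤-trans (n²≤4nC2 n le) (≤-reflexive (cong (4 *_) (sym (transpositions-count n))))

  degree≤N : ∀ x → degree F x ≤ N
  degree≤N x = ≤-trans (∑-≤-const ts 1 (λ {u} _ → ⟨⟩-≤1 (edgeIn? F x (act u x)))) (≤-reflexive (*-identityʳ N))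

  S≤PN : S ≤ P * N
  S≤PN = ∑-≤-const ps N (λ {x} _ → degree≤N x)

  edges≤eCT : 2 ≤ n → numEdges F ≤ eCT n
  edges≤eCT le = *-cancelˡ-≤ 2 (≤-trans (handshake F) (≤-trans S≤PN (≤-reflexive (PN≡2e le))))

module FourCycles {n : ℕ} (F : SubgraphCT n) (free : CycleFree 4 F) where

  open Counts F

  private
    e : Vertex n → Vertex n → ℕ
    e x y = ⟨ edgeIn? F x y ⟩

    e-sym : ∀ x y → e x y ≡ e y x
    e-sym x y = ⟨⟩-cong (edgeIn? F x y) (edgeIn? F y x) (EdgeIn-sym F) (EdgeIn-sym F)

    ne : Transposition n → Transposition n → ℕ
    ne u v = ⟨ ¬? (u ≟ᵗ v) ⟩

    ne-sym : ∀ u v → ne u v ≡ ne v u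
    ne-sym u v = ⟨⟩-cong (¬? (u ≟ᵗ v)) (¬? (v ≟ᵗ u)) ≢-sym ≢-sym

  four-free : ∀ {x u v} → IsPerm x → Ordered u → Ordered v → u ≢ v →
    EdgeIn F x (act u x) → EdgeIn F (act u x) (act v (act u x)) → EdgeIn F (act v (act u x)) (act v x) →
    EdgeIn F (act v x) x → ⊥
  four-free {x} {u} {v} perm ou ov u≢v e₁ e₂ e₃ e₄ = free (closed-walk⇒cycle F (e₁ ∷ e₂ ∷ e₃ ∷ e₄ ∷ [])
    ((≢-sym (zero-one ou) ∷ ≢-sym (zero-two ov ou (≢-sym u≢v)) ∷ ≢-sym (zero-one ov) ∷ []) ∷
     (≢-sym (one-two ov ou ou (≢-sym u≢v)) ∷ (λ eq → u≢v (one-one ou ov eq)) ∷ []) ∷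
     (one-two ov ou ov (≢-sym u≢v) ∷ []) ∷ [] ∷ []) refl)
    where open Free {x = x} perm

  private
    four : ∀ {X Y Z W : Set} (a : Dec X) (b : Dec Y) (c : Dec Z) (d : Dec W) →
           (X → Y → Z → W → ⊥) → ⟨ a ⟩ + ⟨ b ⟩ + ⟨ c ⟩ + ⟨ d ⟩ ≤ 3
    four (yes x) (yes y) (yes z) (yes w) k = ⊥-elim (k x y z w)
    four (no _) b c d k = +-mono-≤ (+-mono-≤ (⟨⟩-≤1 b) (⟨⟩-≤1 c)) (⟨⟩-≤1 d)
    four (yes _) (no _) c d k = s≤s (+-mono-≤ (⟨⟩-≤1 c) (⟨⟩-≤1 d))
    four (yes _) (yes _) (no _) d k = s≤s (s≤s (⟨⟩-≤1 d))
    four (yes _) (yes _) (yes _) (no _) k = ≤-refl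

    weigh : ∀ {X : Set} (x : Dec X) a b c d → (X → a + b + c + d ≤ 3) →
            ⟨ x ⟩ * a + ⟨ x ⟩ * b + ⟨ x ⟩ * c + ⟨ x ⟩ * d ≤ ⟨ x ⟩ * 3
    weigh (no _) a b c d k = z≤n
    weigh (yes x) a b c d k = ≤-trans (≤-reflexive (lemma a b c d)) (k x)
      where
      lemma : ∀ a b c d → a + 0 + (b + 0) + (c + 0) + (d + 0) ≡ a + b + c + d
      lemma = solve-∀

    -- The four sides of the square x, ux, vux, vx. Here `u` and `v` need only be distinct, so every
    -- ordered pair of distinct transpositions contributes, and all four totals agree.
    t₁ t₂ t₃ t₄ : Vertex n → Transposition n → Transposition n → ℕ
    t₁ x u v = ne u v * e x (act u x)
    t₂ x u v = ne u v * e (act u x) (act v (act u x))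
    t₃ x u v = ne u v * e (act v (act u x)) (act v x)
    t₄ x u v = ne u v * e (act v x) x

    total : (Vertex n → Transposition n → Transposition n → ℕ) → ℕ
    total t = ∑[ u ∈ ts ] ∑[ v ∈ ts ] ∑[ x ∈ ps ] t x u v

    total-cong : ∀ {t t′} → (∀ {x u v} → x ∈ ps → u ∈ ts → v ∈ ts → t x u v ≡ t′ x u v) → total t ≡ total t′
    total-cong eq = ∑-cong ts (λ u∈ → ∑-cong ts (λ v∈ → ∑-cong ps (λ x∈ → eq x∈ u∈ v∈)))

    total-+ : ∀ t t′ → total (λ x u v → t x u v + t′ x u v) ≡ total t + total t′
    total-+ t t′ = trans (∑-cong ts (λ _ → trans (∑-cong ts (λ _ → ∑-+ ps _ _)) (∑-+ ts _ _))) (∑-+ ts _ _)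

    total-flip : ∀ t → total t ≡ total (λ x u v → t x v u)
    total-flip t = ∑-swap ts ts _

    total₂ : total t₂ ≡ total t₁
    total₂ = trans (∑-cong ts (λ {u} _ → ∑-cong ts (λ {v} _ → ∑-act F u (λ x → ne u v * e x (act v x)))))
      (trans (total-flip (λ x u v → ne u v * e x (act v x))) (total-cong (λ {x} {u} {v} _ _ _ → cong (_* e x (act u x)) (ne-sym v u))))

    total₄ : total t₄ ≡ total t₁
    total₄ = trans (total-flip t₄)
      (total-cong (λ {x} {u} {v} _ _ _ → cong₂ _*_ (ne-sym v u) (e-sym (act u x) x)))

    -- Replacing x by vx turns this side into the edge from `x` labelled `conj v u`; conjugation by
    -- `v` is an involution that preserves being different from `v`.
    total₃ : total t₃ ≡ total t₁
    total₃ = begin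
      total t₃
        ≡⟨ ∑-cong ts (λ {u} _ → ∑-cong ts (λ {v} _ → sym (∑-act F v (λ x → t₃ x u v)))) ⟩
      total (λ x u v → t₃ (act v x) u v)
        ≡⟨ total-cong (λ {x} {u} {v} _ u∈ v∈ → cong₂ _*_ (conj-ne (ordered u∈) (ordered v∈)) (conj-e x u v)) ⟩
      total (λ x u v → t₁ x (conj v u) v)
        ≡⟨ total-flip (λ x u v → t₁ x (conj v u) v) ⟩
      ∑[ v ∈ ts ] ∑[ u ∈ ts ] ∑[ x ∈ ps ] t₁ x (conj v u) v
        ≡⟨ ∑-cong ts (λ {v} _ → ∑-involution (conj v) ts!
             (λ u∈ → transpositions-complete n (conj-ordered v (ordered u∈)))
             (λ u∈ → conj-involutive v (ordered u∈)) (λ u → ∑[ x ∈ ps ] t₁ x u v)) ⟩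
      ∑[ v ∈ ts ] ∑[ u ∈ ts ] ∑[ x ∈ ps ] t₁ x u v
        ≡⟨ sym (total-flip t₁) ⟩
      total t₁ ∎
      where
      open ≡-Reasoning
      conj-ne : ∀ {u v} → Ordered u → Ordered v → ne u v ≡ ne (conj v u) v
      conj-ne {u} {v} ou ov = ⟨⟩-cong (¬? (u ≟ᵗ v)) (¬? (conj v u ≟ᵗ v))
        (λ u≢v eq → u≢v (trans (sym (conj-involutive v ou)) (trans (cong (conj v) eq) (conj-self ov))))
        (λ c≢v eq → c≢v (trans (cong (conj v) eq) (conj-self ov)))
      conj-e : ∀ x u v → e (act v (act u (act v x))) (act v (act v x)) ≡ e x (act (conj v u) x)
      conj-e x u v = trans (cong₂ e (sym (act-conj v u x)) (act-involutive v x)) (e-sym (act (conj v u) x) x)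

    others : ∀ {u} → u ∈ ts → ∑[ v ∈ ts ] ne u v ≡ N ∸ 1
    others u∈ = cong (_∸ 1) (count-others _≟ᵗ_ ts! u∈)

    total₁ : total t₁ ≡ (N ∸ 1) * S
    total₁ = begin
      total t₁
        ≡⟨ ∑-cong ts (λ {u} u∈ → trans (∑-product ts ps (ne u) (λ x → e x (act u x))) (cong (_* (∑[ x ∈ ps ] e x (act u x))) (others u∈))) ⟩
      ∑[ u ∈ ts ] ((N ∸ 1) * (∑[ x ∈ ps ] e x (act u x)))
        ≡⟨ trans (∑-*ˡ ts (N ∸ 1) _) (cong ((N ∸ 1) *_) (∑-swap ts ps _)) ⟩
      (N ∸ 1) * S ∎
      where open ≡-Reasoning

  four-bound : 2 ≤ N → 4 * S ≤ 3 * (P * N)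
  four-bound 2≤N = *-cancelˡ-≤ (N ∸ 1) (begin
    (N ∸ 1) * (4 * S)                                     ≡⟨ lemma (N ∸ 1) S ⟩
    K + K + K + K                                         ≡⟨ cong₂ _+_ (cong₂ _+_ (cong₂ _+_ (sym total₁) (sym (trans total₂ total₁))) (sym (trans total₃ total₁))) (sym (trans total₄ total₁)) ⟩
    total t₁ + total t₂ + total t₃ + total t₄              ≡⟨ cong (_+ total t₄) (cong (_+ total t₃) (sym (total-+ t₁ t₂))) ⟩
    total _ + total t₃ + total t₄                          ≡⟨ cong (_+ total t₄) (sym (total-+ _ t₃)) ⟩
    total _ + total t₄                                     ≡⟨ sym (total-+ _ t₄) ⟩
    total (λ x u v → t₁ x u v + t₂ x u v + t₃ x u v + t₄ x u v)
      ≤⟨ ∑-mono ts (λ u∈ → ∑-mono ts (λ v∈ → ∑-mono ps (λ x∈ → local x∈ u∈ v∈))) ⟩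
    total (λ x u v → ne u v * 3)
      ≡⟨ ∑-cong ts (λ {u} u∈ → trans (∑-product ts ps (ne u) (λ _ → 3)) (cong₂ _*_ (others u∈) (∑-const ps 3))) ⟩
    ∑[ _ ∈ ts ] ((N ∸ 1) * (P * 3))                        ≡⟨ ∑-const ts _ ⟩
    N * ((N ∸ 1) * (P * 3))                                ≡⟨ lemma₂ N (N ∸ 1) P ⟩
    (N ∸ 1) * (3 * (P * N))                                ∎)
    where
    open ≤-Reasoning
    instance
      N-1≢0 : NonZero (N ∸ 1)
      N-1≢0 = >-nonZero (∸-monoˡ-≤ 1 2≤N)
    K = (N ∸ 1) * S
    lemma : ∀ m s → m * (4 * s) ≡ m * s + m * s + m * s + m * s
    lemma = solve-∀
    lemma₂ : ∀ a b c → a * (b * (c * 3)) ≡ b * (3 * (c * a))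
    lemma₂ = solve-∀
    local : ∀ {x u v} → x ∈ ps → u ∈ ts → v ∈ ts → t₁ x u v + t₂ x u v + t₃ x u v + t₄ x u v ≤ ne u v * 3
    local {x} {u} {v} x∈ u∈ v∈ = weigh (¬? (u ≟ᵗ v)) (e x (act u x)) (e (act u x) (act v (act u x))) (e (act v (act u x)) (act v x)) (e (act v x) x)
      λ u≢v → four (edgeIn? F x (act u x)) (edgeIn? F (act u x) (act v (act u x))) (edgeIn? F (act v (act u x)) (act v x)) (edgeIn? F (act v x) x)
        (four-free (ps-perm x∈) (ordered u∈) (ordered v∈) u≢v)

C₄-bound : ∀ n → 3 ≤ n → (F : SubgraphCT n) → CycleFree 4 F → 4 * numEdges F ≤ 3 * eCT n
C₄-bound n 3≤n F free = *-cancelˡ-≤ 2 (begin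
  2 * (4 * numEdges F)  ≡⟨ lemma (numEdges F) ⟩
  4 * (2 * numEdges F)  ≤⟨ *-monoʳ-≤ 4 (handshake F) ⟩
  4 * S                 ≤⟨ FourCycles.four-bound F free 2≤N ⟩
  3 * (P * N)           ≡⟨ cong (3 *_) (PN≡2e (<⇒≤ 3≤n)) ⟩
  3 * (2 * eCT n)       ≡⟨ lemma₂ (eCT n) ⟩
  2 * (3 * eCT n)       ∎)
  where
  open ≤-Reasoning
  open Counts F
  lemma : ∀ f → 2 * (4 * f) ≡ 4 * (2 * f)
  lemma = solve-∀
  lemma₂ : ∀ f → 3 * (2 * f) ≡ 2 * (3 * f)
  lemma₂ = solve-∀
  2≤N : 2 ≤ N
  2≤N = *-cancelˡ-≤ 4 (begin
    8             ≤⟨ n≤1+n 8 ⟩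
    3 * 3         ≤⟨ *-mono-≤ 3≤n 3≤n ⟩
    n * n         ≤⟨ n²≤4*N (<⇒≤ 3≤n) ⟩
    4 * N         ∎)

-- Six-cycles

module SixCycles {n : ℕ} (F : SubgraphCT n) (free : CycleFree 6 F) where

  open Counts F
  open Link F

  module _ {x : Vertex n} (perm : IsPerm x) where

    open Free {x = x} perm
    open Expand {x} perm

    private
      edge? : ∀ u → Dec (EdgeIn F x (act u x))
      edge? u = edgeIn? F x (act u x)

      as bs : List (Transposition n)
      as = filter edge? ts
      bs = filter (λ u → ¬? (edge? u)) ts

      -- otherwise x, ux, uvx, vx, wvx, wx is a hexagon
      neighbours-apart : ∀ {u v w} → u ∈ as → v ∈ ts → w ∈ as → Linked x u v → Linked x w v → u ≡ w
      neighbours-apart {u} {v} {w} u∈ v∈ w∈ r r′ = decidable-stable (u ≟ᵗ w) λ u≢w →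
        let u∈ts , eu = ∈-filter⁻ edge? {xs = ts} u∈
            w∈ts , ew = ∈-filter⁻ edge? {xs = ts} w∈
            path : Walk (Linked x) u (u ∷ v ∷ []) w
            path = r ∷ linked-sym x r′ ∷ []
            os : All Ordered (w ∷ u ∷ v ∷ [])
            os = ordered w∈ts ∷ ordered u∈ts ∷ ordered v∈ ∷ []
            distinct : Unique (w ∷ u ∷ v ∷ [])
            distinct = (≢-sym u≢w ∷ ∥-irrefl {u = w} {v} (proj₁ r′) ∷ []) ∷ (∥-irrefl {u = u} {v} (proj₁ r) ∷ []) ∷ [] ∷ []
            x∉ : x ∉ expand path
            x∉ z∈ = case-shape os (shape path z∈)
            w∉ : act w x ∉ expand path
            w∉ = one∉ path os (ordered w∈ts) λ p → All.lookup (AllPairs.head distinct) p refl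
        in free (closed-walk⇒cycle F (eu ∷ (expand-walk path ++ʷ (EdgeIn-sym F ew ∷ [])))
             (All-++⁺ (∉⇒All≢ x∉) (≢-sym (zero-one (ordered w∈ts)) ∷ []) ∷
              Unique-++ (expand-unique path os distinct) ([] ∷ []) λ { z∈ (here refl) → w∉ z∈ }) refl)
        where
        case-shape : ∀ {ws u} → All Ordered (u ∷ ws) → Shape ws u x → ⊥
        case-shape (ou ∷ os) (one s∈ e) = zero-one (All.lookup os s∈) (sym e)
        case-shape (ou ∷ os) (two {s} {t} s∈ t∈ p e) =
          zero-two (All.lookup os s∈) (All.lookup (ou ∷ os) t∈) (∥-irrefl {u = s} {t} p) (sym e)

      few : ∀ {v} → v ∈ ts → ∑[ u ∈ as ] ⟨ linked? x u v ⟩ ≤ 1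
      few {v} v∈ = at-most-one (λ u → linked? x u v) (Unique-filter⁺ edge? ts!)
        (λ u∈ w∈ r r′ → neighbours-apart u∈ v∈ w∈ r r′)

      b : ℕ
      b = length bs

      b+d : b + degree F x ≡ N
      b+d = trans (+-comm b _) (trans (cong₂ _+_ (sym (length-filter-∑ edge? ts)) refl)
        (trans (cong₂ _+_ (length-∑ as) (length-∑ bs)) (trans (sym (∑-partition edge? ts (λ _ → 1))) (sym (length-∑ ts)))))

      triangle-free : ∀ {u v w} → u ∈ bs → v ∈ bs → w ∈ bs →
        T (does (linked? x u v)) → T (does (linked? x v w)) → T (does (linked? x u w)) → ⊥
      triangle-free {u} {v} {w} u∈ v∈ w∈ p q r = free (link-cycle 3 ≤-refl
        (u , u ∷ v ∷ w ∷ [] , uv ∷ vw ∷ linked-sym x uw ∷ [] ,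
         ((∥-irrefl {u = u} {v} (proj₁ uv) ∷ ∥-irrefl {u = u} {w} (proj₁ uw) ∷ []) ∷ (∥-irrefl {u = v} {w} (proj₁ vw) ∷ []) ∷ [] ∷ []) ,
         refl , inside u∈ ∷ inside v∈ ∷ inside w∈ ∷ []))
        where
        uv : Linked x u v
        uv = T-does⁻ (linked? x u v) p
        vw : Linked x v w
        vw = T-does⁻ (linked? x v w) q
        uw : Linked x u w
        uw = T-does⁻ (linked? x u w) r
        inside : ∀ {u} → u ∈ bs → u ∈ ts
        inside p = proj₁ (∈-filter⁻ (λ u → ¬? (edge? u)) {xs = ts} p)

      link-sum : List (Transposition n) → List (Transposition n) → ℕ
      link-sum us vs = ∑[ u ∈ us ] ∑[ v ∈ vs ] ⟨ linked? x u v ⟩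

      link-flip : ∀ us vs → link-sum us vs ≡ link-sum vs us
      link-flip us vs = trans (∑-swap us vs _) (∑-cong vs (λ {v} _ → ∑-cong us (λ {u} _ →
        ⟨⟩-cong (linked? x u v) (linked? x v u) (linked-sym x) (linked-sym x))))

      touching-as : link-sum ts as ≤ N
      touching-as = ≤-trans (≤-reflexive (∑-cong ts (λ {v} _ → ∑-cong as (λ {u} _ →
          ⟨⟩-cong (linked? x v u) (linked? x u v) (linked-sym x) (linked-sym x)))))
        (≤-trans (∑-≤-const ts 1 few) (≤-reflexive (*-identityʳ N)))

      inside-bs : 2 * link-sum bs bs ≤ b * b
      inside-bs = Mantel.mantel (λ u v → does (linked? x u v))
        (λ u v → does-cong (linked? x u v) (linked? x v u) (linked-sym x) (linked-sym x)) bs triangle-free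

      link-split : link-sum ts ts ≤ 2 * N + link-sum bs bs
      link-split = begin
        link-sum ts ts
          ≡⟨ trans (∑-cong ts (λ _ → ∑-partition edge? ts _)) (∑-+ ts _ _) ⟩
        link-sum ts as + link-sum ts bs
          ≡⟨ cong (link-sum ts as +_) (trans (link-flip ts bs) (trans (∑-cong bs (λ _ → ∑-partition edge? ts _)) (∑-+ bs _ _))) ⟩
        link-sum ts as + (link-sum bs as + link-sum bs bs)
          ≤⟨ +-mono-≤ touching-as (+-monoˡ-≤ _ (≤-trans (∑-⊆ _ (Unique-filter⁺ (λ u → ¬? (edge? u)) ts!) (λ p → proj₁ (∈-filter⁻ (λ u → ¬? (edge? u)) {xs = ts} p))) touching-as)) ⟩
        N + (N + link-sum bs bs)
          ≡⟨ lemma N _ ⟩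
        2 * N + link-sum bs bs ∎
        where
        open ≤-Reasoning
        lemma : ∀ a b → a + (a + b) ≡ 2 * a + b
        lemma = solve-∀

    -- The pairs that involve an edge at `x` contribute at most `2 * N`, the others at most (N -
    -- d)²/2. Adding `2 * N * d` on both sides avoids the subtraction, as (N - d)² + 2Nd = N² + d².
    local-bound : 2 * (∑[ u ∈ ts ] ∑[ v ∈ ts ] ⟨ linked? x u v ⟩) + 2 * N * degree F x
                  ≤ (4 * N + N * N) + degree F x * degree F x
    local-bound = begin
      2 * link-sum ts ts + 2 * N * d                       ≤⟨ +-monoˡ-≤ _ (*-monoʳ-≤ 2 link-split) ⟩
      2 * (2 * N + link-sum bs bs) + 2 * N * d             ≡⟨ lemma₁ N (link-sum bs bs) d ⟩
      4 * N + (2 * link-sum bs bs + 2 * N * d)             ≤⟨ +-monoʳ-≤ (4 * N) (+-monoˡ-≤ _ inside-bs) ⟩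
      4 * N + (b * b + 2 * N * d)                          ≡⟨ cong (λ m → 4 * N + (b * b + 2 * m * d)) (sym b+d) ⟩
      4 * N + (b * b + 2 * (b + d) * d)                    ≡⟨ lemma₂ (4 * N) b d ⟩
      4 * N + (b + d) * (b + d) + d * d                    ≡⟨ cong (λ m → 4 * N + m * m + d * d) b+d ⟩
      4 * N + N * N + d * d                                ∎
      where
      open ≤-Reasoning
      d = degree F x
      lemma₁ : ∀ m l d → 2 * (2 * m + l) + 2 * m * d ≡ 4 * m + (2 * l + 2 * m * d)
      lemma₁ = solve-∀
      lemma₂ : ∀ c b d → c + (b * b + 2 * (b + d) * d) ≡ c + (b + d) * (b + d) + d * d
      lemma₂ = solve-∀

  private
    Q : ℕ
    Q = ∑[ x ∈ ps ] (degree F x * degree F x)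

  global-bound : 2 * linkSum + 2 * N * S ≤ P * (4 * N + N * N) + Q
  global-bound = begin
    2 * linkSum + 2 * N * S
      ≡⟨ cong₂ _+_ (sym (∑-*ˡ ps 2 _)) (sym (∑-*ˡ ps (2 * N) (degree F))) ⟩
    (∑[ x ∈ ps ] (2 * (∑[ u ∈ ts ] ∑[ v ∈ ts ] ⟨ linked? x u v ⟩))) + (∑[ x ∈ ps ] (2 * N * degree F x))
      ≡⟨ sym (∑-+ ps _ _) ⟩
    ∑[ x ∈ ps ] (2 * (∑[ u ∈ ts ] ∑[ v ∈ ts ] ⟨ linked? x u v ⟩) + 2 * N * degree F x)
      ≤⟨ ∑-mono ps (λ x∈ → local-bound (ps-perm x∈)) ⟩
    ∑[ x ∈ ps ] ((4 * N + N * N) + degree F x * degree F x)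
      ≡⟨ trans (∑-+ ps _ _) (cong (_+ Q) (∑-const ps _)) ⟩
    P * (4 * N + N * N) + Q ∎
    where open ≤-Reasoning

  -- `cherry-count` is used twice to match the factor of `linkSum` in `global-bound`; one copy of
  -- `Q` then cancels.
  squares-bound : Q + 2 * N * S ≤ P * (N * N + (4 + 8 * n) * N)
  squares-bound = +-cancelˡ-≤ Q _ _ (begin
    Q + (Q + 2 * N * S)                                    ≤⟨ +-mono-≤ cherry-count (+-monoˡ-≤ _ cherry-count) ⟩
    linkSum + 4 * n * S + (linkSum + 4 * n * S + 2 * N * S) ≡⟨ lemma₁ linkSum n S N ⟩
    (2 * linkSum + 2 * N * S) + 8 * n * S                  ≤⟨ +-mono-≤ global-bound (*-monoʳ-≤ (8 * n) S≤PN) ⟩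
    P * (4 * N + N * N) + Q + 8 * n * (P * N)              ≡⟨ lemma₂ P N Q n ⟩
    Q + P * (N * N + (4 + 8 * n) * N)                      ∎)
    where
    open ≤-Reasoning
    lemma₁ : ∀ l n s m → l + 4 * n * s + (l + 4 * n * s + 2 * m * s) ≡ (2 * l + 2 * m * s) + 8 * n * s
    lemma₁ = solve-∀
    lemma₂ : ∀ p m q n → p * (4 * m + m * m) + q + 8 * n * (p * m) ≡ q + p * (m * m + (4 + 8 * n) * m)
    lemma₂ = solve-∀

  -- Completes the square: divided by (PN)² it reads (δ + 1)² ≤ 2 + O(n/N) for the density δ =
  -- S/(PN).
  quadratic-bound : (S + P * N) * (S + P * N) ≤ 2 * ((P * N) * (P * N)) + (4 + 8 * n) * (P * (P * N))
  quadratic-bound = begin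
    (S + P * N) * (S + P * N)                              ≡⟨ lemma₁ S P N ⟩
    S * S + (P * (2 * N * S) + P * N * (P * N))            ≤⟨ +-monoˡ-≤ _ (cauchy-schwarz ps (degree F)) ⟩
    P * Q + (P * (2 * N * S) + P * N * (P * N))            ≡⟨ lemma₂ P Q (2 * N * S) (P * N * (P * N)) ⟩
    P * (Q + 2 * N * S) + P * N * (P * N)                  ≤⟨ +-monoˡ-≤ _ (*-monoʳ-≤ P squares-bound) ⟩
    P * (P * (N * N + (4 + 8 * n) * N)) + P * N * (P * N)  ≡⟨ lemma₃ P N (4 + 8 * n) ⟩
    2 * ((P * N) * (P * N)) + (4 + 8 * n) * (P * (P * N))  ∎
    where
    open ≤-Reasoning
    lemma₁ : ∀ s p m → (s + p * m) * (s + p * m) ≡ s * s + (p * (2 * m * s) + p * m * (p * m))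
    lemma₁ = solve-∀
    lemma₂ : ∀ p q t r → p * q + (p * t + r) ≡ p * (q + t) + r
    lemma₂ = solve-∀
    lemma₃ : ∀ p m c → p * (p * (m * m + c * m)) + p * m * (p * m) ≡ 2 * ((p * m) * (p * m)) + c * (p * (p * m))
    lemma₃ = solve-∀

-- The term `e * e` pays for the subtraction, because (X - e)² + e² ≤ X² for e ≤ X.
square-shift : ∀ X e r → e ≤ X → X * X ≤ 2 * (r * e) ^ 2 + e * e → (X ∸ e) ^ 2 ≤ 2 * (r * e) ^ 2
square-shift X e r e≤X le with m≤n⇒∃[o]m+o≡n e≤X
... | Y , refl rewrite m+n∸m≡n e Y = +-cancelʳ-≤ (e * e) _ _
  (≤-trans (m≤m+n _ (2 * (Y * e))) (≤-trans (≤-reflexive (lemma Y e)) le))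
  where
  lemma : ∀ y e → y * (y * 1) + e * e + 2 * (y * e) ≡ (e + y) * (e + y)
  lemma = solve-∀

-- With r = m + 1 this bounds the density by √2 - 1 + 1/r, squared to stay within ℕ. The error is
-- absorbed once r²(4 + 8n) ≤ N; as 4 + 8n ≤ 12n and 2N = n(n - 1), it suffices that n exceeds 24r².
C₆-bound : ∀ m → Σ ℕ λ N₀ → ∀ n → 3 ≤ n → N₀ ≤ n → (F : SubgraphCT n) → CycleFree 6 F →
  ((suc m * (numEdges F + eCT n)) ∸ eCT n) ^ 2 ≤ 2 * (suc m * eCT n) ^ 2
C₆-bound m = suc (24 * (r * r)) , λ n 3≤n large F free → proof n 3≤n large F free
  where
  r : ℕ
  r = suc m
  proof : ∀ n → 3 ≤ n → suc (24 * (r * r)) ≤ n → (F : SubgraphCT n) → CycleFree 6 F →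
          ((r * (numEdges F + eCT n)) ∸ eCT n) ^ 2 ≤ 2 * (r * eCT n) ^ 2
  proof n@(suc n′) 3≤n (s≤s large) F free = square-shift (r * (φ + e)) e r
    (≤-trans (m≤n+m e φ) (m≤m+n (φ + e) (m * (φ + e)))) (*-cancelˡ-≤ 4 (begin
      4 * (r * (φ + e) * (r * (φ + e)))                   ≡⟨ lemma₁ r φ e ⟩
      r * r * ((2 * φ + 2 * e) * (2 * φ + 2 * e))         ≡⟨ cong (λ z → r * r * ((2 * φ + z) * (2 * φ + z))) (sym PN) ⟩
      r * r * ((2 * φ + P * N) * (2 * φ + P * N))         ≤⟨ *-monoʳ-≤ (r * r) (*-mono-≤ hs hs) ⟩
      r * r * ((S + P * N) * (S + P * N))                 ≤⟨ *-monoʳ-≤ (r * r) (SixCycles.quadratic-bound F free) ⟩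
      r * r * (2 * ((P * N) * (P * N)) + (4 + 8 * n) * (P * (P * N)))
        ≡⟨ lemma₂ (r * r) (P * N) P (4 + 8 * n) ⟩
      2 * (r * r * ((P * N) * (P * N))) + r * r * (4 + 8 * n) * (P * (P * N))
        ≤⟨ +-monoʳ-≤ _ (*-monoˡ-≤ (P * (P * N)) threshold) ⟩
      2 * (r * r * ((P * N) * (P * N))) + N * (P * (P * N))
        ≡⟨ lemma₃ (r * r) P N ⟩
      (2 * (r * r) + 1) * ((P * N) * (P * N))
        ≡⟨ cong (λ z → (2 * (r * r) + 1) * (z * z)) PN ⟩
      (2 * (r * r) + 1) * ((2 * e) * (2 * e))
        ≡⟨ lemma₄ r e ⟩
      4 * (2 * (r * e) ^ 2 + e * e)                       ∎))
    where
    open ≤-Reasoning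
    open Counts F
    φ e : ℕ
    φ = numEdges F
    e = eCT n
    PN : P * N ≡ 2 * e
    PN = PN≡2e (<⇒≤ 3≤n)
    hs : 2 * φ + P * N ≤ S + P * N
    hs = +-monoˡ-≤ _ (handshake F)
    threshold : r * r * (4 + 8 * n) ≤ N
    threshold = *-cancelˡ-≤ 2 (begin
      2 * (r * r * (4 + 8 * n))       ≤⟨ *-monoʳ-≤ 2 (*-monoʳ-≤ (r * r) (+-monoˡ-≤ (8 * n) (*-monoʳ-≤ 4 (s≤s (z≤n {n′}))))) ⟩
      2 * (r * r * (4 * n + 8 * n))   ≡⟨ lemma (r * r) n ⟩
      n * (24 * (r * r))              ≤⟨ *-monoʳ-≤ n large ⟩
      n * n′                          ≡⟨ sym (2*nC2 n′) ⟩
      2 * (n choose 2)                     ≡⟨ cong (2 *_) (sym (transpositions-count n)) ⟩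
      2 * N                           ∎)
      where
      lemma : ∀ s n → 2 * (s * (4 * n + 8 * n)) ≡ n * (24 * s)
      lemma = solve-∀
    lemma₁ : ∀ r f e → 4 * (r * (f + e) * (r * (f + e))) ≡ r * r * ((2 * f + 2 * e) * (2 * f + 2 * e))
    lemma₁ = solve-∀
    lemma₂ : ∀ s q p c → s * (2 * (q * q) + c * (p * q)) ≡ 2 * (s * (q * q)) + s * c * (p * q)
    lemma₂ = solve-∀
    lemma₃ : ∀ s p m → 2 * (s * ((p * m) * (p * m))) + m * (p * (p * m)) ≡ (2 * s + 1) * ((p * m) * (p * m))
    lemma₃ = solve-∀
    lemma₄ : ∀ r e → (2 * (r * r) + 1) * ((2 * e) * (2 * e)) ≡ 4 * (2 * ((r * e) * ((r * e) * 1)) + e * e)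
    lemma₄ = solve-∀

-- Cycles of length divisible by four

*-^ : ∀ x y k → (x * y) ^ k ≡ x ^ k * y ^ k
*-^ x y zero = refl
*-^ x y (suc k) = trans (cong (x * y *_) (*-^ x y k)) (lemma x y (x ^ k) (y ^ k))
  where
  lemma : ∀ x y a b → x * y * (a * b) ≡ x * a * (y * b)
  lemma = solve-∀

square-^ : ∀ x k → x ^ (k * 2) ≡ (x * x) ^ k
square-^ x zero = refl
square-^ x (suc k) = trans (cong (λ z → x * (x * z)) (square-^ x k)) (sym (*-assoc x x _))

-- Where the power passes `w`, the smaller base is positive because w ≥ 1, and consecutive positive
-- integers differ by a factor of at most 2.
root : ∀ k → 1 ≤ k → ∀ w → 1 ≤ w → ∃ λ q → w < q ^ k × q ^ k ≤ 2 ^ k * w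
root (suc j) _ w w≥1 with first-failure {Q = λ h → h ^ suc j ≤ w} (λ h → h ^ suc j ≤? w) z≤n (suc w)
    (λ le → 1+n≰n (≤-trans (≤-trans (≤-reflexive (sym (*-identityʳ (suc w)))) (*-monoʳ-≤ (suc w) (m^n>0 (suc w) j))) le))
... | zero , _ , _ , ¬le = ⊥-elim (¬le (≤-trans (≤-reflexive (^-zeroˡ (suc j))) w≥1))
... | suc p , _ , le , ¬le = suc (suc p) , ≰⇒> ¬le , (begin
  suc (suc p) ^ suc j              ≤⟨ ^-monoˡ-≤ (suc j) (≤-trans (+-monoˡ-≤ (suc p) (s≤s (z≤n {p}))) (≤-reflexive (cong (suc p +_) (sym (+-identityʳ (suc p)))))) ⟩
  (2 * suc p) ^ suc j              ≡⟨ *-^ 2 (suc p) (suc j) ⟩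
  2 ^ suc j * suc p ^ suc j        ≤⟨ *-monoʳ-≤ (2 ^ suc j) le ⟩
  2 ^ suc j * w                    ∎)
  where open ≤-Reasoning

base-positive : ∀ q k {w} → w < q ^ suc k → 1 ≤ q
base-positive zero k lt = ⊥-elim (n≮0 lt)
base-positive (suc q) k _ = s≤s z≤n

square-cancel-≤ : ∀ {x y} → x * x ≤ y * y → x ≤ y
square-cancel-≤ {x} {y} le = ≮⇒≥ λ y<x → <⇒≱ (*-mono-< y<x y<x) le

module Sparse {n : ℕ} (F : SubgraphCT n) where

  open Counts F
  open Link F

  -- weighted AM-GM in place of Cauchy–Schwarz: 2 θ d ≤ d² + θ²
  degreeSum-bound : ∀ θ → 1 ≤ θ → 4 * n ≤ θ → linkSum ≤ P * (θ * θ) → S ≤ 2 * (P * θ)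
  degreeSum-bound θ θ≥1 n≤θ sparse = *-cancelˡ-≤ θ (+-cancelˡ-≤ (θ * S) _ _ (begin
    θ * S + θ * S                                      ≡⟨ lemma₁ θ S ⟩
    2 * θ * S                                          ≡⟨ sym (∑-*ˡ ps (2 * θ) (degree F)) ⟩
    ∑[ x ∈ ps ] (2 * θ * degree F x)                   ≤⟨ ∑-mono ps (λ {x} _ → ≤-trans (≤-reflexive (*-assoc 2 θ _)) (2mn≤m²+n² θ (degree F x))) ⟩
    ∑[ x ∈ ps ] (θ * θ + degree F x * degree F x)      ≡⟨ trans (∑-+ ps _ _) (cong (_+ Q) (∑-const ps (θ * θ))) ⟩
    P * (θ * θ) + Q                                    ≤⟨ +-monoʳ-≤ (P * (θ * θ)) cherry-count ⟩
    P * (θ * θ) + (linkSum + 4 * n * S)                ≤⟨ +-monoʳ-≤ (P * (θ * θ)) (+-mono-≤ sparse (*-monoˡ-≤ S n≤θ)) ⟩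
    P * (θ * θ) + (P * (θ * θ) + θ * S)                ≡⟨ lemma₂ P θ S ⟩
    θ * S + θ * (2 * (P * θ))                          ∎))
    where
    open ≤-Reasoning
    instance
      θ≢0 = >-nonZero θ≥1
    Q = ∑[ x ∈ ps ] (degree F x * degree F x)
    lemma₁ : ∀ t s → t * s + t * s ≡ 2 * t * s
    lemma₁ = solve-∀
    lemma₂ : ∀ p t s → p * (t * t) + (p * (t * t) + t * s) ≡ t * s + t * (2 * (p * t))
    lemma₂ = solve-∀

  module _ (k q : ℕ) (k≥2 : 2 ≤ k) (q≥1 : 1 ≤ q) (large : N < q ^ k) (free : CycleFree (2 * (2 * k)) F) where

    link-sparse : ∀ {x} → x ∈ ps → ∑[ u ∈ ts ] ∑[ v ∈ ts ] ⟨ linked? x u v ⟩ ≤ 2 * ((2 * k + 5) * (q + 5)) * N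
    link-sparse {x} x∈ = EvenCycles.bondy-simonovits _≟ᵗ_ (λ u v → does (linked? x u v))
      (λ u v → does-cong (linked? x u v) (linked? x v u) (linked-sym x) (linked-sym x))
      (λ v t → linked-irrefl x (T-does⁻ (linked? x v v) t))
      ts ts! k q q≥1 large
      (λ (u , us , w , us! , size , ins) → free (Expand.link-cycle {x} (ps-perm x∈) (2 * k) (≤-trans (n≤1+n 3) (*-monoʳ-≤ 2 k≥2))
        (u , us , Walk-map (λ {u} {v} → T-does⁻ (linked? x u v)) w , us! , size , ins)))

    linkSum-sparse : linkSum ≤ P * (2 * ((2 * k + 5) * (q + 5)) * N)
    linkSum-sparse = ∑-≤-const ps _ link-sparse

-- For l = 2k take `q` near N^(1/k) and `θ` near √(cqN), so that the density is of order θ/N, that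
-- is n^(-1 + 2/l). The 12 in `c` covers q + 5 ≤ 6q and the factor 2 of `bondy-simonovits`; 128 is 4
-- · 8 from the two roots and (4N)^j, times 4 from (PN)² = 4e².
even-bound : ∀ l → 4 ≤ l → 2 ∣ l → Σ ℕ λ C → Σ ℕ λ N₀ → ∀ n → 3 ≤ n → N₀ ≤ n →
  (F : SubgraphCT n) → CycleFree (2 * l) F → PowBound (numEdges F) C n (l ∸ 2) l (eCT n)
even-bound l 4≤l (divides zero refl) = ⊥-elim (n≮0 4≤l)
even-bound l 4≤l (divides (suc j) refl) = 128 * c , 0 , λ n 3≤n _ F free → proof n 3≤n F free
  where
  k c : ℕ
  k = suc j
  c = 12 * (2 * k + 5)
  k≥2 : 2 ≤ k
  k≥2 = *-cancelʳ-≤ 2 k 2 4≤l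
  N≥1 : ∀ n → 3 ≤ n → (F : SubgraphCT n) → 1 ≤ Counts.N F
  N≥1 n 3≤n F = *-cancelˡ-≤ 4 (≤-trans (*-mono-≤ {2} {n} {2} (<⇒≤ 3≤n) (<⇒≤ 3≤n)) (Counts.n²≤4*N F (<⇒≤ 3≤n)))
  with-roots : ∀ n → 3 ≤ n → (F : SubgraphCT n) → CycleFree (2 * (k * 2)) F →
    ∀ q → Counts.N F < q ^ k → q ^ k ≤ 2 ^ k * Counts.N F →
    ∀ θ → c * q * Counts.N F < θ ^ 2 → θ ^ 2 ≤ 4 * (c * q * Counts.N F) →
    numEdges F ^ (k * 2) * n ^ (j * 2) ≤ (128 * c * eCT n) ^ (k * 2)
  with-roots n 3≤n F free q N<q^k q^k≤ θ W<θ² θ²≤ = begin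
    φ ^ (k * 2) * n ^ (j * 2)
      ≤⟨ *-mono-≤ (^-monoˡ-≤ (k * 2) φ≤Pθ) (≤-trans (≤-reflexive (square-^ n j)) (^-monoˡ-≤ j n²≤4N)) ⟩
    (P * θ) ^ (k * 2) * (4 * N) ^ j
      ≡⟨ cong (_* (4 * N) ^ j) (trans (square-^ (P * θ) k) (trans (cong (_^ k) (lemma₁ P θ)) (*-^ (P * P) (θ * θ) k))) ⟩
    (P * P) ^ k * (θ * θ) ^ k * (4 * N) ^ j
      ≤⟨ *-monoˡ-≤ _ (*-monoʳ-≤ ((P * P) ^ k) (^-monoˡ-≤ k θθ≤)) ⟩
    (P * P) ^ k * (4 * (c * q * N)) ^ k * (4 * N) ^ j
      ≡⟨ cong (λ z → (P * P) ^ k * z * (4 * N) ^ j) (trans (cong (_^ k) (lemma₂ c q N)) (*-^ (4 * c * N) q k)) ⟩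
    (P * P) ^ k * ((4 * c * N) ^ k * q ^ k) * (4 * N) ^ j
      ≡⟨ lemma₃ ((P * P) ^ k) ((4 * c * N) ^ k) (q ^ k) ((4 * N) ^ j) ⟩
    (P * P) ^ k * ((4 * c * N) ^ k * (q ^ k * (4 * N) ^ j))
      ≤⟨ *-monoʳ-≤ ((P * P) ^ k) (*-monoʳ-≤ ((4 * c * N) ^ k) q-part) ⟩
    (P * P) ^ k * ((4 * c * N) ^ k * (8 * N) ^ k)
      ≡⟨ sym (trans (*-^ (P * P) (4 * c * N * (8 * N)) k) (cong ((P * P) ^ k *_) (*-^ (4 * c * N) (8 * N) k))) ⟩
    (P * P * (4 * c * N * (8 * N))) ^ k
      ≡⟨ cong (_^ k) (trans (lemma₄ P c N) (trans (cong (λ z → 32 * c * (z * z)) (PN≡2e (<⇒≤ 3≤n))) (lemma₅ c (eCT n)))) ⟩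
    (128 * c * (eCT n * eCT n)) ^ k
      ≤⟨ ^-monoˡ-≤ k (≤-trans (m≤n*m (128 * c * (eCT n * eCT n)) (128 * c)) (≤-reflexive (lemma₆ (128 * c) (eCT n)))) ⟩
    (128 * c * eCT n * (128 * c * eCT n)) ^ k
      ≡⟨ sym (square-^ (128 * c * eCT n) k) ⟩
    (128 * c * eCT n) ^ (k * 2) ∎
    where
    open ≤-Reasoning
    open Counts F
    open Sparse F
    open Link F using (linkSum)
    φ : ℕ
    φ = numEdges F
    lemma₁ : ∀ p t → p * t * (p * t) ≡ p * p * (t * t)
    lemma₁ = solve-∀
    lemma₂ : ∀ c q m → 4 * (c * q * m) ≡ 4 * c * m * q
    lemma₂ = solve-∀
    lemma₃ : ∀ a b q d → a * (b * q) * d ≡ a * (b * (q * d))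
    lemma₃ = solve-∀
    lemma₄ : ∀ p c m → p * p * (4 * c * m * (8 * m)) ≡ 32 * c * ((p * m) * (p * m))
    lemma₄ = solve-∀
    lemma₅ : ∀ c e → 32 * c * (2 * e * (2 * e)) ≡ 128 * c * (e * e)
    lemma₅ = solve-∀
    lemma₆ : ∀ d e → d * (d * (e * e)) ≡ d * e * (d * e)
    lemma₆ = solve-∀
    lemma₇ : ∀ t → t * (t * 1) ≡ t * t
    lemma₇ = solve-∀
    q≥1 : 1 ≤ q
    q≥1 = base-positive q j N<q^k
    n²≤4N : n * n ≤ 4 * N
    n²≤4N = n²≤4*N (<⇒≤ 3≤n)
    θθ≤ : θ * θ ≤ 4 * (c * q * N)
    θθ≤ = ≤-trans (≤-reflexive (sym (lemma₇ θ))) θ²≤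
    W≤θθ : c * q * N ≤ θ * θ
    W≤θθ = ≤-trans (<⇒≤ W<θ²) (≤-reflexive (lemma₇ θ))
    -- In fact c ≥ 108 for k ≥ 2; the comparison 16n² ≤ 64N ≤ θ² below asks for 64.
    64≤c : 64 ≤ c
    64≤c = ≤-trans (m≤m+n 64 44) (*-monoʳ-≤ 12 (+-monoˡ-≤ 5 (*-monoʳ-≤ 2 k≥2)))
    4n≤θ : 4 * n ≤ θ
    4n≤θ = square-cancel-≤ (begin
      4 * n * (4 * n)   ≡⟨ lemma n ⟩
      16 * (n * n)      ≤⟨ *-monoʳ-≤ 16 n²≤4N ⟩
      16 * (4 * N)      ≡⟨ sym (*-assoc 16 4 N) ⟩
      64 * N            ≤⟨ *-monoˡ-≤ N (≤-trans (≤-reflexive (sym (*-identityʳ 64))) (*-mono-≤ 64≤c q≥1)) ⟩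
      c * q * N         ≤⟨ W≤θθ ⟩
      θ * θ             ∎)
      where
      lemma : ∀ n → 4 * n * (4 * n) ≡ 16 * (n * n)
      lemma = solve-∀
    sparse : linkSum ≤ P * (θ * θ)
    sparse = begin
      linkSum                                   ≤⟨ linkSum-sparse k q k≥2 q≥1 N<q^k (subst (λ z → CycleFree (2 * z) F) (*-comm k 2) free) ⟩
      P * (2 * ((2 * k + 5) * (q + 5)) * N)     ≤⟨ *-monoʳ-≤ P (*-monoˡ-≤ N (*-monoʳ-≤ 2 (*-monoʳ-≤ (2 * k + 5) (+-monoʳ-≤ q (*-monoʳ-≤ 5 q≥1))))) ⟩
      P * (2 * ((2 * k + 5) * (q + 5 * q)) * N) ≡⟨ cong (P *_) (lemma (2 * k + 5) q N) ⟩
      P * (c * q * N)                           ≤⟨ *-monoʳ-≤ P W≤θθ ⟩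
      P * (θ * θ)                               ∎
      where
      lemma : ∀ d q m → 2 * (d * (q + 5 * q)) * m ≡ 12 * d * q * m
      lemma = solve-∀
    φ≤Pθ : φ ≤ P * θ
    φ≤Pθ = *-cancelˡ-≤ 2 (≤-trans (handshake F) (degreeSum-bound θ (≤-trans (*-mono-≤ {1} {4} {1} (s≤s z≤n) (≤-trans (s≤s z≤n) 3≤n)) 4n≤θ) 4n≤θ sparse))
    q-part : q ^ k * (4 * N) ^ j ≤ (8 * N) ^ k
    q-part = begin
      q ^ k * (4 * N) ^ j              ≤⟨ *-monoˡ-≤ _ q^k≤ ⟩
      2 ^ k * N * (4 * N) ^ j          ≤⟨ *-monoˡ-≤ _ (*-monoʳ-≤ (2 ^ k) (m≤n*m N 4)) ⟩
      2 ^ k * (4 * N) * (4 * N) ^ j    ≡⟨ *-assoc (2 ^ k) (4 * N) _ ⟩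
      2 ^ k * (4 * N) ^ k              ≡⟨ sym (*-^ 2 (4 * N) k) ⟩
      (2 * (4 * N)) ^ k                ≡⟨ cong (_^ k) (sym (*-assoc 2 4 N)) ⟩
      (8 * N) ^ k                      ∎
  proof : ∀ n → 3 ≤ n → (F : SubgraphCT n) → CycleFree (2 * (k * 2)) F →
          numEdges F ^ (k * 2) * n ^ (j * 2) ≤ (128 * c * eCT n) ^ (k * 2)
  proof n 3≤n F free =
    let q , N<q^k , q^k≤ = root k (s≤s z≤n) (Counts.N F) (N≥1 n 3≤n F)
        θ , W<θ² , θ²≤ = root 2 (s≤s z≤n) (c * q * Counts.N F)
          (*-mono-≤ (*-mono-≤ {1} {c} (s≤s z≤n) (base-positive q j N<q^k)) (N≥1 n 3≤n F))
    in with-roots n 3≤n F free q N<q^k q^k≤ θ W<θ² θ²≤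

-- Two arcs over a common edge

-- The finite search space that makes `Good` decidable.
words : List A → ℕ → List (List A)
words vs zero = [ [] ]
words vs (suc m) = concatMap (λ x → map (x ∷_) (words vs m)) vs

words-complete : {vs xs : List A} → All (_∈ vs) xs → xs ∈ words vs (length xs)
words-complete [] = here refl
words-complete {vs = vs} {x ∷ xs} (x∈ ∷ all) =
  ∈-concatMap⁺ (λ x → map (x ∷_) (words vs (length xs))) (lose x∈ (∈-map⁺ (x ∷_) (words-complete all)))

walk? : DecidableEquality A → {R : A → A → Set} → (∀ x y → Dec (R x y)) → ∀ x xs y → Dec (Walk R x xs y)
walk? _≟_ R? x [] y with x ≟ y
... | yes refl = yes []
... | no ne = no λ { [] → ne refl }
walk? _≟_ R? x (z ∷ zs) y with x ≟ z
... | no ne = no λ { (_ ∷ _) → ne refl }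
walk? _≟_ R? x (_ ∷ []) y | yes refl with R? x y
... | yes r = yes (r ∷ [])
... | no ¬r = no λ { (r ∷ []) → ¬r r }
walk? _≟_ R? x (_ ∷ w ∷ ws) y | yes refl with R? x w | walk? _≟_ R? w (w ∷ ws) y
... | yes r | yes p = yes (r ∷ p)
... | no ¬r | _ = no λ { (r ∷ (r′ ∷ p)) → ¬r r }
... | _ | no ¬p = no λ { (r ∷ (r′ ∷ p)) → ¬p (r′ ∷ p) }

module Rich {n : ℕ} (F : SubgraphCT n) where

  open Counts F
  open Link F

  -- The remainder of a link cycle of length `2 * k` through the pair `u`, `v`: a path from `v` back
  -- to `u`.
  record Good (k : ℕ) (x : Vertex n) (u v : Transposition n) : Set where
    constructor good
    field
      {inner} : List (Transposition n)
      path : Walk (Linked x) v inner u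
      path! : Unique (u ∷ inner)
      size : suc (length inner) ≡ 2 * k
      inside : All (_∈ ts) (u ∷ inner)

  good? : ∀ k x u v → Dec (Good k x u v)
  good? k x u v = map′ to from (Any.any? (λ ws →
      walk? _≟ᵗ_ (linked? x) v ws u ×-dec unique? (u ∷ ws) ×-dec (suc (length ws) ℕₚ.≟ 2 * k) ×-dec All.all? (_∈? ts) (u ∷ ws))
    (words ts (2 * k ∸ 1)))
    where
    open DecMembership _≟ᵗ_ using (_∈?_)
    open DecUnique _≟ᵗ_ using (unique?)
    Candidate : List (Transposition n) → Set
    Candidate ws = Walk (Linked x) v ws u × Unique (u ∷ ws) × suc (length ws) ≡ 2 * k × All (_∈ ts) (u ∷ ws)
    to : Any Candidate (words ts (2 * k ∸ 1)) → Good k x u v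
    to p = let ws , _ , w , w! , s , i = find p in good w w! s i
    from : Good k x u v → Any Candidate (words ts (2 * k ∸ 1))
    from (good {ws} w w! s (u∈ ∷ i)) = lose (subst (λ m → ws ∈ words ts m) (cong (_∸ 1) s) (words-complete i)) (w , w! , s , u∈ ∷ i)

  good-sym : ∀ k x {u v} → Good k x u v → Good k x v u
  good-sym k x (good w w! s i) with reverseʷ (linked-sym x) w
  ... | ys , w′ , p = good w′ (Unique-resp-↭ p w!) (trans (sym (↭-length p)) s)
    (All.tabulate (λ z∈ → All.lookup i (∈-resp-↭ (↭-sym p) z∈)))

  Bad : ℕ → Vertex n → Transposition n → Transposition n → Set
  Bad k x u v = Linked x u v × ¬ Good k x u v

  bad? : ∀ k x u v → Dec (Bad k x u v)
  bad? k x u v = linked? x u v ×-dec ¬? (good? k x u v)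

  bad-sym : ∀ k x {u v} → Bad k x u v → Bad k x v u
  bad-sym k x (r , ¬g) = linked-sym x r , ¬g ∘ good-sym k x

  -- Any such cycle would make its own first pair good.
  bad-acyclic : ∀ k x → 1 ≤ k → ¬ Cycle (Bad k x) ts (2 * k)
  bad-acyclic k x _ (u , _ ∷ ws , (_ , ¬g) ∷ w , u! , s , i) = ¬g (good (Walk-map proj₁ w) u! s i)
  bad-acyclic (suc k) x _ (u , [] , [] , _ , () , _)

  -- Taking `q = n` works for every k ≥ 2, since N < n². For k = 2, the case of 8-cycles, `q` must
  -- be of order n in any case.
  bad-few : ∀ k → 2 ≤ k → 1 ≤ n → ∀ x → ∑[ u ∈ ts ] ∑[ v ∈ ts ] ⟨ bad? k x u v ⟩ ≤ 2 * ((2 * k + 5) * (n + 5)) * N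
  bad-few k k≥2 n≥1 x = EvenCycles.bondy-simonovits _≟ᵗ_ (λ u v → does (bad? k x u v))
    (λ u v → does-cong (bad? k x u v) (bad? k x v u) (bad-sym k x) (bad-sym k x))
    (λ v t → linked-irrefl x (proj₁ (T-does⁻ (bad? k x v v) t)))
    ts ts! k n n≥1 small
    (λ (u , us , w , rest) → bad-acyclic k x (<⇒≤ k≥2) (u , us , Walk-map (λ {u} {v} → T-does⁻ (bad? k x u v)) w , rest))
    where
    open ≤-Reasoning
    instance
      n≢0 = >-nonZero n≥1
    small : N < n ^ k
    small = begin-strict
      N            ≡⟨ transpositions-count n ⟩
      n choose 2   <⟨ nC2<n² n n≥1 ⟩
      n * n        ≡⟨ cong (n *_) (sym (*-identityʳ n)) ⟩
      n ^ 2        ≤⟨ ^-monoʳ-≤ n k≥2 ⟩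
      n ^ k        ∎

  -- The two arcs hang off the same edge from y to act v y, but are seen from act u y and from
  -- act u′ (act v y); if u′ misses the first and u the second arc, they meet only in that edge.
  module Arcs {y : Vertex n} (perm : IsPerm y) {u v : Transposition n} (link : Linked (act u y) u v) {k : ℕ} (k≥2 : 2 ≤ k)
    (g : Good k (act u y) u v) where

    open Good g
    open Expand {act u y} (act-perm u {y} perm)

    os : All Ordered (u ∷ inner)
    os = All.map ordered inside

    ou : Ordered u
    ou = All.head os

    2≤size : 2 ≤ length inner
    2≤size = ≤-pred (≤-trans (n≤1+n 3) (≤-trans (*-monoʳ-≤ 2 k≥2) (≤-reflexive (sym size))))

    head-eq : act u (act v (act u y)) ≡ act v y
    head-eq = trans (cong (act u) (sym (act-commute {u = u} {v} (proj₁ link) y))) (act-involutive u (act v y))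

    trail : List (Vertex n)
    trail = arc path

    trail-walk : Walk (EdgeIn F) (act v y) trail y
    trail-walk = subst₂ (λ s t → Walk (EdgeIn F) s trail t) head-eq (act-involutive u y) (arc-walk link path)

    trail! : Unique trail
    trail! = AllPairs.tail (arc-unique link path 2≤size os path!)

    trail-length : suc (length trail) ≡ 2 * (2 * k)
    trail-length = trans (cong suc (arc-length path)) (trans (sym (*-suc 2 (length inner))) (cong (2 *_) size))

    start∈ : v ∈ inner
    start∈ = go path 2≤size
      where
      go : ∀ {ws} → Walk (Linked (act u y)) v ws u → 2 ≤ length ws → v ∈ ws
      go (_ ∷ _) _ = here refl

    lookup² : ∀ s i → lookup (act s (act u y)) i ≡ τ s (τ u (lookup y i))
    lookup² s i = lookup-act² s u y i

    lookup³ : ∀ s t i → lookup (act s (act t (act u y))) i ≡ τ s (τ t (τ u (lookup y i)))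
    lookup³ s t i = trans (lookup-act s (act t (act u y)) i) (cong (τ s) (lookup-act² t u y i))

    -- Applied to an entry of the transposition at the centre of the other arc, which this arc
    -- leaves in place.
    fixes : ∀ {i} → (∀ {w} → w ∈ u ∷ inner → τ w (lookup y i) ≡ lookup y i) → ∀ {z} → z ∈ trail → lookup z i ≡ lookup y i
    fixes {i} fix (here refl) = trans (lookup³ u v i)
      (trans (cong (τ u) (trans (cong (τ v) (fix (here refl))) (fix (there start∈)))) (fix (here refl)))
    fixes {i} fix (there z∈) with shape path z∈
    ... | one {s} s∈ refl = trans (lookup² s i) (trans (cong (τ s) (fix (here refl))) (fix (there s∈)))
    ... | two {s} {t} s∈ t∈ p refl = trans (lookup³ s t i)
      (trans (cong (τ s) (trans (cong (τ t) (fix (here refl))) (fix t∈))) (fix (there s∈)))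

    -- At position `i` the centre uy has `proj₂ u`. To bring back `proj₁ u`, one of the factors
    -- applied to uy must be `u`; the factor from `inner` is not, so it is the other one, and the
    -- two copies of `u` cancel.
    returns : ∀ {i} → lookup y i ≡ proj₁ u → ∀ {z} → z ∈ trail → lookup z i ≡ proj₁ u → ∃ λ s → Ordered s × z ≡ act s y
    returns at (here refl) _ = v , All.lookup os (there start∈) , head-eq
    returns {i} at (there z∈) back with shape path z∈
    ... | one {s} s∈ refl = ⊥-elim (Unique[x∷xs]⇒x∉xs path! (subst (_∈ inner) s≡u s∈))
      where
      s≡u : s ≡ u
      s≡u = sym (τ-determined ou (All.lookup os (there s∈)) (τ-moves-snd ou)
        (trans (τ-snd u) (sym (trans (cong (τ s) (sym (trans (cong (τ u) at) (τ-fst u)))) (trans (sym (lookup² s i)) back)))))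
    ... | two {s} {t} s∈ t∈ p refl with ∥-product-factor {s = s} {t} {proj₂ u} p moved
      where
      whole : τ s (τ t (proj₂ u)) ≡ proj₁ u
      whole = trans (cong (λ z → τ s (τ t z)) (sym (trans (cong (τ u) at) (τ-fst u)))) (trans (sym (lookup³ s t i)) back)
      moved : τ s (τ t (proj₂ u)) ≢ proj₂ u
      moved e = fst≢snd ou (trans (sym whole) e)
    ... | inj₁ e = ⊥-elim (Unique[x∷xs]⇒x∉xs path! (subst (_∈ inner) s≡u s∈))
      where
      s≡u : s ≡ u
      s≡u = sym (τ-determined ou (All.lookup os (there s∈)) (τ-moves-snd ou)
        (trans (τ-snd u) (sym (trans e (trans (cong (λ z → τ s (τ t z)) (sym (trans (cong (τ u) at) (τ-fst u)))) (trans (sym (lookup³ s t i)) back))))))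
    ... | inj₂ e = s , All.lookup os (there s∈) , cong (act s) (trans (cong (λ w → act w (act u y)) t≡u) (act-involutive u y))
      where
      t≡u : t ≡ u
      t≡u = sym (τ-determined ou (All.lookup os t∈) (τ-moves-snd ou)
        (trans (τ-snd u) (sym (trans e (trans (cong (λ z → τ s (τ t z)) (sym (trans (cong (τ u) at) (τ-fst u)))) (trans (sym (lookup³ s t i)) back))))))

  module Glue {y : Vertex n} (perm : IsPerm y) {u u′ v : Transposition n}
    {k k′ : ℕ} (k≥2 : 2 ≤ k) (k′≥2 : 2 ≤ k′)
    (link : Linked (act u y) u v) (g : Good k (act u y) u v)
    (link′ : Linked (act u′ (act v y)) u′ v) (g′ : Good k′ (act u′ (act v y)) u′ v)
    (clear : ∀ {w} → w ∈ u ∷ Good.inner g → w ∥ u′) (clear′ : ∀ {w} → w ∈ u′ ∷ Good.inner g′ → w ∥ u) where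

    private
      module A₁ = Arcs {y} perm link k≥2 g
      module A₂ = Arcs {act v y} (act-perm v {y} perm) link′ k′≥2 g′

      fix : ∀ {w s : Transposition n} → w ∥ s → τ w (proj₁ s) ≡ proj₁ s
      fix {w} {s} p = ∥-fst {u = s} {w} (∥-sym {u = w} {s} p)

      -- The second arc keeps `proj₁ u` where `y` has it, so a common vertex is sy by `returns`; by
      -- symmetry it is s′vy. But s′v is either the identity or no transposition.
      disjoint : ∀ {z} → z ∈ A₁.trail → z ∈ A₂.trail → ⊥
      disjoint {z} z∈ z∈′ =
        let i , at-i = perm-surjective {x = y} perm (proj₁ u)
            j , at-j = perm-surjective {x = y} perm (proj₁ u′)
            at-i′ = trans (lookup-act v y i) (trans (cong (τ v) at-i) (fix {v} {u} (clear′ (there A₂.start∈))))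
            at-j′ = trans (lookup-act v y j) (trans (cong (τ v) at-j) (fix {v} {u′} (clear (there A₁.start∈))))
            s , os , z≡ = A₁.returns at-i z∈ (trans (A₂.fixes (λ {w} w∈ → fix-at {w} {u} at-i′ (clear′ w∈)) z∈′) at-i′)
            s′ , os′ , z≡′ = A₂.returns at-j′ z∈′ (trans (A₁.fixes (λ {w} w∈ → fix-at {w} {u′} at-j (clear w∈)) z∈) at-j)
        in apart os os′ (s′ ≟ᵗ v) (trans (sym z≡) z≡′)
        where
        fix-at : ∀ {w s : Transposition n} {p} → p ≡ proj₁ s → w ∥ s → τ w p ≡ p
        fix-at {w} {s} refl p = fix {w} {s} p
        apart : ∀ {s s′} → Ordered s → Ordered s′ → Dec (s′ ≡ v) → act s y ≢ act s′ (act v y)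
        apart os os′ (yes refl) eq = Free.zero-one {x = y} perm os (trans eq (act-involutive v y))
        apart os os′ (no s′≢v) eq = Free.one-two {x = y} perm os′ (All.lookup A₁.os (there A₁.start∈)) os s′≢v (sym eq)

    -- Each trail omits its final vertex, so the lists have 4k - 1 and 4k′ - 1 entries.
    glued : ∀ m → 2 + suc m ≡ 2 * (2 * k) + 2 * (2 * k′) → HasCycle F (suc m)
    glued m eq = closed-walk⇒cycle F
      (A₁.trail-walk ++ʷ subst (λ z → Walk (EdgeIn F) z A₂.trail (act v y)) (act-involutive v y) A₂.trail-walk)
      (Unique-++ A₁.trail! A₂.trail! disjoint)
      (trans (length-++ A₁.trail) (suc-injective (suc-injective (trans (sym (+-suc (suc l₁) l₂)) (trans (cong₂ _+_ A₁.trail-length A₂.trail-length) (sym eq))))))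
      where
      l₁ = length A₁.trail
      l₂ = length A₂.trail

-- Counting conflicts between arcs over a common edge

∑≡0 : {xs : List A} {f : A → ℕ} → ∑ xs f ≡ 0 → ∀ {x} → x ∈ xs → f x ≡ 0
∑≡0 {xs = x ∷ xs} {f} eq (here refl) = m+n≡0⇒m≡0 (f x) eq
∑≡0 {xs = x ∷ xs} {f} eq (there x∈) = ∑≡0 {f = f} (m+n≡0⇒n≡0 (f x) eq) x∈

⟨¬⟩≡0 : {X : Set} (d : Dec X) → ⟨ ¬? d ⟩ ≡ 0 → X
⟨¬⟩≡0 (yes x) _ = x

-- Otherwise αβ would exceed both 2αc and 2βd, hence also their mean.
product-dichotomy : ∀ α β c d → α * β ≤ α * c + β * d → α ≤ 2 * d ⊎ β ≤ 2 * c
product-dichotomy α β c d le with α ≤? 2 * d | β ≤? 2 * c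
... | yes p | _ = inj₁ p
... | no _ | yes q = inj₂ q
... | no p | no q = ⊥-elim (<⇒≱ exceeds (≤-trans (*-monoʳ-≤ 2 le) (≤-reflexive (lemma₁ α β c d))))
  where
  open ≤-Reasoning
  instance
    α≢0 = >-nonZero (≤-trans (s≤s z≤n) (≰⇒> p))
    β≢0 = >-nonZero (≤-trans (s≤s z≤n) (≰⇒> q))
  lemma₁ : ∀ a b c d → 2 * (a * c + b * d) ≡ a * (2 * c) + b * (2 * d)
  lemma₁ = solve-∀
  lemma₂ : ∀ a b → a * b + b * a ≡ 2 * (a * b)
  lemma₂ = solve-∀
  exceeds : α * (2 * c) + β * (2 * d) < 2 * (α * β)
  exceeds = begin-strict
    α * (2 * c) + β * (2 * d)  <⟨ +-mono-< (*-monoʳ-< α (≰⇒> q)) (*-monoʳ-< β (≰⇒> p)) ⟩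
    α * β + β * α              ≡⟨ lemma₂ α β ⟩
    2 * (α * β)                ∎

module OddCycles {n : ℕ} (F : SubgraphCT n) (n≥1 : 1 ≤ n) {k k′ : ℕ} (k≥2 : 2 ≤ k) (k′≥2 : 2 ≤ k′)
  {m : ℕ} (length-eq : 2 + suc m ≡ 2 * (2 * k) + 2 * (2 * k′)) (free : CycleFree (suc m) F) where

  open Counts F
  open Link F
  open Rich F

  private
    d : Vertex n → ℕ
    d = degree F

    edge : Vertex n → Transposition n → ℕ
    edge y v = ⟨ edgeIn? F y (act v y) ⟩

    -- The link cycle is read off the decision, so the choice made for `u` does not depend on its
    -- partner `u′`. This lets the clashes be summed over each side separately.
    track : ∀ {k x u v} → Dec (Good k x u v) → List (Transposition n)
    track {u = u} (yes g) = u ∷ Good.inner g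
    track (no _) = []

    track-length : ∀ {k x u v} (g : Dec (Good k x u v)) → length (track g) ≤ 2 * k
    track-length (yes g) = ≤-reflexive (Good.size g)
    track-length (no _) = z≤n

    Useful : ℕ → Vertex n → Transposition n → Transposition n → Set
    Useful k y v u = Linked (act u y) u v × Good k (act u y) u v

    useful? : ∀ k y v u → Dec (Useful k y v u)
    useful? k y v u = linked? (act u y) u v ×-dec good? k (act u y) u v

    U : ℕ → Vertex n → Transposition n → List (Transposition n)
    U k y v = filter (useful? k y v) ts

    clash : List (Transposition n) → Transposition n → ℕ
    clash ws u = ∑[ w ∈ ws ] ⟨ ¬? (w ∥? u) ⟩

    -- Two tracks without a clash would glue to a cycle of the forbidden length.
    conflict : ∀ {y u u′ v} → IsPerm y → Useful k y v u → Useful k′ (act v y) v u′ →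
      (g : Dec (Good k (act u y) u v)) (g′ : Dec (Good k′ (act u′ (act v y)) u′ v)) →
      1 ≤ clash (track g) u′ + clash (track g′) u
    conflict perm (_ , h) _ (no ¬g) _ = ⊥-elim (¬g h)
    conflict perm _ (_ , h) (yes _) (no ¬g) = ⊥-elim (¬g h)
    conflict {y} {u} {u′} perm (l , _) (l′ , _) (yes g) (yes g′) = n≢0⇒n>0 λ zero-sum →
      free (Glue.glued {y} perm k≥2 k′≥2 l g l′ g′
        (λ {w} w∈ → ⟨¬⟩≡0 (w ∥? u′) (∑≡0 {f = λ w → ⟨ ¬? (w ∥? u′) ⟩} (m+n≡0⇒m≡0 _ zero-sum) w∈))
        (λ {w} w∈ → ⟨¬⟩≡0 (w ∥? u) (∑≡0 {f = λ w → ⟨ ¬? (w ∥? u) ⟩} (m+n≡0⇒n≡0 (clash (u ∷ Good.inner g) u′) zero-sum) w∈)) m length-eq)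

    clash-total : ∀ {us} ws → Unique us → (∀ {u} → u ∈ us → u ∈ ts) → ∑[ u ∈ us ] clash ws u ≤ length ws * (4 * n)
    clash-total {us} ws us! us⊆ = ≤-trans (≤-reflexive (∑-swap us ws _))
      (∑-≤-const ws (4 * n) (λ {w} _ → ≤-trans (∑-⊆ _ us! us⊆) (few-touching w)))

    U! : ∀ k y v → Unique (U k y v)
    U! k y v = Unique-filter⁺ (useful? k y v) ts!

    U⊆ : ∀ k y v {u} → u ∈ U k y v → u ∈ ts
    U⊆ k y v p = proj₁ (∈-filter⁻ (useful? k y v) {xs = ts} p)

    useful : ∀ k y v {u} → u ∈ U k y v → Useful k y v u
    useful k y v p = proj₂ (∈-filter⁻ (useful? k y v) {xs = ts} p)

    conflicts : ∀ {y} v → IsPerm y → let α = length (U k y v) ; β = length (U k′ (act v y) v) in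
      α * β ≤ α * (2 * k * (4 * n)) + β * (2 * k′ * (4 * n))
    conflicts {y} v perm = begin
      α * β
        ≡⟨ sym (∑-const us β) ⟩
      ∑[ _ ∈ us ] β
        ≡⟨ ∑-cong us (λ _ → length-∑ us′) ⟩
      ∑[ _ ∈ us ] ∑[ _ ∈ us′ ] 1
        ≤⟨ ∑-mono us (λ {u} u∈ → ∑-mono us′ (λ {u′} u′∈ → conflict {y} {u} {u′} {v} perm (useful k y v u∈) (useful k′ (act v y) v u′∈) (good? k (act u y) u v) (good? k′ (act u′ (act v y)) u′ v))) ⟩
      ∑[ u ∈ us ] ∑[ u′ ∈ us′ ] (clash (t u) u′ + clash (t′ u′) u)
        ≡⟨ trans (∑-cong us (λ _ → ∑-+ us′ _ _)) (∑-+ us _ _) ⟩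
      (∑[ u ∈ us ] ∑[ u′ ∈ us′ ] clash (t u) u′) + (∑[ u ∈ us ] ∑[ u′ ∈ us′ ] clash (t′ u′) u)
        ≤⟨ +-mono-≤ (∑-≤-const us _ (λ {u} _ → ≤-trans (clash-total (t u) (U! k′ (act v y) v) (U⊆ k′ (act v y) v)) (*-monoˡ-≤ (4 * n) (track-length (good? k (act u y) u v)))))
             (≤-trans (≤-reflexive (∑-swap us us′ _))
               (∑-≤-const us′ _ (λ {u′} _ → ≤-trans (clash-total (t′ u′) (U! k y v) (U⊆ k y v)) (*-monoˡ-≤ (4 * n) (track-length (good? k′ (act u′ (act v y)) u′ v)))))) ⟩
      α * (2 * k * (4 * n)) + β * (2 * k′ * (4 * n)) ∎
      where
      open ≤-Reasoning
      us us′ : List (Transposition n)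
      us = U k y v
      us′ = U k′ (act v y) v
      α = length us
      β = length us′
      t t′ : Transposition n → List (Transposition n)
      t u = track (good? k (act u y) u v)
      t′ u′ = track (good? k′ (act u′ (act v y)) u′ v)

    badDeg : ℕ → Vertex n → Transposition n → ℕ
    badDeg k y v = ∑[ u ∈ ts ] ⟨ bad? k (act u y) u v ⟩

    -- For `u` disjoint from `v`, the edge from vy to uvy and the edge from y to vy make `u`, `v` a
    -- link pair of uy. It is bad or useful; the other `u` number at most `4 * n`.
    degree-split : ∀ k y v → EdgeIn F y (act v y) → d (act v y) ≤ badDeg k y v + length (U k y v) + 4 * n
    degree-split k y v e = begin
      d (act v y)
        ≤⟨ ∑-mono ts (λ {u} _ → at u (v ∥? u) (edgeIn? F (act v y) (act u (act v y))) (linked? (act u y) u v) (good? k (act u y) u v)) ⟩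
      ∑[ u ∈ ts ] (⟨ bad? k (act u y) u v ⟩ + ⟨ useful? k y v u ⟩ + ⟨ ¬? (v ∥? u) ⟩)
        ≡⟨ trans (∑-+ ts _ _) (cong (_+ (∑[ u ∈ ts ] ⟨ ¬? (v ∥? u) ⟩)) (∑-+ ts _ _)) ⟩
      badDeg k y v + (∑[ u ∈ ts ] ⟨ useful? k y v u ⟩) + (∑[ u ∈ ts ] ⟨ ¬? (v ∥? u) ⟩)
        ≤⟨ +-mono-≤ (≤-reflexive (cong (badDeg k y v +_) (sym (length-filter-∑ (useful? k y v) ts)))) (few-touching v) ⟩
      badDeg k y v + length (U k y v) + 4 * n ∎
      where
      open ≤-Reasoning
      linked : ∀ u → v ∥ u → EdgeIn F (act v y) (act u (act v y)) → Linked (act u y) u v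
      linked u p e′ = p′ ,
        subst₂ (EdgeIn F) (sym (act-involutive u y)) (sym top) e ,
        subst₂ (EdgeIn F) (act-commute {u = u} {v} p′ y) (sym top) (EdgeIn-sym F e′)
        where
        p′ : u ∥ v
        p′ = ∥-sym {u = v} {u} p
        top : act u (act v (act u y)) ≡ act v y
        top = trans (cong (act u) (sym (act-commute {u = u} {v} p′ y))) (act-involutive u (act v y))
      at : ∀ u (p : Dec (v ∥ u)) (e′ : Dec (EdgeIn F (act v y) (act u (act v y)))) (l : Dec (Linked (act u y) u v)) (g : Dec (Good k (act u y) u v)) →
           ⟨ e′ ⟩ ≤ ⟨ l ×-dec ¬? g ⟩ + ⟨ l ×-dec g ⟩ + ⟨ ¬? p ⟩
      at u p (no _) l g = z≤n
      at u (no _) (yes _) l g = m≤n+m 1 _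
      at u (yes p) (yes e′) (no ¬l) g = ⊥-elim (¬l (linked u p e′))
      at u (yes p) (yes e′) (yes l) (yes g) = ≤-refl
      at u (yes p) (yes e′) (yes l) (no ¬g) = ≤-refl

  K : ℕ
  K = 16 * (k + k′) + 4

  private
    -- By `product-dichotomy` one of the two useful sets is small, and it then bounds the degree of
    -- vy or that of y. Which one is not known, so both degrees are assumed to be at least `θ`.
    edge-bound : ∀ {y} v → IsPerm y → EdgeIn F y (act v y) → ∀ {θ} → θ ≤ d y → θ ≤ d (act v y) →
                 θ ≤ K * n + (badDeg k y v + badDeg k′ (act v y) v)
    edge-bound {y} v perm e {θ} low low′ =
      case (product-dichotomy (length (U k y v)) (length (U k′ (act v y) v)) (2 * k * (4 * n)) (2 * k′ * (4 * n)) (conflicts v perm))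
      where
      open ≤-Reasoning
      case : length (U k y v) ≤ 2 * (2 * k′ * (4 * n)) ⊎ length (U k′ (act v y) v) ≤ 2 * (2 * k * (4 * n)) →
             θ ≤ K * n + (badDeg k y v + badDeg k′ (act v y) v)
      case (inj₁ few) = begin
        θ                                                   ≤⟨ low′ ⟩
        d (act v y)                                         ≤⟨ degree-split k y v e ⟩
        badDeg k y v + length (U k y v) + 4 * n                  ≤⟨ +-monoˡ-≤ (4 * n) (+-monoʳ-≤ (badDeg k y v) few) ⟩
        badDeg k y v + 2 * (2 * k′ * (4 * n)) + 4 * n            ≤⟨ m≤m+n _ (16 * k * n + badDeg k′ (act v y) v) ⟩
        badDeg k y v + 2 * (2 * k′ * (4 * n)) + 4 * n + (16 * k * n + badDeg k′ (act v y) v) ≡⟨ lemma k k′ n (badDeg k y v) (badDeg k′ (act v y) v) ⟩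
        K * n + (badDeg k y v + badDeg k′ (act v y) v)                ∎
        where
        lemma : ∀ k l n b c → b + 2 * (2 * l * (4 * n)) + 4 * n + (16 * k * n + c) ≡ (16 * (k + l) + 4) * n + (b + c)
        lemma = solve-∀
      case (inj₂ few) = begin
        θ                                                   ≤⟨ low ⟩
        d y                                                 ≡⟨ cong d (sym (act-involutive v y)) ⟩
        d (act v (act v y))                                 ≤⟨ degree-split k′ (act v y) v (subst (EdgeIn F (act v y)) (sym (act-involutive v y)) (EdgeIn-sym F e)) ⟩
        badDeg k′ (act v y) v + length (U k′ (act v y) v) + 4 * n ≤⟨ +-monoˡ-≤ (4 * n) (+-monoʳ-≤ (badDeg k′ (act v y) v) few) ⟩
        badDeg k′ (act v y) v + 2 * (2 * k * (4 * n)) + 4 * n    ≤⟨ m≤m+n _ (16 * k′ * n + badDeg k y v) ⟩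
        badDeg k′ (act v y) v + 2 * (2 * k * (4 * n)) + 4 * n + (16 * k′ * n + badDeg k y v) ≡⟨ lemma k k′ n (badDeg k y v) (badDeg k′ (act v y) v) ⟩
        K * n + (badDeg k y v + badDeg k′ (act v y) v)                ∎
        where
        lemma : ∀ k l n b c → c + 2 * (2 * k * (4 * n)) + 4 * n + (16 * l * n + b) ≡ (16 * (k + l) + 4) * n + (b + c)
        lemma = solve-∀

    M : ℕ → ℕ
    M k = 2 * ((2 * k + 5) * (n + 5)) * N

    bad-total : ∀ k → 2 ≤ k → ∑[ v ∈ ts ] ∑[ y ∈ ps ] badDeg k y v ≤ P * M k
    bad-total k k≥2 = begin
      ∑[ v ∈ ts ] ∑[ y ∈ ps ] ∑[ u ∈ ts ] ⟨ bad? k (act u y) u v ⟩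
        ≡⟨ ∑-cong ts (λ {v} _ → trans (∑-swap ps ts _) (trans (∑-cong ts (λ {u} _ → ∑-act F u (λ x → ⟨ bad? k x u v ⟩))) (∑-swap ts ps _))) ⟩
      ∑[ v ∈ ts ] ∑[ x ∈ ps ] ∑[ u ∈ ts ] ⟨ bad? k x u v ⟩
        ≡⟨ trans (∑-swap ts ps _) (∑-cong ps (λ _ → ∑-swap ts ts _)) ⟩
      ∑[ x ∈ ps ] ∑[ u ∈ ts ] ∑[ v ∈ ts ] ⟨ bad? k x u v ⟩
        ≤⟨ ∑-≤-const ps (M k) (λ {x} _ → bad-few k k≥2 n≥1 x) ⟩
      P * M k ∎
      where open ≤-Reasoning

    low-total : ∀ θ → ∑[ v ∈ ts ] ∑[ y ∈ ps ] (edge y v * (θ * ⟨ d y <? θ ⟩)) ≤ P * (θ * θ)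
    low-total θ = ≤-trans (≤-reflexive (trans (∑-swap ts ps _) (∑-cong ps (λ {y} _ → ∑-*ʳ ts (θ * ⟨ d y <? θ ⟩) (edge y)))))
      (∑-≤-const ps (θ * θ) (λ {y} _ → at (d y) (d y <? θ)))
      where
      at : ∀ δ (l : Dec (δ < θ)) → δ * (θ * ⟨ l ⟩) ≤ θ * θ
      at δ (yes lt) = *-mono-≤ (<⇒≤ lt) (≤-reflexive (*-identityʳ θ))
      at δ (no _) = ≤-trans (≤-reflexive (trans (cong (δ *_) (*-zeroʳ θ)) (*-zeroʳ δ))) z≤n

    low-total′ : ∀ θ → ∑[ v ∈ ts ] ∑[ y ∈ ps ] (edge y v * (θ * ⟨ d (act v y) <? θ ⟩)) ≤ P * (θ * θ)
    low-total′ θ = ≤-trans (≤-reflexive (∑-cong ts (λ {v} _ →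
        trans (∑-cong ps (λ {y} _ → cong (_* (θ * ⟨ d (act v y) <? θ ⟩)) (flip y v)))
          (∑-act F v (λ y → edge y v * (θ * ⟨ d y <? θ ⟩))))))
      (low-total θ)
      where
      flip : ∀ y v → edge y v ≡ edge (act v y) v
      flip y v = ⟨⟩-cong (edgeIn? F y (act v y)) (edgeIn? F (act v y) (act v (act v y)))
        (λ e → subst (EdgeIn F (act v y)) (sym (act-involutive v y)) (EdgeIn-sym F e))
        (λ e → EdgeIn-sym F (subst (EdgeIn F (act v y)) (act-involutive v y) e))

  -- An edge end of degree below `θ` is charged `θ` for each of its fewer than `θ` edges, which
  -- costs `P * (θ * θ)` for either end. All remaining edges fall under `edge-bound`.
  weighted-bound : ∀ θ → θ * S ≤ 2 * (P * (θ * θ)) + K * n * S + P * (M k + M k′)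
  weighted-bound θ = begin
    θ * S
      ≡⟨ cong (θ *_) (∑-swap ps ts _) ⟩
    θ * (∑[ v ∈ ts ] ∑[ y ∈ ps ] edge y v)
      ≡⟨ sym (trans (∑-cong ts (λ _ → ∑-*ˡ ps θ _)) (∑-*ˡ ts θ _)) ⟩
    total (λ v y → θ * edge y v)
      ≤⟨ ∑-mono ts (λ {v} _ → ∑-mono ps (λ {y} y∈ → at v y (ps-perm y∈) (edgeIn? F y (act v y)) (d y <? θ) (d (act v y) <? θ))) ⟩
    total (λ v y → (edge y v * (θ * ⟨ d y <? θ ⟩) + edge y v * (θ * ⟨ d (act v y) <? θ ⟩)) + (K * n * edge y v + (badDeg k y v + badDeg k′ (act v y) v)))
      ≡⟨ trans (total-+ _ _) (cong₂ _+_ (total-+ _ _) (trans (total-+ _ _) (cong (total (λ v y → K * n * edge y v) +_) (total-+ _ _)))) ⟩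
    (total (λ v y → edge y v * (θ * ⟨ d y <? θ ⟩)) + total (λ v y → edge y v * (θ * ⟨ d (act v y) <? θ ⟩)))
      + (total (λ v y → K * n * edge y v) + (total (λ v y → badDeg k y v) + total (λ v y → badDeg k′ (act v y) v)))
      ≤⟨ +-mono-≤ (+-mono-≤ (low-total θ) (low-total′ θ))
           (+-mono-≤ (≤-reflexive (trans (∑-cong ts (λ _ → ∑-*ˡ ps (K * n) _)) (trans (∑-*ˡ ts (K * n) _) (cong (K * n *_) (∑-swap ts ps _)))))
             (+-mono-≤ (bad-total k k≥2) (≤-trans (≤-reflexive (∑-cong ts (λ {v} _ → ∑-act F v (λ y → badDeg k′ y v)))) (bad-total k′ k′≥2)))) ⟩
    (P * (θ * θ) + P * (θ * θ)) + (K * n * S + (P * M k + P * M k′))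
      ≡⟨ lemma P (θ * θ) (K * n * S) (M k) (M k′) ⟩
    2 * (P * (θ * θ)) + K * n * S + P * (M k + M k′) ∎
    where
    open ≤-Reasoning
    total : (Transposition n → Vertex n → ℕ) → ℕ
    total f = ∑[ v ∈ ts ] ∑[ y ∈ ps ] f v y
    total-+ : ∀ f g → total (λ v y → f v y + g v y) ≡ total f + total g
    total-+ f g = trans (∑-cong ts (λ _ → ∑-+ ps _ _)) (∑-+ ts _ _)
    lemma : ∀ p t s a b → (p * t + p * t) + (s + (p * a + p * b)) ≡ 2 * (p * t) + s + p * (a + b)
    lemma = solve-∀
    at : ∀ v y → IsPerm y → (e : Dec (EdgeIn F y (act v y))) (l : Dec (d y < θ)) (l′ : Dec (d (act v y) < θ)) →
         θ * ⟨ e ⟩ ≤ (⟨ e ⟩ * (θ * ⟨ l ⟩) + ⟨ e ⟩ * (θ * ⟨ l′ ⟩)) + (K * n * ⟨ e ⟩ + (badDeg k y v + badDeg k′ (act v y) v))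
    at v y perm (no _) l l′ = ≤-trans (≤-reflexive (*-zeroʳ θ)) z≤n
    at v y perm (yes e) (yes _) l′ = ≤-trans (≤-trans (≤-reflexive (sym (+-identityʳ (θ * 1)))) (m≤m+n _ _)) (m≤m+n _ _)
    at v y perm (yes e) (no _) (yes _) = ≤-trans (≤-trans (≤-reflexive (sym (+-identityʳ (θ * 1)))) (m≤n+m (θ * 1 + 0) (θ * 0 + 0))) (m≤m+n _ _)
    at v y perm (yes e) (no l) (no l′) = begin
      θ * 1                                                ≡⟨ *-identityʳ θ ⟩
      θ                                                    ≤⟨ edge-bound v perm e (≮⇒≥ l) (≮⇒≥ l′) ⟩
      K * n + (badDeg k y v + badDeg k′ (act v y) v)                 ≡⟨ cong (_+ (badDeg k y v + badDeg k′ (act v y) v)) (sym (*-identityʳ (K * n))) ⟩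
      K * n * 1 + (badDeg k y v + badDeg k′ (act v y) v)             ≤⟨ m≤n+m _ ((θ * 0 + 0) + (θ * 0 + 0)) ⟩
      _                                                    ∎

  degreeSum-bound : ∀ θ → 1 ≤ θ → 2 * (K * n) ≤ θ → M k + M k′ ≤ θ * θ → S ≤ 6 * (P * θ)
  degreeSum-bound θ θ≥1 large sparse = *-cancelˡ-≤ θ (+-cancelˡ-≤ (θ * S) _ _ (begin
    θ * S + θ * S                                                         ≡⟨ cong (θ * S +_) (sym (+-identityʳ (θ * S))) ⟩
    2 * (θ * S)                                                           ≤⟨ *-monoʳ-≤ 2 (weighted-bound θ) ⟩
    2 * (2 * (P * (θ * θ)) + K * n * S + P * (M k + M k′))                ≤⟨ *-monoʳ-≤ 2 (+-monoʳ-≤ (2 * (P * (θ * θ)) + K * n * S) (*-monoʳ-≤ P sparse)) ⟩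
    2 * (2 * (P * (θ * θ)) + K * n * S + P * (θ * θ))                     ≡⟨ lemma₁ P θ (K * n) S ⟩
    2 * (K * n) * S + θ * (6 * (P * θ))                                   ≤⟨ +-monoˡ-≤ (θ * (6 * (P * θ))) (*-monoˡ-≤ S large) ⟩
    θ * S + θ * (6 * (P * θ))                                             ∎))
    where
    open ≤-Reasoning
    instance
      θ≢0 = >-nonZero θ≥1
    lemma₁ : ∀ p t a s → 2 * (2 * (p * (t * t)) + a * s + p * (t * t)) ≡ 2 * a * s + t * (6 * (p * t))
    lemma₁ = solve-∀

  -- `c₁` gives M k + M k′ ≤ c₁n³, from n + 5 ≤ 6n and N ≤ n²; the summand `2 * K` ensures 2Kn ≤ θ.
  -- Both are used with θ = c₂ns, where s is near √n.
  c₁ c₂ : ℕ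
  c₁ = 12 * (2 * (k + k′) + 10)
  c₂ = 2 * K + c₁

  edges-bound : 2 ≤ n → numEdges F ^ 2 * n ≤ (48 * c₂ * eCT n) ^ 2
  edges-bound n≥2 = let s , n<s² , s²≤ = root 2 (s≤s z≤n) n n≥1 in with-root s n<s² s²≤
    where
    with-root : ∀ s → n < s ^ 2 → s ^ 2 ≤ 4 * n → numEdges F ^ 2 * n ≤ (48 * c₂ * eCT n) ^ 2
    with-root s n<s² s²≤ = begin
      φ ^ 2 * n                                            ≤⟨ *-monoˡ-≤ n (^-monoˡ-≤ 2 φ≤) ⟩
      (3 * (P * (c₂ * n * s))) ^ 2 * n                     ≡⟨ lemma₁ P c₂ n s ⟩
      9 * (c₂ * c₂) * (P * P) * (n * n * n) * (s ^ 2)      ≤⟨ *-monoʳ-≤ (9 * (c₂ * c₂) * (P * P) * (n * n * n)) s²≤ ⟩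
      9 * (c₂ * c₂) * (P * P) * (n * n * n) * (4 * n)      ≡⟨ lemma₂ P c₂ n ⟩
      36 * (c₂ * c₂) * (P * P) * ((n * n) * (n * n))       ≤⟨ *-monoʳ-≤ (36 * (c₂ * c₂) * (P * P)) (*-mono-≤ (n²≤4*N n≥2) (n²≤4*N n≥2)) ⟩
      36 * (c₂ * c₂) * (P * P) * ((4 * N) * (4 * N))       ≡⟨ lemma₃ P c₂ N ⟩
      576 * (c₂ * c₂) * ((P * N) * (P * N))                ≡⟨ cong (λ z → 576 * (c₂ * c₂) * (z * z)) (PN≡2e n≥2) ⟩
      576 * (c₂ * c₂) * ((2 * eCT n) * (2 * eCT n))        ≡⟨ lemma₄ c₂ (eCT n) ⟩
      (48 * c₂ * eCT n) ^ 2                                ∎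
      where
      open ≤-Reasoning
      φ θ : ℕ
      φ = numEdges F
      θ = c₂ * n * s
      lemma₁ : ∀ p c n s → (3 * (p * (c * n * s))) * ((3 * (p * (c * n * s))) * 1) * n ≡ 9 * (c * c) * (p * p) * (n * n * n) * (s * (s * 1))
      lemma₁ = solve-∀
      lemma₂ : ∀ p c n → 9 * (c * c) * (p * p) * (n * n * n) * (4 * n) ≡ 36 * (c * c) * (p * p) * ((n * n) * (n * n))
      lemma₂ = solve-∀
      lemma₃ : ∀ p c m → 36 * (c * c) * (p * p) * ((4 * m) * (4 * m)) ≡ 576 * (c * c) * ((p * m) * (p * m))
      lemma₃ = solve-∀
      lemma₄ : ∀ c e → 576 * (c * c) * ((2 * e) * (2 * e)) ≡ 48 * c * e * (48 * c * e * 1)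
      lemma₄ = solve-∀
      s≥1 : 1 ≤ s
      s≥1 = base-positive s 1 n<s²
      c₁≥1 : 1 ≤ c₁
      c₁≥1 = *-mono-≤ {1} {12} (s≤s z≤n) (≤-trans (s≤s z≤n) (m≤n+m 10 (2 * (k + k′))))
      c₂≥1 : 1 ≤ c₂
      c₂≥1 = ≤-trans c₁≥1 (m≤n+m c₁ (2 * K))
      θ≥1 : 1 ≤ θ
      θ≥1 = *-mono-≤ (*-mono-≤ c₂≥1 n≥1) s≥1
      large : 2 * (K * n) ≤ θ
      large = begin
        2 * (K * n)      ≡⟨ sym (*-assoc 2 K n) ⟩
        2 * K * n        ≤⟨ *-monoˡ-≤ n (m≤m+n (2 * K) c₁) ⟩
        c₂ * n           ≡⟨ sym (*-identityʳ (c₂ * n)) ⟩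
        c₂ * n * 1       ≤⟨ *-monoʳ-≤ (c₂ * n) s≥1 ⟩
        c₂ * n * s       ∎
      N≤n² : N ≤ n * n
      N≤n² = ≤-trans (≤-reflexive (transpositions-count n)) (<⇒≤ (nC2<n² n n≥1))
      sparse : M k + M k′ ≤ θ * θ
      sparse = begin
        M k + M k′                                      ≡⟨ lemma k k′ n N ⟩
        2 * ((2 * (k + k′) + 10) * (n + 5)) * N         ≤⟨ *-mono-≤ (*-monoʳ-≤ 2 (*-monoʳ-≤ (2 * (k + k′) + 10) (+-monoʳ-≤ n (*-monoʳ-≤ 5 n≥1)))) N≤n² ⟩
        2 * ((2 * (k + k′) + 10) * (n + 5 * n)) * (n * n) ≡⟨ lemma′ (2 * (k + k′) + 10) n ⟩
        c₁ * 1 * (n * n) * n                            ≤⟨ *-mono-≤ (*-monoˡ-≤ (n * n) (*-mono-≤ (m≤n+m c₁ (2 * K)) c₂≥1)) (<⇒≤ n<s²) ⟩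
        c₂ * c₂ * (n * n) * s ^ 2                       ≡⟨ lemma″ c₂ n s ⟩
        θ * θ                                           ∎
        where
        lemma : ∀ k l n m → 2 * ((2 * k + 5) * (n + 5)) * m + 2 * ((2 * l + 5) * (n + 5)) * m ≡ 2 * ((2 * (k + l) + 10) * (n + 5)) * m
        lemma = solve-∀
        lemma′ : ∀ d n → 2 * (d * (n + 5 * n)) * (n * n) ≡ 12 * d * 1 * (n * n) * n
        lemma′ = solve-∀
        lemma″ : ∀ c n s → c * c * (n * n) * (s * (s * 1)) ≡ c * n * s * (c * n * s)
        lemma″ = solve-∀
      φ≤ : φ ≤ 3 * (P * θ)
      φ≤ = *-cancelˡ-≤ 2 (≤-trans (handshake F) (≤-trans (degreeSum-bound θ θ≥1 large sparse) (≤-reflexive (*-assoc 2 3 (P * θ)))))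

-- Use the square bound `i` times and the trivial φ ≤ e for the remaining j - 2i factors.
interpolate : ∀ {φ e n C} i j → 1 ≤ C → 2 * i ≤ j → φ ≤ e → φ ^ 2 * n ≤ (C * e) ^ 2 → φ ^ j * n ^ i ≤ (C * e) ^ j
interpolate {φ} {e} {n} {C} i j C≥1 2i≤j φ≤e φ²n≤ with m≤n⇒∃[o]m+o≡n 2i≤j
... | o , refl = begin
  φ ^ (2 * i + o) * n ^ i          ≡⟨ cong (_* n ^ i) (trans (^-distribˡ-+-* φ (2 * i) o) (cong (_* φ ^ o) (sym (^-*-assoc φ 2 i)))) ⟩
  (φ ^ 2) ^ i * φ ^ o * n ^ i      ≡⟨ lemma ((φ ^ 2) ^ i) (φ ^ o) (n ^ i) ⟩
  (φ ^ 2) ^ i * n ^ i * φ ^ o      ≡⟨ cong (_* φ ^ o) (sym (*-^ (φ ^ 2) n i)) ⟩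
  (φ ^ 2 * n) ^ i * φ ^ o          ≤⟨ *-mono-≤ (^-monoˡ-≤ i φ²n≤) (^-monoˡ-≤ o (≤-trans φ≤e (≤-trans (≤-reflexive (sym (*-identityˡ e))) (*-monoˡ-≤ e C≥1)))) ⟩
  ((C * e) ^ 2) ^ i * (C * e) ^ o  ≡⟨ trans (cong (_* (C * e) ^ o) (^-*-assoc (C * e) 2 i)) (sym (^-distribˡ-+-* (C * e) (2 * i) o)) ⟩
  (C * e) ^ (2 * i + o)            ∎
  where
  open ≤-Reasoning
  lemma : ∀ a b c → a * b * c ≡ a * c * b
  lemma = solve-∀

-- For h = k + 1 an 8-cycle and a 4k-cycle are glued, and 8 + 4k - 2 = 2(1 + 2h). The condition k ≥
-- 2 makes 14 the first length covered.
odd-bound : ∀ h → 3 ≤ h → ∃ λ C → ∀ i j → 2 * i ≤ j → ∀ n → 3 ≤ n → (F : SubgraphCT n) →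
  CycleFree (2 * (1 + 2 * h)) F → PowBound (numEdges F) C n i j (eCT n)
odd-bound (suc k) (s≤s k≥2) = 48 * c , λ i j 2i≤j n 3≤n F free →
  interpolate {numEdges F} {eCT n} {n} i j (≤-trans (s≤s z≤n) (*-monoʳ-≤ 48 c≥1)) 2i≤j (Counts.edges≤eCT F (<⇒≤ 3≤n))
    (OddCycles.edges-bound F (≤-trans (s≤s z≤n) 3≤n) {2} {k} ≤-refl k≥2 (length-eq k) free (<⇒≤ 3≤n))
  where
  c : ℕ
  c = 2 * (16 * (2 + k) + 4) + 12 * (2 * (2 + k) + 10)
  c≥1 : 1 ≤ c
  c≥1 = s≤s z≤n
  length-eq : ∀ k → 2 + 2 * (1 + 2 * suc k) ≡ 2 * (2 * 2) + 2 * (2 * k)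
  length-eq = solve-∀

odd : ∀ l → ¬ (2 ∣ l) → ∃ λ h → l ≡ 1 + 2 * h
odd zero ¬even = ⊥-elim (¬even (divides 0 refl))
odd (suc zero) _ = 0 , refl
odd (suc (suc l)) ¬even with odd l (λ { (divides q refl) → ¬even (divides (suc q) refl) })
... | h , refl = suc h , cong (2 +_) (lemma h)
  where
  lemma : ∀ h → suc (2 * h) ≡ h + suc (h + 0)
  lemma = solve-∀

-- The claimed saving 1/8 - 1/(4(l - 3)) equals (l - 5)/(8(l - 3)), which is below the available
-- 1/2.
odd-exponent-gap : ∀ l → 2 * (l ∸ 5) ≤ 8 * (l ∸ 3)
odd-exponent-gap l = *-mono-≤ {2} {8} (s≤s (s≤s z≤n)) (∸-monoʳ-≤ l (s≤s (s≤s (s≤s (z≤n {2})))))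

theorem1p1 : (∀ (l : ℕ) → 4 ≤ l → 2 ∣ l →
    Σ ℕ λ C → Σ ℕ λ N → ∀ (n : ℕ) → 3 ≤ n → N ≤ n →
    ∀ (F : SubgraphCT n) → CycleFree (2 * l) F →
    PowBound (numEdges F) C n (l ∸ 2) l (eCT n))
    ×
    (Σ ℕ λ C → Σ ℕ λ N → ∀ (n : ℕ) → 3 ≤ n → N ≤ n →
    ∀ (F : SubgraphCT n) → CycleFree (2 * 7) F →
    PowBound (numEdges F) C n 1 7 (eCT n))
    ×
    (∀ (l : ℕ) → 4 ≤ l → ¬ (2 ∣ l) → l ≢ 7 →
    Σ ℕ λ C → Σ ℕ λ N → ∀ (n : ℕ) → 3 ≤ n → N ≤ n →
    ∀ (F : SubgraphCT n) → CycleFree (2 * l) F →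
    PowBound (numEdges F) C n (l ∸ 5) (8 * (l ∸ 3)) (eCT n))
    ×
    (∀ (m : ℕ) → Σ ℕ λ N → ∀ (n : ℕ) → 3 ≤ n → N ≤ n →
    ∀ (F : SubgraphCT n) → CycleFree 6 F →
    ((suc m * (numEdges F + eCT n)) ∸ eCT n) ^ 2
    ≤ 2 * (suc m * eCT n) ^ 2)
    ×
    (∀ (n : ℕ) → 3 ≤ n →
    ∀ (F : SubgraphCT n) → CycleFree 4 F →
    4 * numEdges F ≤ 3 * eCT n)
theorem1p1 = even-bound , case-7 , case-odd , C₆-bound , C₄-bound
  where
  case-7 : Σ ℕ λ C → Σ ℕ λ N → ∀ (n : ℕ) → 3 ≤ n → N ≤ n →
    ∀ (F : SubgraphCT n) → CycleFree (2 * 7) F → PowBound (numEdges F) C n 1 7 (eCT n)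
  case-7 = let C , bound = odd-bound 3 ≤-refl in
    C , 0 , λ n 3≤n _ → bound 1 7 (s≤s (s≤s z≤n)) n 3≤n
  case-odd : ∀ (l : ℕ) → 4 ≤ l → ¬ (2 ∣ l) → l ≢ 7 →
    Σ ℕ λ C → Σ ℕ λ N → ∀ (n : ℕ) → 3 ≤ n → N ≤ n →
    ∀ (F : SubgraphCT n) → CycleFree (2 * l) F → PowBound (numEdges F) C n (l ∸ 5) (8 * (l ∸ 3)) (eCT n)
  case-odd l 4≤l ¬even _ with odd l ¬even
  ... | zero , refl = ⊥-elim (<⇒≱ 4≤l (s≤s z≤n))
  ... | suc zero , refl = ⊥-elim (<⇒≱ 4≤l ≤-refl)
  -- l = 5, where the exponent of n vanishes
  ... | suc (suc zero) , refl = 1 , 0 , λ n 3≤n _ F _ →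
    ≤-trans (≤-reflexive (*-identityʳ _)) (^-monoˡ-≤ 16 (≤-trans (Counts.edges≤eCT F (<⇒≤ 3≤n)) (≤-reflexive (sym (*-identityˡ (eCT n))))))
  ... | suc (suc (suc h)) , refl = let C , bound = odd-bound (3 + h) (s≤s (s≤s (s≤s z≤n))) in
    C , 0 , λ n 3≤n _ → bound (l ∸ 5) (8 * (l ∸ 3)) (odd-exponent-gap l) n 3≤n
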